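{- Let $\epsilon,\delta\in(0,1)$ and $c=(2+\delta)\cdot 14\cdot(3+\epsilon)$. There exists a Streaming algorithm that, for an instance $(V,z,\mathbf{w})$ of the Robust Knapsack Center (RKC) problem, with $V$ of doubling dimension $D$ and with $k$ the minimum cardinality of an optimal solution, computes a $(3+\epsilon)$-approximate solution using either (i) $O(\log(k+z)+D\log(1/\epsilon))$ passes and working memory of size $O\big(\tfrac1\delta\log\tfrac1\delta\,(k+z)(c/\epsilon)^D\big)$; or (ii) for any $\eta\in(0,1)$, $O(1/\eta)$ passes with an extra factor $O(|V|^{\eta})$ in the working memory size, i.e. working memory $O\big(|V|^{\eta}\,\tfrac1\delta\log\tfrac1\delta\,(k+z)(c/\epsilon)^D\big)$.
   Context: $V$ is a finite set of points from a metric space with distance $d$, and $d(i,S)=\min_{c\in S}d(i,c)$. RKC problem: given weights $\mathbf{w}=\{w_i: i\in V\}$ with $w_i\in[0,1]$ and an integer $0\le z<|V|$, find a set $S\subseteq V$ with $\sum_{j\in S}w_j\le 1$ (feasible set) minimizing $$r(S,V,z)=\min_{X\subseteq V:\,|X|\ge |V|-z}\ \max_{i\in X} d(i,S).$$ An $\alpha$-approximate solution is a feasible $S$ whose cost is at most $\alpha$ times the minimum cost. Distances are available through a constant-time oracle. Doubling dimension: the ball of radius $r$ centered at $i\in V$ is the set of points of $V$ at distance at most $r$ from $i$; the doubling dimension of $V$ is the smallest $D$ such that every ball of radius $r$ centered at a point of $V$ is contained in the union of at most $2^D$ balls of radius $r/2$ centered at points of $V$. The algorithm does not know $D$. Streaming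 model: the computation is performed by a single processor with a limited working memory (measured in number of points/words), and the input points are provided as a continuous stream; a pass is one sequential scan of the stream. -}

module Defs where

open import Algebra.Bundles using (Monoid)
import Algebra.Definitions.RawMonoid as RawMonoidDefs
open import Algebra.Structures using (IsCommutativeRing)
open import Data.Bool.Base using (Bool; true; false; not; if_then_else_)
open import Data.Fin.Base using (Fin; fromℕ<)
open import Data.Fin.Subset using (Subset; _∈_; ⊥; ⁅_⁆; _∪_; ∣_∣)
open import Data.List.Base using (List; []; _∷_; allFin)
open import Data.Maybe.Base using (Maybe; just; nothing; map; zipWith; _>>=_)
open import Data.Nat.Base as ℕ using (ℕ)
open import Data.Nat.Properties as ℕₚ using (_<?_)
open import Data.Product.Base using (Σ; ∃; ∃-syntax; _×_; _,_)
open import Data.Unit.Base using (⊤)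
open import Data.Vec.Base using (Vec; foldr′; lookup; replicate; _[_]≔_)
open import Function.Base using (flip)
open import Function.Metric.Structures using (IsGeneralMetric)
open import Relation.Binary.Core using (Rel)
open import Relation.Binary.Structures using (IsDecTotalOrder)
open import Relation.Binary.PropositionalEquality.Core using (_≡_; _≢_)
open import Relation.Nullary.Decidable.Core using (yes; no; does)
import Relation.Binary.Construct.NonStrictToStrict as Strict
open import Level using (0ℓ)

-- `Least _≤_ P v`: v is the minimum of { u | P u }, attained.
Least : {A : Set} → Rel A 0ℓ → (A → Set) → A → Set
Least _≤_ P v = P v × (∀ u → P u → v ≤ u)

-- The real numbers, as a complete ordered field with decidable order.  These
-- axioms determine the structure up to isomorphism; log₂ is then the unique
-- monotone homomorphism from the positive reals to (ℝ, +) with log₂ 2 = 1,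
-- exp₂ is its inverse, and the Archimedean property is (classically) a
-- consequence of completeness.  The values of ⁻¹ at 0 and of log₂ outside the
-- positive reals are unspecified.
record Reals : Set₁ where
  infix  4 _≤_
  infixl 6 _+_
  infixl 7 _*_
  infix  8 -_ _⁻¹
  field
    ℝ                 : Set
    _≤_               : Rel ℝ 0ℓ
    _+_ _*_           : ℝ → ℝ → ℝ
    -_ _⁻¹            : ℝ → ℝ
    0# 1#             : ℝ
    isCommutativeRing : IsCommutativeRing _≡_ _+_ _*_ -_ 0# 1#
    isDecTotalOrder   : IsDecTotalOrder _≡_ _≤_
    0≢1               : 0# ≢ 1#
    ⁻¹-inverseʳ       : ∀ {x} → x ≢ 0# → x * x ⁻¹ ≡ 1#
    +-monoˡ-≤         : ∀ z {x y} → x ≤ y → x + z ≤ y + z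
    *-nonNegative     : ∀ {x y} → 0# ≤ x → 0# ≤ y → 0# ≤ x * y

  open IsCommutativeRing isCommutativeRing public using (+-isMonoid)
  open IsDecTotalOrder isDecTotalOrder public using (_≤?_)
  open Strict _≡_ _≤_ public using (_<_)

  +-monoid : Monoid 0ℓ 0ℓ
  +-monoid = record { isMonoid = +-isMonoid }

  open RawMonoidDefs (Monoid.rawMonoid +-monoid) public using (sum)
  open RawMonoidDefs (Monoid.rawMonoid +-monoid) using () renaming (_×_ to _·_)

  real : ℕ → ℝ
  real n = n · 1#

  UpperBound : (ℝ → Set) → ℝ → Set
  UpperBound P b = ∀ x → P x → x ≤ b

  field
    archimedean : ∀ x → ∃[ n ] x ≤ real n
    complete    : (P : ℝ → Set) → ∃ P → ∃ (UpperBound P) →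
                  ∃ (Least _≤_ (UpperBound P))
    exp₂ log₂   : ℝ → ℝ
    exp₂>0      : ∀ x → 0# < exp₂ x
    log₂-exp₂   : ∀ x → log₂ (exp₂ x) ≡ x
    exp₂-log₂   : ∀ {x} → 0# < x → exp₂ (log₂ x) ≡ x
    log₂-*      : ∀ {x y} → 0# < x → 0# < y → log₂ (x * y) ≡ log₂ x + log₂ y
    log₂-mono-≤ : ∀ {x y} → 0# < x → x ≤ y → log₂ x ≤ log₂ y
    log₂-2      : log₂ (real 2) ≡ 1#

  infixl 7 _/_
  _/_ : ℝ → ℝ → ℝ
  x / y = x * y ⁻¹

  -- Meaningful for positive base only.
  infixr 8 _^_
  _^_ : ℝ → ℝ → ℝ
  x ^ y = exp₂ (y * log₂ x)

  -- max (1 , log₂ x): the usual convention for logarithms under O(·), where a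
  -- logarithmic factor is never read as being smaller than a constant.
  log⁺ : ℝ → ℝ
  log⁺ x = if does (1# ≤? log₂ x) then log₂ x else 1#

module RKC (R : Reals) where
  open Reals R

  -- The points of V are numbered in the order in which the stream presents
  -- them, so quantifying over instances also quantifies over stream orders.
  record Instance : Set where
    field
      n        : ℕ
      d        : Fin n → Fin n → ℝ
      isMetric : IsGeneralMetric _≡_ _≡_ _≤_ 0# _+_ d
      w        : Fin n → ℝ
      0≤w      : ∀ i → 0# ≤ w i
      w≤1      : ∀ i → w i ≤ 1#
      z        : ℕ
      z<n      : z ℕ.< n

  module _ (I : Instance) where
    open Instance I

    Feasible : Subset n → Set
    Feasible S = sum (λ j → if lookup S j then w j else 0#) ≤ 1#

    -- Minima and maxima are given by their graphs.  The distance to the empty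
    -- set is +∞: no real is related to it, hence (as z < n) no real is the
    -- cost of the empty set.
    DistanceTo : Fin n → Subset n → ℝ → Set
    DistanceTo i S = Least _≤_ (λ v → ∃[ c ] c ∈ S × v ≡ d i c)

    MaxDistance : Subset n → Subset n → ℝ → Set
    MaxDistance X S = Least (flip _≤_) (λ v → ∃[ i ] i ∈ X × DistanceTo i S v)

    Cost : Subset n → ℝ → Set
    Cost S = Least _≤_ (λ v → ∃[ X ] n ℕ.∸ z ℕ.≤ ∣ X ∣ × MaxDistance X S v)

    OptimalCost : ℝ → Set
    OptimalCost = Least _≤_ (λ v → ∃[ S ] Feasible S × Cost S v)

    Optimal : Subset n → Set
    Optimal S = Feasible S × (∃[ v ] Cost S v × OptimalCost v)

    MinOptimalCardinality : ℕ → Set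
    MinOptimalCardinality = Least ℕ._≤_ (λ k → ∃[ S ] Optimal S × ∣ S ∣ ≡ k)

    Approximate : ℝ → Subset n → Set
    Approximate α S = Feasible S ×
      (∃[ v ] ∃[ o ] Cost S v × OptimalCost o × v ≤ α * o)

    -- D is real, so 2^D may be any positive integer.
    Doubling : ℝ → Set
    Doubling D = ∀ i r → 0# ≤ r →
      ∃[ T ] real ∣ T ∣ ≤ exp₂ D ×
             (∀ j → d i j ≤ r → ∃[ c ] c ∈ T × d c j ≤ r / real 2)

    DoublingDimension : ℝ → Set
    DoublingDimension = Least _≤_ Doubling

-- Streaming algorithms are programs of a real RAM with multi-pass read access
-- to the stream.  A memory word holds a point (with its weight), a natural
-- number or a real number.  Points are opaque: they can only be copied, and
-- passed to the distance and weight oracles.  There is no rounding operation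
-- from reals to naturals.
module Streaming (R : Reals) where
  open Reals R
  open RKC R

  data Sort : Set where
    point nat num : Sort

  -- Code run inside a scan can refer to the current stream item; passes
  -- cannot be nested.
  data Mode : Set where
    outside inScan : Mode

  data Expr (m : Mode) : Sort → Set where
    load         : ∀ {s} → Expr m nat → Expr m s
    litℕ         : ℕ → Expr m nat
    litℝ         : ℝ → Expr m num
    z-input      : Expr m nat
    _+ℕ_ _∸ℕ_ _*ℕ_ : Expr m nat → Expr m nat → Expr m nat
    toℝ          : Expr m nat → Expr m num
    _+ℝ_ _*ℝ_    : Expr m num → Expr m num → Expr m num
    -ℝ_ _⁻¹ℝ     : Expr m num → Expr m num
    dist         : Expr m point → Expr m point → Expr m num
    weight       : Expr m point → Expr m num
    current      : m ≡ inScan → Expr m point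

  data Test (m : Mode) : Set where
    _≤ℕ_ : Expr m nat → Expr m nat → Test m
    _≤ℝ_ : Expr m num → Expr m num → Test m
    neg  : Test m → Test m

  data Cmd : Mode → Set where
    skip  : ∀ {m} → Cmd m
    store : ∀ {m s} → Expr m nat → Expr m s → Cmd m
    _⨾_   : ∀ {m} → Cmd m → Cmd m → Cmd m
    cond  : ∀ {m} → Test m → Cmd m → Cmd m → Cmd m
    while : ∀ {m} → Test m → Cmd m → Cmd m
    pass  : Cmd inScan → Cmd outside

  Program : Set
  Program = Cmd outside

  module Semantics (I : Instance) (M : ℕ) where
    open Instance I

    Value : Sort → Set
    Value point = Fin n
    Value nat   = ℕ
    Value num   = ℝ

    Word : Set
    Word = Σ Sort Value

    Memory : Set
    Memory = Vec Word M

    Item : Mode → Set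
    Item outside = ⊤
    Item inScan  = Fin n

    as : ∀ s → Word → Maybe (Value s)
    as point (point , v) = just v
    as nat   (nat   , v) = just v
    as num   (num   , v) = just v
    as _     _           = nothing

    read : Memory → ℕ → Maybe Word
    read μ a with a <? M
    ... | yes a<M = just (lookup μ (fromℕ< a<M))
    ... | no  _   = nothing

    -- `nothing`: access outside the memory, or to a word of the wrong sort.
    eval : ∀ {m s} → Item m → Memory → Expr m s → Maybe (Value s)
    eval ρ μ (load {s} a)              = eval ρ μ a >>= λ i → read μ i >>= as s
    eval ρ μ (litℕ k)                  = just k
    eval ρ μ (litℝ x)                  = just x
    eval ρ μ z-input                   = just z
    eval ρ μ (e +ℕ f)                  = zipWith ℕ._+_ (eval ρ μ e) (eval ρ μ f)
    eval ρ μ (e ∸ℕ f)                  = zipWith ℕ._∸_ (eval ρ μ e) (eval ρ μ f)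
    eval ρ μ (e *ℕ f)                  = zipWith ℕ._*_ (eval ρ μ e) (eval ρ μ f)
    eval ρ μ (toℝ e)                   = map real (eval ρ μ e)
    eval ρ μ (e +ℝ f)                  = zipWith _+_ (eval ρ μ e) (eval ρ μ f)
    eval ρ μ (e *ℝ f)                  = zipWith _*_ (eval ρ μ e) (eval ρ μ f)
    eval ρ μ (-ℝ e)                    = map -_ (eval ρ μ e)
    eval ρ μ (e ⁻¹ℝ)                   = map _⁻¹ (eval ρ μ e)
    eval ρ μ (dist p q)                = zipWith d (eval ρ μ p) (eval ρ μ q)
    eval ρ μ (weight p)                = map w (eval ρ μ p)
    eval ρ μ (current _≡_.refl)        = just ρ

    test : ∀ {m} → Item m → Memory → Test m → Maybe Bool
    test ρ μ (e ≤ℕ f) = zipWith (λ x y → does (x ℕₚ.≤? y)) (eval ρ μ e) (eval ρ μ f)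
    test ρ μ (e ≤ℝ f) = zipWith (λ x y → does (x ≤? y)) (eval ρ μ e) (eval ρ μ f)
    test ρ μ (neg t)  = map not (test ρ μ t)

    -- `Exec ρ c μ p μ′`: c terminates, taking μ to μ′ with p passes.
    data Exec : ∀ {m} → Item m → Cmd m → Memory → ℕ → Memory → Set
    data Scan (c : Cmd inScan) : List (Fin n) → Memory → Memory → Set

    data Exec where
      skip  : ∀ {m} {ρ : Item m} {μ} → Exec ρ skip μ 0 μ
      store : ∀ {m s} {ρ : Item m} {μ} {a : Expr m nat} {e : Expr m s} {i v} →
              eval ρ μ a ≡ just i → (i<M : i ℕ.< M) → eval ρ μ e ≡ just v →
              Exec ρ (store a e) μ 0 (μ [ fromℕ< i<M ]≔ (s , v))
      seq   : ∀ {m} {ρ : Item m} {c c′ μ μ′ μ″ p p′} →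
              Exec ρ c μ p μ′ → Exec ρ c′ μ′ p′ μ″ →
              Exec ρ (c ⨾ c′) μ (p ℕ.+ p′) μ″
      cond  : ∀ {m} {ρ : Item m} {t c c′ μ μ′ p b} →
              test ρ μ t ≡ just b → Exec ρ (if b then c else c′) μ p μ′ →
              Exec ρ (cond t c c′) μ p μ′
      stop  : ∀ {m} {ρ : Item m} {t c μ} →
              test ρ μ t ≡ just false → Exec ρ (while t c) μ 0 μ
      step  : ∀ {m} {ρ : Item m} {t c μ μ′ p} →
              test ρ μ t ≡ just true → Exec ρ (c ⨾ while t c) μ p μ′ →
              Exec ρ (while t c) μ p μ′
      pass  : ∀ {ρ c μ μ′} → Scan c (allFin n) μ μ′ → Exec ρ (pass c) μ 1 μ′

    data Scan c where
      []  : ∀ {μ} → Scan c [] μ μ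
      _∷_ : ∀ {i is μ μ′ μ″ p} →
            Exec i c μ p μ′ → Scan c is μ′ μ″ → Scan c (i ∷ is) μ μ″

    initial : Memory
    initial = replicate M (nat , 0)

    -- The output is the set of the points left in memory.
    output : Memory → Subset n
    output = foldr′ (λ { (point , i) S → ⁅ i ⁆ ∪ S ; _ S → S }) ⊥

  -- P, run on I with some number of memory words that is at most W, halts
  -- after at most T passes with an α-approximate solution.  A run that tries
  -- to use more words than it is given gets stuck.
  Solves : Program → Instance → (α T W : ℝ) → Set
  Solves P I α T W =
    ∃[ M ] let open Semantics I M in
    ∃[ p ] ∃[ μ ] Exec _ P initial p μ
      × Approximate I α (output μ)
      × real p ≤ T
      × real M ≤ W

-- Time is not bounded in this model, so the offline problem on a coreset can be
-- solved by exhaustive search, which already gives factor 3; ε and δ only loosen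
-- the space bound.
--
-- For a guess m, one pass of the doubling algorithm keeps at most m pivots that
-- cover V within a radius r, and a second pass counts the points of each cluster
-- and records the cheapest point near each pivot.  Let v be the least radius
-- such that some feasible set of these representatives has n − z points in
-- clusters whose pivots are within v of the pivot of a selected cluster.  Moving
-- between points and pivots costs r, so the optimum o satisfies v ≤ o + 2r, and
-- the set found has cost at most v + 2r.  The guess is accepted if 4r ≤ v: then
-- 2r ≤ o and the cost is at most 3o.  Otherwise m is multiplied by g.
--
-- A guess is accepted as soon as m balls of radius o/64 cover V, because the
-- doubling algorithm then ends with r ≤ o/8.  The k centres of an optimal
-- solution and its z outliers cover V within o, so (k + z) 64^D such balls
-- suffice, as do n balls of radius 0.  With g = 2 there are O(log (k + z) + D)
-- guesses; with the least g such that g^⌈1/η⌉ ≥ n there are O(1/η) of them, and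
-- g = O(n^η).

module Submission where

open import Defs
open import Algebra.Bundles using (CommutativeRing)
import Algebra.Properties.Monoid.Mult as MonoidMult
import Algebra.Properties.Ring as RingProperties
import Algebra.Properties.Semiring.Mult as SemiringMult
open import Data.Bool.Base as Bool using (Bool; _∧_; _∨_; false; if_then_else_; not; true)
open import Data.Fin as Fin using (Fin; fromℕ<; suc; toℕ; zero)
open import Data.Fin.Properties as Finₚ using (any?; fromℕ<-toℕ; pigeonhole; toℕ-fromℕ<; toℕ-injective; toℕ<n)
open import Data.Fin.Subset using (Nonempty; Subset; _∪_; inside; outside; ⁅_⁆; ∁; ∣_∣) renaming (_∈_ to _∈ₛ_; ⊥ to ⊥ₛ)
open import Data.Fin.Subset.Properties using (Empty-unique; _∈?_; nonempty?; x∈p⇒∣p-x∣<∣p∣; x∈p∪q⁺; x∈p∪q⁻; x∈⁅x⁆; x∈⁅y⁆⇒x≡y; x∉p⇒x∈∁p; ∉⊥; ∣∁p∣≡n∸∣p∣; ∣⊥∣≡0)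
open import Data.List.Base as List using (List; []; _++_; _∷_; allFin; cartesianProduct; concatMap; filter; foldr; length; upTo)
open import Data.List.Membership.Propositional using (_∈_)
open import Data.List.Membership.Propositional.Properties using (∈-++⁺ʳ; ∈-++⁺ˡ; ∈-allFin; ∈-cartesianProduct⁺; ∈-concatMap⁺; ∈-filter⁺; ∈-map⁺; ∈-upTo⁺)
open import Data.List.Properties using (length-++; length-tabulate)
open import Data.List.Relation.Unary.Any as Any using (Any; here; there)
open import Data.Maybe.Base using (Maybe; just)
open import Data.Maybe.Properties using (just-injective)
open import Data.Nat.Base as ℕ using (_≡ᵇ_; suc; s≤s; zero; z≤n; ℕ)
open import Data.Nat.DivMod using ([m+kn]%n≡m%n; m%n<n; m<n*o⇒m/o<n; m<n⇒m%n≡m; m≡m%n+[m/n]*n)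
import Data.Nat.Properties as ℕₚ
open import Data.Product.Base using (_,_; _×_; proj₁; proj₂; uncurry; Σ; ∃; ∃-syntax)
open import Data.Sum.Base using ([_,_]; _⊎_; inj₁; inj₂)
open import Data.Unit.Base using (tt)
open import Data.Vec.Base as Vec using (Vec; []; _[_]≔_; _∷_; foldr′; lookup; tabulate)
open import Data.Vec.Properties using ([]=⇒lookup; lookup-replicate; lookup⇒[]=; lookup∘tabulate; lookup∘update; lookup∘update′; tabulate∘lookup)
open import Function.Base using (_∘_; flip; id)
open import Function.Metric.Structures using (IsGeneralMetric)
open import Level using (0ℓ)
open import Relation.Binary.Core using (Rel)
open import Relation.Binary.Definitions using (Total; Transitive)
open import Relation.Binary.PropositionalEquality hiding ([_])
open import Relation.Binary.Structures using (IsDecTotalOrder)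
open import Relation.Nullary using (Dec; contradiction; does; no; yes; ¬_)
open import Relation.Nullary.Decidable using (_×-dec_; dec-false; dec-true)
open import Relation.Unary using (Decidable)

-- The machine is unforgiving: it gets stuck on a word of the wrong sort or an address outside its
-- memory, whose size M is fixed before the run although the program knows none of M, k and D. Hence
-- the table layout: once a row is set up, its words never change sort; rows are added only when a
-- guess calls for them; and M is chosen after the fact as exactly the table of the accepted guess
-- m, with m + 1 rows of 43 words. The algorithm is analysed in a small language whose commands are
-- total functions on typed states. One simulation lemma carries the analysis to the machine; only
-- the adding of rows, the passes and the loop over guesses are treated on the machine itself. All
-- bounds are read off the last rejected guess: rejection proves it smaller than every cover of
-- radius o/64, and the accepted guess is only g times larger. Six halvings lead from o to o/64,
-- which is why the radius is taken to be a power of two below o.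

module RealLemmas (R : Reals) where
  open Reals R

  -- Ordered field arithmetic, exponentials and logarithms.

  commutativeRing : CommutativeRing _ _
  commutativeRing = record { isCommutativeRing = isCommutativeRing }

  open CommutativeRing commutativeRing public
    using (+-assoc; +-comm; +-identityˡ; +-identityʳ; *-comm; *-assoc; *-identityˡ; *-identityʳ;
           distribˡ; distribʳ; -‿inverseˡ; -‿inverseʳ; zeroˡ; zeroʳ; semiring; ring)
  open IsDecTotalOrder isDecTotalOrder public using ()
    renaming (refl to ≤-refl; reflexive to ≤-reflexive; trans to ≤-trans; antisym to ≤-antisym; total to ≤-total)
  module Ring = RingProperties ring

  ≰⇒≥ : ∀ {x y} → ¬ x ≤ y → y ≤ x
  ≰⇒≥ {x} {y} ne = [ (λ le → contradiction le ne) , (λ ge → ge) ] (≤-total x y)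

  +-monoʳ-≤ : ∀ z {x y} → x ≤ y → z + x ≤ z + y
  +-monoʳ-≤ z {x} {y} le = subst₂ _≤_ (+-comm x z) (+-comm y z) (+-monoˡ-≤ z le)

  +-mono-≤ : ∀ {x y u v} → x ≤ y → u ≤ v → x + u ≤ y + v
  +-mono-≤ {x} {y} {u} {v} p q = ≤-trans (+-monoˡ-≤ u p) (+-monoʳ-≤ y q)

  +-cancelʳ-≤ : ∀ z {x y} → x + z ≤ y + z → x ≤ y
  +-cancelʳ-≤ z {x} {y} le = subst₂ _≤_ (undo x) (undo y) (+-monoˡ-≤ (- z) le)
    where
    undo : ∀ u → u + z + - z ≡ u
    undo u = trans (+-assoc u z (- z)) (trans (cong (u +_) (-‿inverseʳ z)) (+-identityʳ u))

  0≤-x : ∀ {x} → x ≤ 0# → 0# ≤ - x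
  0≤-x {x} le = subst₂ _≤_ (-‿inverseʳ x) (+-identityˡ _) (+-monoˡ-≤ (- x) le)

  +-nonNegative : ∀ {x y} → 0# ≤ x → 0# ≤ y → 0# ≤ x + y
  +-nonNegative {x} {y} p q = subst (_≤ x + y) (+-identityˡ 0#) (+-mono-≤ p q)

  x≤x+y : ∀ {x y} → 0# ≤ y → x ≤ x + y
  x≤x+y {x} {y} le = subst (_≤ x + y) (+-identityʳ x) (+-monoʳ-≤ x le)

  *-monoˡ-≤ : ∀ {z x y} → 0# ≤ z → x ≤ y → x * z ≤ y * z
  *-monoˡ-≤ {z} {x} {y} 0≤z le = +-cancelʳ-≤ (- (x * z)) (subst₂ _≤_ (sym (-‿inverseʳ (x * z))) eq
    (*-nonNegative (subst (_≤ y + - x) (-‿inverseʳ x) (+-monoˡ-≤ (- x) le)) 0≤z))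
    where
    eq : (y + - x) * z ≡ y * z + - (x * z)
    eq = trans (distribʳ z y (- x)) (cong (y * z +_) (sym (Ring.-‿distribˡ-* x z)))

  *-monoʳ-≤ : ∀ {z x y} → 0# ≤ z → x ≤ y → z * x ≤ z * y
  *-monoʳ-≤ {z} {x} {y} 0≤z le = subst₂ _≤_ (*-comm x z) (*-comm y z) (*-monoˡ-≤ 0≤z le)

  *-mono-≤ : ∀ {x y u v} → 0# ≤ u → 0# ≤ y → x ≤ y → u ≤ v → x * u ≤ y * v
  *-mono-≤ 0≤u 0≤y p q = ≤-trans (*-monoˡ-≤ 0≤u p) (*-monoʳ-≤ 0≤y q)

  -1*-1 : - 1# * - 1# ≡ 1#
  -1*-1 = trans (Ring.-1*x≈-x (- 1#)) (Ring.-‿involutive 1#)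

  -- If 1 ≤ 0, then -1 is nonnegative, and so is its square, which is 1.
  0≤1 : 0# ≤ 1#
  0≤1 = [ (λ p → p) , (λ p → subst (0# ≤_) -1*-1 (*-nonNegative (0≤-x p) (0≤-x p))) ] (≤-total 0# 1#)

  1≰0 : ¬ 1# ≤ 0#
  1≰0 le = 0≢1 (≤-antisym 0≤1 le)

  real-+ : ∀ k l → real (k ℕ.+ l) ≡ real k + real l
  real-+ = MonoidMult.×-homo-+ +-monoid 1#

  real-* : ∀ k l → real (k ℕ.* l) ≡ real k * real l
  real-* = SemiringMult.×1-homo-* semiring

  0≤real : ∀ k → 0# ≤ real k
  0≤real zero    = ≤-refl
  0≤real (suc k) = +-nonNegative 0≤1 (0≤real k)

  real-mono : ∀ {k l} → k ℕ.≤ l → real k ≤ real l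
  real-mono {l = l} z≤n = 0≤real l
  real-mono (s≤s le)    = +-monoʳ-≤ 1# (real-mono le)

  real-1 : real 1 ≡ 1#
  real-1 = +-identityʳ 1#

  1≤real : ∀ {k} → 1 ℕ.≤ k → 1# ≤ real k
  1≤real {k} le = subst (_≤ real k) real-1 (real-mono le)

  double : ∀ x → x * real 2 ≡ x + x
  double x = begin
    x * (1# + real 1)     ≡⟨ distribˡ x 1# (real 1) ⟩
    x * 1# + x * real 1   ≡⟨ cong (λ e → x * 1# + x * e) real-1 ⟩
    x * 1# + x * 1#       ≡⟨ cong₂ _+_ (*-identityʳ x) (*-identityʳ x) ⟩
    x + x                 ∎
    where open ≡-Reasoning

  0<1 : 0# < 1#
  0<1 = 0≤1 , 0≢1

  <-≤⇒< : ∀ {x y z} → x < y → y ≤ z → x < z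
  <-≤⇒< {x} {y} {z} (le , ne) le′ = ≤-trans le le′ , λ { refl → ne (≤-antisym le le′) }

  0<⇒≢ : ∀ {x} → 0# < x → x ≢ 0#
  0<⇒≢ (_ , ne) eq = ne (sym eq)

  *-inverse : ∀ {x} → 0# < x → x * x ⁻¹ ≡ 1#
  *-inverse pos = ⁻¹-inverseʳ (0<⇒≢ pos)

  -- If the inverse were at most 0, multiplying its negative by x would make -1 nonnegative.
  0≤⁻¹ : ∀ {x} → 0# < x → 0# ≤ x ⁻¹
  0≤⁻¹ {x} pos@(0≤x , _) with ≤-total 0# (x ⁻¹)
  ... | inj₁ p = p
  ... | inj₂ q = contradiction
    (+-cancelʳ-≤ (- 1#) (subst₂ _≤_ (sym (-‿inverseʳ 1#))
      (trans (sym (Ring.-‿distribʳ-* x (x ⁻¹))) (trans (cong -_ (*-inverse pos)) (sym (+-identityˡ _))))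
      (*-nonNegative 0≤x (0≤-x q))))
    1≰0

  1≤⁻¹ : ∀ {x} → 0# < x → x ≤ 1# → 1# ≤ x ⁻¹
  1≤⁻¹ pos le = subst₂ _≤_ (*-inverse pos) (*-identityˡ _) (*-monoˡ-≤ (0≤⁻¹ pos) le)

  half+half : ∀ x → x / real 2 + x / real 2 ≡ x
  half+half x = trans (sym (double _)) (trans (*-assoc x _ _)
    (trans (cong (x *_) (trans (*-comm _ _) (*-inverse 0<2))) (*-identityʳ x)))
    where
    0<2 : 0# < real 2
    0<2 = <-≤⇒< 0<1 (1≤real {2} (s≤s z≤n))

  double-half : ∀ x → (x + x) / real 2 ≡ x
  double-half x = trans (cong (_* real 2 ⁻¹) (sym (double x))) (trans (*-assoc x _ _)
    (trans (cong (x *_) (*-inverse (<-≤⇒< 0<1 (1≤real {2} (s≤s z≤n))))) (*-identityʳ x)))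

  *-positive : ∀ {x y} → 0# < x → 0# < y → 0# < x * y
  *-positive {x} {y} px@(0≤x , _) (0≤y , 0≢y) = *-nonNegative 0≤x 0≤y , λ 0≡xy → 0≢y (sym (begin
    y                    ≡⟨ *-identityˡ y ⟨
    1# * y               ≡⟨ cong (_* y) (trans (*-comm _ _) (*-inverse px)) ⟨
    x ⁻¹ * x * y         ≡⟨ *-assoc _ x y ⟩
    x ⁻¹ * (x * y)       ≡⟨ cong (x ⁻¹ *_) 0≡xy ⟨
    x ⁻¹ * 0#            ≡⟨ zeroʳ _ ⟩
    0#                   ∎))
    where open ≡-Reasoning

  -- Monotonicity is an axiom for `log₂` only. In the case `exp₂ y ≤ exp₂ x`, taking logarithms
  -- gives y ≤ x, so that x = y.
  exp₂-mono : ∀ {x y} → x ≤ y → exp₂ x ≤ exp₂ y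
  exp₂-mono {x} {y} le with ≤-total (exp₂ x) (exp₂ y)
  ... | inj₁ p = p
  ... | inj₂ q = ≤-reflexive (cong exp₂ (≤-antisym le
        (subst₂ _≤_ (log₂-exp₂ y) (log₂-exp₂ x) (log₂-mono-≤ (exp₂>0 y) q))))

  exp₂-+ : ∀ x y → exp₂ (x + y) ≡ exp₂ x * exp₂ y
  exp₂-+ x y = trans
    (cong exp₂ (sym (trans (log₂-* (exp₂>0 x) (exp₂>0 y)) (cong₂ _+_ (log₂-exp₂ x) (log₂-exp₂ y)))))
    (exp₂-log₂ (*-positive (exp₂>0 x) (exp₂>0 y)))

  log₂-1 : log₂ 1# ≡ 0#
  log₂-1 = begin
    log₂ 1#                                   ≡⟨ +-identityʳ _ ⟨
    log₂ 1# + 0#                              ≡⟨ cong (log₂ 1# +_) (-‿inverseʳ (log₂ 1#)) ⟨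
    log₂ 1# + (log₂ 1# + - log₂ 1#)           ≡⟨ +-assoc _ _ _ ⟨
    log₂ 1# + log₂ 1# + - log₂ 1#             ≡⟨ cong (_+ - log₂ 1#) (log₂-* 0<1 0<1) ⟨
    log₂ (1# * 1#) + - log₂ 1#                ≡⟨ cong (λ e → log₂ e + - log₂ 1#) (*-identityˡ 1#) ⟩
    log₂ 1# + - log₂ 1#                       ≡⟨ -‿inverseʳ _ ⟩
    0#                                        ∎
    where open ≡-Reasoning

  0≤log₂ : ∀ {x} → 1# ≤ x → 0# ≤ log₂ x
  0≤log₂ le = subst (_≤ log₂ _) log₂-1 (log₂-mono-≤ 0<1 le)

  exp₂-0 : exp₂ 0# ≡ 1#
  exp₂-0 = trans (cong exp₂ (sym log₂-1)) (exp₂-log₂ 0<1)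

  1≤exp₂ : ∀ {x} → 0# ≤ x → 1# ≤ exp₂ x
  1≤exp₂ le = subst (_≤ exp₂ _) exp₂-0 (exp₂-mono le)

  1≤log⁺ : ∀ x → 1# ≤ log⁺ x
  1≤log⁺ x with 1# ≤? log₂ x
  ... | yes p = p
  ... | no _  = ≤-refl

  log₂≤log⁺ : ∀ x → log₂ x ≤ log⁺ x
  log₂≤log⁺ x with 1# ≤? log₂ x
  ... | yes p = ≤-refl
  ... | no ¬p = ≰⇒≥ ¬p

-- A structured language over a table of typed columns, and its simulation on the machine.

module Machine (R : Reals) where
  open Reals R
  open RKC R
  open Streaming R

  -- The sort of a variable is the sort of its whole column, so an address determines the sort of
  -- its word and typed loads cannot get stuck.
  data Var : Sort → Set where
    N : Fin 32 → Var nat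
    Q : Fin 6  → Var num
    P : Fin 5  → Var point

  W : ℕ
  W = 43

  class : ∀ {s} → Var s → ℕ
  class (N x) = toℕ x
  class (Q x) = 32 ℕ.+ toℕ x
  class (P x) = 38 ℕ.+ toℕ x

  class<W : ∀ {s} (x : Var s) → class x ℕ.< W
  class<W (N x) = ℕₚ.<-≤-trans (toℕ<n x) (ℕₚ.m≤m+n 32 11)
  class<W (Q x) = ℕₚ.<-≤-trans (ℕₚ.+-monoʳ-< 32 (toℕ<n x)) (ℕₚ.m≤m+n 38 5)
  class<W (P x) = ℕₚ.+-monoʳ-< 38 (toℕ<n x)

  same : ∀ {s s′} → Var s → Var s′ → Bool
  same (N x) (N y) = toℕ x ≡ᵇ toℕ y
  same (Q x) (Q y) = toℕ x ≡ᵇ toℕ y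
  same (P x) (P y) = toℕ x ≡ᵇ toℕ y
  same _     _     = false

  -- Memory is a table with a column for each variable and `sz` rows; scalars
  -- occupy row 0.
  addr : ∀ {s} → Var s → ℕ → ℕ
  addr x t = class x ℕ.+ t ℕ.* W

  sz : Var nat
  sz = N (Fin.zero)

  data HExpr : Sort → Set where
    !_    : ∀ {s} → Var s → HExpr s
    #_    : ℕ → HExpr nat
    real# : ℝ → HExpr num
    zin   : HExpr nat
    _⊕_ _⊖_ _⊗_ : HExpr nat → HExpr nat → HExpr nat
    _⊞_   : HExpr num → HExpr num → HExpr num
    δ⟨_,_⟩ : HExpr point → HExpr point → HExpr num
    wt    : HExpr point → HExpr num

  data HTest : Set where
    _≼_ : HExpr nat → HExpr nat → HTest
    _⊑_ : HExpr num → HExpr num → HTest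

  infixr 4 _⨟_
  infix 5 _≔_ _≼_ _⊑_
  infixl 6 _⊕_ _⊖_ _⊞_
  infixl 7 _⊗_
  infix 8 !_ #_

  -- Array accesses outside the first `sz` cells are skipped, so that every
  -- command runs to completion.
  data HCmd : Set where
    nop   : HCmd
    _≔_   : ∀ {s} → Var s → HExpr s → HCmd
    fetch : ∀ {s} → Var s → Var s → HExpr nat → HCmd
    save  : ∀ {s} → Var s → HExpr nat → HExpr s → HCmd
    _⨟_   : HCmd → HCmd → HCmd
    when  : HTest → HCmd → HCmd → HCmd
    for   : Var nat → Var nat → HCmd → HCmd

  compE : ∀ {m s} → HExpr s → Expr m s
  compE (! x)        = load (litℕ (addr x 0))
  compE (# k)        = litℕ k
  compE (real# x)    = litℝ x
  compE zin          = z-input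
  compE (e ⊕ f)      = compE e +ℕ compE f
  compE (e ⊖ f)      = compE e ∸ℕ compE f
  compE (e ⊗ f)      = compE e *ℕ compE f
  compE (e ⊞ f)      = compE e +ℝ compE f
  compE δ⟨ e , f ⟩   = dist (compE e) (compE f)
  compE (wt e)       = weight (compE e)

  compT : ∀ {m} → HTest → Test m
  compT (e ≼ f) = compE e ≤ℕ compE f
  compT (e ⊑ f) = compE e ≤ℝ compE f

  cell : ∀ {m s} → Var s → HExpr nat → Expr m nat
  cell x e = litℕ (class x) +ℕ (compE e *ℕ litℕ W)

  put : ∀ {m s} → Var s → HExpr s → Cmd m
  put x e = store (litℕ (addr x 0)) (compE e)

  compile : ∀ {m} → HCmd → Cmd m
  compile nop           = skip
  compile (x ≔ e)       = put x e
  compile (fetch {s} x a e) =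
    cond (compT ((e ⊕ # 1) ≼ ! sz)) (store {s = s} (litℕ (addr x 0)) (load (cell a e))) skip
  compile (save a e f)  = cond (compT ((e ⊕ # 1) ≼ ! sz)) (store (cell a e) (compE f)) skip
  compile (c ⨟ c′)      = compile c ⨾ compile c′
  compile (when t c c′) = cond (compT t) (compile c) (compile c′)
  compile (for i b c)   =
    put i (# 0) ⨾ while (compT ((! i ⊕ # 1) ≼ ! b)) (compile c ⨾ put i (! i ⊕ # 1))

  -- Boolean, so that on a concrete command every frame condition is proved by `refl`.
  touches : HCmd → ∀ {s} → Var s → Bool
  touches nop           y = false
  touches (x ≔ e)       y = same x y
  touches (fetch x a e) y = same x y
  touches (save a e f)  y = same a y
  touches (c ⨟ c′)      y = touches c y ∨ touches c′ y
  touches (when t c c′) y = touches c y ∨ touches c′ y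
  touches (for i b c)   y = same i y ∨ touches c y

  -- The body of a loop writes neither index nor bound, so the loop turns exactly as often as the
  -- bound says at entry. No command writes `sz`, so the guards of `fetch` and `save` always delimit
  -- the rows that exist.
  wf : HCmd → Bool
  wf (c ⨟ c′)      = wf c ∧ wf c′
  wf (when t c c′) = wf c ∧ wf c′
  wf (for i b c)   = not (same i sz) ∧ not (touches c i) ∧ not (touches c b) ∧ not (same i b) ∧ wf c
  wf c             = not (touches c sz)

  module Run (I : Instance) where
    open Instance I

    Val : Sort → Set
    Val point = Fin n
    Val nat   = ℕ
    Val num   = ℝ

    -- Columns are total functions of the row, so that `run` needs no bounds; `Rep` will tie only
    -- the rows below `sz` to memory.
    record State : Set where
      constructor state
      field at : ∀ {s} → Var s → ℕ → Val s
    open State public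

    infix 9 _·_
    _·_ : ∀ {s} → State → Var s → Val s
    σ · x = at σ x 0

    private
      ifEq : ∀ {A : Set} → Bool → ℕ → ℕ → A → A → A
      ifEq b t t′ v u = if b ∧ (t ≡ᵇ t′) then v else u

    upd′ : ∀ {s} → Var s → ℕ → Val s → State → ∀ {s′} → Var s′ → ℕ → Val s′
    upd′ (N x) t v σ (N y) t′ = ifEq (toℕ x ≡ᵇ toℕ y) t t′ v (at σ (N y) t′)
    upd′ (Q x) t v σ (Q y) t′ = ifEq (toℕ x ≡ᵇ toℕ y) t t′ v (at σ (Q y) t′)
    upd′ (P x) t v σ (P y) t′ = ifEq (toℕ x ≡ᵇ toℕ y) t t′ v (at σ (P y) t′)
    upd′ (N x) t v σ y t′ = at σ y t′
    upd′ (Q x) t v σ y t′ = at σ y t′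
    upd′ (P x) t v σ y t′ = at σ y t′

    upd : ∀ {s} → Var s → ℕ → Val s → State → State
    upd x t v σ = state (upd′ x t v σ)

    ev : ∀ {s} → HExpr s → State → Val s
    ev (! x)      σ = σ · x
    ev (# k)      σ = k
    ev (real# x)  σ = x
    ev zin        σ = z
    ev (e ⊕ f)    σ = ev e σ ℕ.+ ev f σ
    ev (e ⊖ f)    σ = ev e σ ℕ.∸ ev f σ
    ev (e ⊗ f)    σ = ev e σ ℕ.* ev f σ
    ev (e ⊞ f)    σ = ev e σ + ev f σ
    ev δ⟨ e , f ⟩ σ = d (ev e σ) (ev f σ)
    ev (wt e)     σ = w (ev e σ)

    Holds : HTest → State → Set
    Holds (e ≼ f) σ = ev e σ ℕ.≤ ev f σ
    Holds (e ⊑ f) σ = ev e σ ≤ ev f σ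

    holds? : ∀ t σ → Dec (Holds t σ)
    holds? (e ≼ f) σ = ev e σ ℕₚ.≤? ev f σ
    holds? (e ⊑ f) σ = ev e σ ≤? ev f σ

    iterate : (State → State) → ℕ → State → State
    iterate f zero    σ = σ
    iterate f (suc k) σ = iterate f k (f σ)

    bump : Var nat → State → State
    bump i σ = upd i 0 (σ · i ℕ.+ 1) σ

    run : HCmd → State → State
    run nop           σ = σ
    run (x ≔ e)       σ = upd x 0 (ev e σ) σ
    run (fetch x a e) σ = if does (ev e σ ℕ.+ 1 ℕₚ.≤? σ · sz) then upd x 0 (at σ a (ev e σ)) σ else σ
    run (save a e f)  σ = if does (ev e σ ℕ.+ 1 ℕₚ.≤? σ · sz) then upd a (ev e σ) (ev f σ) σ else σ
    run (c ⨟ c′)      σ = run c′ (run c σ)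
    run (when t c c′) σ = if does (holds? t σ) then run c σ else run c′ σ
    -- The bound is read once. The machine tests it again at each turn, and `wf` makes the two
    -- agree.
    run (for i b c)   σ = iterate (λ τ → bump i (run c τ)) (σ · b) (upd i 0 0 σ)

    ≡ᵇ-refl : ∀ t → (t ≡ᵇ t) ≡ true
    ≡ᵇ-refl zero    = refl
    ≡ᵇ-refl (suc t) = ≡ᵇ-refl t

    ≡ᵇ⇒≡ : ∀ t t′ → (t ≡ᵇ t′) ≡ true → t ≡ t′
    ≡ᵇ⇒≡ t t′ eq = ℕₚ.≡ᵇ⇒≡ t t′ (subst Bool.T (sym eq) tt)

    upd-same : ∀ {s} (x : Var s) t v σ → at (upd x t v σ) x t ≡ v
    upd-same (N x) t v σ rewrite ≡ᵇ-refl (toℕ x) | ≡ᵇ-refl t = refl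
    upd-same (Q x) t v σ rewrite ≡ᵇ-refl (toℕ x) | ≡ᵇ-refl t = refl
    upd-same (P x) t v σ rewrite ≡ᵇ-refl (toℕ x) | ≡ᵇ-refl t = refl

    upd-var : ∀ {s s′} (x : Var s) t v σ (y : Var s′) t′ →
              same x y ≡ false → at (upd x t v σ) y t′ ≡ at σ y t′
    upd-var (N x) t v σ (N y) t′ eq rewrite eq = refl
    upd-var (Q x) t v σ (Q y) t′ eq rewrite eq = refl
    upd-var (P x) t v σ (P y) t′ eq rewrite eq = refl
    upd-var (N x) t v σ (Q y) t′ eq = refl
    upd-var (N x) t v σ (P y) t′ eq = refl
    upd-var (Q x) t v σ (N y) t′ eq = refl
    upd-var (Q x) t v σ (P y) t′ eq = refl
    upd-var (P x) t v σ (N y) t′ eq = refl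
    upd-var (P x) t v σ (Q y) t′ eq = refl

    ≢⇒≡ᵇ : ∀ {t t′} → t ≢ t′ → (t ≡ᵇ t′) ≡ false
    ≢⇒≡ᵇ {t} {t′} ne with t ≡ᵇ t′ in eq
    ... | true  = contradiction (≡ᵇ⇒≡ t t′ eq) ne
    ... | false = refl

    upd-index : ∀ {s} (x : Var s) t v σ {t′} → t ≢ t′ → at (upd x t v σ) x t′ ≡ at σ x t′
    upd-index (N x) t v σ ne rewrite ≡ᵇ-refl (toℕ x) | ≢⇒≡ᵇ ne = refl
    upd-index (Q x) t v σ ne rewrite ≡ᵇ-refl (toℕ x) | ≢⇒≡ᵇ ne = refl
    upd-index (P x) t v σ ne rewrite ≡ᵇ-refl (toℕ x) | ≢⇒≡ᵇ ne = refl

    ∨-false : ∀ b {c} → b ∨ c ≡ false → b ≡ false × c ≡ false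
    ∨-false false eq = refl , eq

    ∧-true : ∀ b {c} → b ∧ c ≡ true → b ≡ true × c ≡ true
    ∧-true true eq = refl , eq

    not-true : ∀ {b} → not b ≡ true → b ≡ false
    not-true {false} _ = refl

    record WfFor (i b : Var nat) (c : HCmd) : Set where
      field
        i≢sz : same i sz ≡ false
        i∉c  : touches c i ≡ false
        b∉c  : touches c b ≡ false
        i≢b  : same i b ≡ false
        wfc  : wf c ≡ true

    wf-for⁻ : ∀ i b c → wf (for i b c) ≡ true → WfFor i b c
    wf-for⁻ i b c ok with ∧-true (not (same i sz)) ok
    ... | p , ok₁ with ∧-true (not (touches c i)) ok₁
    ... | q , ok₂ with ∧-true (not (touches c b)) ok₂
    ... | r , ok₃ with ∧-true (not (same i b)) ok₃
    ... | s , t = record { i≢sz = not-true p ; i∉c = not-true q ; b∉c = not-true r ; i≢b = not-true s ; wfc = t }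

    frame : ∀ c σ {s} (y : Var s) → touches c y ≡ false → ∀ t → at (run c σ) y t ≡ at σ y t
    iterate-frame : ∀ f → ∀ {s} (y : Var s) t → (∀ σ → at (f σ) y t ≡ at σ y t) →
                    ∀ k σ → at (iterate f k σ) y t ≡ at σ y t
    iterate-frame f y t eq zero    σ = refl
    iterate-frame f y t eq (suc k) σ = trans (iterate-frame f y t eq k (f σ)) (eq σ)
    frame nop           σ y eq t = refl
    frame (x ≔ e)       σ y eq t = upd-var x _ _ σ y t eq
    frame (fetch x a e) σ y eq t with does (ev e σ ℕ.+ 1 ℕₚ.≤? σ · sz)
    ... | true  = upd-var x _ _ σ y t eq
    ... | false = refl
    frame (save a e f)  σ y eq t with does (ev e σ ℕ.+ 1 ℕₚ.≤? σ · sz)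
    ... | true  = upd-var a _ _ σ y t eq
    ... | false = refl
    frame (c ⨟ c′)      σ y eq t with ∨-false (touches c y) eq
    ... | p , q = trans (frame c′ (run c σ) y q t) (frame c σ y p t)
    frame (when b c c′) σ y eq t with ∨-false (touches c y) eq | does (holds? b σ)
    ... | p , q | true  = frame c σ y p t
    ... | p , q | false = frame c′ σ y q t
    frame (for i b c)   σ y eq t with ∨-false (same i y) eq
    ... | p , q = trans (iterate-frame _ y t
                          (λ τ → trans (upd-var i 0 _ (run c τ) y t p) (frame c τ y q t))
                          (σ · b) _)
                        (upd-var i 0 0 σ y t p)

    Same : HCmd → State → State → Set
    Same c σ τ = ∀ {s} (y : Var s) → touches c y ≡ false → ∀ t → at τ y t ≡ at σ y t

    same-⨟ : ∀ c c′ {σ τ} → Same c′ (run c σ) τ → Same (c ⨟ c′) σ τ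
    same-⨟ c c′ {σ} sm y y∉ t =
      let c∌y , c′∌y = ∨-false (touches c y) y∉ in trans (sm y c′∌y t) (frame c σ y c∌y t)

    -- The record keeps `run` from unfolding in goals, so that the rules below find the command and
    -- the postcondition by unification.
    record Wp (c : HCmd) (Post : State → Set) (σ : State) : Set where
      constructor wp
      field run-wp : Post (run c σ)
    open Wp public

    module _ {Post : State → Set} {σ : State} where

      nopW : Post σ → Wp nop Post σ
      nopW = wp

      assignW : ∀ {s} {x : Var s} {e} → Post (upd x 0 (ev e σ) σ) → Wp (x ≔ e) Post σ
      assignW = wp

      seqW : ∀ {c c′} → Wp c (Wp c′ Post) σ → Wp (c ⨟ c′) Post σ
      seqW p = wp (run-wp (run-wp p))

      fetchW : ∀ {s} {x a : Var s} {e} → ev e σ ℕ.< σ · sz →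
               Post (upd x 0 (at σ a (ev e σ)) σ) → Wp (fetch x a e) Post σ
      fetchW {s} {x} {a} {e} lt p = wp (aux (ev e σ ℕ.+ 1 ℕₚ.≤? σ · sz))
        where
        aux : (de : Dec (ev e σ ℕ.+ 1 ℕ.≤ σ · sz)) →
              Post (if does de then upd x 0 (at σ a (ev e σ)) σ else σ)
        aux (yes _)  = p
        aux (no nle) = contradiction (subst (ℕ._≤ σ · sz) (ℕₚ.+-comm 1 (ev e σ)) lt) nle

      saveW : ∀ {s} {a : Var s} {e f} → ev e σ ℕ.< σ · sz →
              Post (upd a (ev e σ) (ev f σ) σ) → Wp (save a e f) Post σ
      saveW {s} {a} {e} {f} lt p = wp (aux (ev e σ ℕ.+ 1 ℕₚ.≤? σ · sz))
        where
        aux : (de : Dec (ev e σ ℕ.+ 1 ℕ.≤ σ · sz)) →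
              Post (if does de then upd a (ev e σ) (ev f σ) σ else σ)
        aux (yes _)  = p
        aux (no nle) = contradiction (subst (ℕ._≤ σ · sz) (ℕₚ.+-comm 1 (ev e σ)) lt) nle

      whenW : ∀ {t c c′} → (Holds t σ → Wp c Post σ) → (¬ Holds t σ → Wp c′ Post σ) →
              Wp (when t c c′) Post σ
      whenW {t} {c} {c′} p q = wp (aux (holds? t σ))
        where
        aux : (de : Dec (Holds t σ)) → Post (if does de then run c σ else run c′ σ)
        aux (yes h) = run-wp (p h)
        aux (no h)  = run-wp (q h)

      -- Besides weakening the postcondition, this hands the frame of `c` to the continuation, so
      -- specifications need to mention only what `c` changes.
      conseq : ∀ {c Mid} → Wp c Mid σ → (∀ τ → Same c σ τ → Mid τ → Post τ) → Wp c Post σ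
      conseq {c} p k = wp (k (run c σ) (frame c σ) (run-wp p))

    -- Each turn also receives the frame of the whole loop relative to its entry state; invariants
    -- therefore speak only of what the loop writes.
    forW : ∀ {Post σ i b c} {wf-for : wf (for i b c) ≡ true} (Inv : ℕ → State → Set) →
           Inv 0 (upd i 0 0 σ) →
           (∀ k τ → k ℕ.< σ · b → τ · i ≡ k → Same (for i b c) σ τ → Inv k τ →
              Wp c (λ τ′ → Inv (suc k) (upd i 0 (suc k) τ′)) τ) →
           (∀ τ → Same (for i b c) σ τ → Inv (σ · b) τ → Post τ) →
           Wp (for i b c) Post σ
    forW {Post} {σ} {i} {b} {c} {wf-for} Inv base step done =
      wp (go (σ · b) 0 (upd i 0 0 σ) (ℕₚ.+-identityʳ _) (upd-same i 0 0 σ)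
             (λ y eq t → upd-var i 0 0 σ y t (proj₁ (∨-false (same i y) eq))) base)
      where
      open WfFor (wf-for⁻ i b c wf-for)
      go : ∀ r k τ → r ℕ.+ k ≡ σ · b → τ · i ≡ k → Same (for i b c) σ τ → Inv k τ →
           Post (iterate (λ τ → bump i (run c τ)) r τ)
      go zero    k τ refl ik sm inv = done τ sm inv
      go (suc r) k τ eq ik sm inv =
        go r (suc k) (bump i (run c τ)) (trans (ℕₚ.+-suc r k) eq)
           (trans (upd-same i 0 _ (run c τ)) next)
           (λ y ty t → trans (upd-var i 0 _ (run c τ) y t (proj₁ (∨-false (same i y) ty)))
                      (trans (frame c τ y (proj₂ (∨-false (same i y) ty)) t) (sm y ty t)))
           (subst (λ v → Inv (suc k) (upd i 0 v (run c τ))) (sym next)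
             (run-wp (step k τ (subst (k ℕ.<_) eq (s≤s (ℕₚ.m≤n+m k r))) ik sm inv)))
        where
        next : run c τ · i ℕ.+ 1 ≡ suc k
        next = trans (cong (ℕ._+ 1) (trans (frame c τ i i∉c 0) ik)) (ℕₚ.+-comm k 1)

    module Sound (M : ℕ) where
      open Semantics I M

      conv : ∀ s → Val s → Value s
      conv point v = v
      conv nat   v = v
      conv num   v = v

      as-conv : ∀ s (v : Val s) → as s (s , conv s v) ≡ just (conv s v)
      as-conv point v = refl
      as-conv nat   v = refl
      as-conv num   v = refl

      -- The number of rows is a parameter because, while a row is being added, memory already holds
      -- one row more than `sz` says.
      RepBelow : ℕ → Memory → State → Set
      RepBelow k μ σ = ∀ {s} (x : Var s) t → t ℕ.< k →
                       read μ (addr x t) ≡ just (s , conv s (at σ x t))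

      Rep : Memory → State → Set
      Rep μ σ = RepBelow (σ · sz) μ σ

      Fits : State → Set
      Fits σ = σ · sz ℕ.* W ℕ.≤ M

      found : ∀ s → Val s → Maybe Word
      found s v = just (s , conv s v)

      read-< : ∀ μ {a} (a<M : a ℕ.< M) → read μ a ≡ just (lookup μ (fromℕ< a<M))
      read-< μ {a} a<M with a ℕₚ.<? M
      ... | yes _   = refl
      ... | no a≮M = contradiction a<M a≮M

      addr<M : ∀ {s} (x : Var s) {t size} → t ℕ.< size → size ℕ.* W ℕ.≤ M → addr x t ℕ.< M
      addr<M x {t} lt le = ℕₚ.<-≤-trans (ℕₚ.+-monoˡ-< (t ℕ.* W) (class<W x))
                            (ℕₚ.≤-trans (ℕₚ.*-monoˡ-≤ W lt) le)

      -- In base `W` the last digit of an address is its column.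
      class-inj : ∀ {s s′} (x : Var s) (y : Var s′) {t t′} → addr x t ≡ addr y t′ → class x ≡ class y
      class-inj x y {t} {t′} eq = begin
        class x                   ≡⟨ m<n⇒m%n≡m (class<W x) ⟨
        class x ℕ.% W             ≡⟨ [m+kn]%n≡m%n (class x) t W ⟨
        addr x t ℕ.% W            ≡⟨ cong (ℕ._% W) eq ⟩
        addr y t′ ℕ.% W           ≡⟨ [m+kn]%n≡m%n (class y) t′ W ⟩
        class y ℕ.% W             ≡⟨ m<n⇒m%n≡m (class<W y) ⟩
        class y                   ∎
        where open ≡-Reasoning

      index-inj : ∀ {s} (x : Var s) {t t′} → addr x t ≡ addr x t′ → t ≡ t′
      index-inj x {t} {t′} eq = ℕₚ.*-cancelʳ-≡ t t′ W (ℕₚ.+-cancelˡ-≡ (class x) _ _ eq)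

      same-class : ∀ {s s′} (x : Var s) (y : Var s′) → class x ≡ class y → same x y ≡ true
      same-class (N x) (N y) eq = trans (cong (_≡ᵇ toℕ y) eq) (≡ᵇ-refl (toℕ y))
      same-class (Q x) (Q y) eq = trans (cong (_≡ᵇ toℕ y) (ℕₚ.+-cancelˡ-≡ 32 _ _ eq)) (≡ᵇ-refl (toℕ y))
      same-class (P x) (P y) eq = trans (cong (_≡ᵇ toℕ y) (ℕₚ.+-cancelˡ-≡ 38 _ _ eq)) (≡ᵇ-refl (toℕ y))
      same-class (N x) (Q y) eq = contradiction eq (ℕₚ.<⇒≢ (ℕₚ.<-≤-trans (toℕ<n x) (ℕₚ.m≤m+n 32 _)))
      same-class (N x) (P y) eq = contradiction eq (ℕₚ.<⇒≢ (ℕₚ.<-≤-trans (toℕ<n x) (ℕₚ.≤-trans (ℕₚ.m≤m+n 32 6) (ℕₚ.m≤m+n 38 _))))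
      same-class (Q x) (N y) eq = contradiction (sym eq) (ℕₚ.<⇒≢ (ℕₚ.<-≤-trans (toℕ<n y) (ℕₚ.m≤m+n 32 _)))
      same-class (Q x) (P y) eq = contradiction eq (ℕₚ.<⇒≢ (ℕₚ.<-≤-trans (ℕₚ.+-monoʳ-< 32 (toℕ<n x)) (ℕₚ.m≤m+n 38 _)))
      same-class (P x) (N y) eq = contradiction (sym eq) (ℕₚ.<⇒≢ (ℕₚ.<-≤-trans (toℕ<n y) (ℕₚ.≤-trans (ℕₚ.m≤m+n 32 6) (ℕₚ.m≤m+n 38 _))))
      same-class (P x) (Q y) eq = contradiction (sym eq) (ℕₚ.<⇒≢ (ℕₚ.<-≤-trans (ℕₚ.+-monoʳ-< 32 (toℕ<n y)) (ℕₚ.m≤m+n 38 _)))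

      same⇒≡ : ∀ {s s′} (x : Var s) (y : Var s′) → same x y ≡ true →
               Σ (s ≡ s′) λ { refl → x ≡ y }
      same⇒≡ (N x) (N y) eq = refl , cong N (toℕ-injective (≡ᵇ⇒≡ _ _ eq))
      same⇒≡ (Q x) (Q y) eq = refl , cong Q (toℕ-injective (≡ᵇ⇒≡ _ _ eq))
      same⇒≡ (P x) (P y) eq = refl , cong P (toℕ-injective (≡ᵇ⇒≡ _ _ eq))

      read-update : ∀ μ {a} (a<M : a ℕ.< M) u → read (μ [ fromℕ< a<M ]≔ u) a ≡ just u
      read-update μ a<M u = trans (read-< _ a<M) (cong just (lookup∘update (fromℕ< a<M) μ u))

      read-update-≢ : ∀ μ {a b} (a<M : a ℕ.< M) u → a ≢ b → read (μ [ fromℕ< a<M ]≔ u) b ≡ read μ b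
      read-update-≢ μ {a} {b} a<M u ne with b ℕₚ.<? M
      ... | yes b<M = cong just (lookup∘update′ (λ eq → ne (sym (trans (sym (toℕ-fromℕ< b<M))
                        (trans (cong toℕ eq) (toℕ-fromℕ< a<M))))) μ u)
      ... | no _    = refl

      RepBelow-upd : ∀ {k μ σ s} (x : Var s) t v (a<M : addr x t ℕ.< M) →
                     RepBelow k μ σ → RepBelow k (μ [ fromℕ< a<M ]≔ (s , conv s v)) (upd x t v σ)
      RepBelow-upd {k} {μ} {σ} x t v a<M rep y t′ lt
        with same x y in eq | t ℕₚ.≟ t′
      ... | false | _ = trans (read-update-≢ μ a<M _ ne)
                          (trans (rep y t′ lt) (cong (found _) (sym (upd-var x t v σ y t′ eq))))
        where
        ne : addr x t ≢ addr y t′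
        ne ad with trans (sym eq) (same-class x y (class-inj x y {t} {t′} ad))
        ... | ()
      ... | true | q with same⇒≡ x y eq
      ... | refl , refl with q
      ... | yes refl = trans (read-update μ a<M _) (cong (found _) (sym (upd-same x t v σ)))
      ... | no ne    = trans (read-update-≢ μ a<M _ (ne ∘ index-inj x))
                          (trans (rep x t′ lt) (cong (found _) (sym (upd-index x t v σ ne))))

      Rep-upd : ∀ {μ σ s} (x : Var s) t v (a<M : addr x t ℕ.< M) → same x sz ≡ false →
                Rep μ σ → Rep (μ [ fromℕ< a<M ]≔ (s , conv s v)) (upd x t v σ)
      Rep-upd {μ} {σ} x t v a<M x≢sz rep y t′ lt =
        RepBelow-upd {σ · sz} {μ} {σ} x t v a<M rep y t′ (subst (t′ ℕ.<_) (upd-var x t v σ sz 0 x≢sz) lt)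

      module _ {m : Mode} {ρ : Item m} {μ : Memory} {σ : State} (rep : Rep μ σ) where

        eval-load : ∀ {s} (a : Expr m nat) (x : Var s) {t} → t ℕ.< σ · sz →
                    eval ρ μ a ≡ just (addr x t) → eval ρ μ (load {s = s} a) ≡ just (conv s (at σ x t))
        eval-load {s} a x {t} lt eq rewrite eq | rep x t lt = as-conv s _

        module _ (pos : 0 ℕ.< σ · sz) where

          eval-sound : ∀ {s} (e : HExpr s) → eval ρ μ (compE e) ≡ just (conv s (ev e σ))
          eval-sound (! x)      = eval-load (litℕ (addr x 0)) x pos refl
          eval-sound (# k)      = refl
          eval-sound (real# x)  = refl
          eval-sound zin        = refl
          eval-sound (e ⊕ f)    rewrite eval-sound e | eval-sound f = refl
          eval-sound (e ⊖ f)    rewrite eval-sound e | eval-sound f = refl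
          eval-sound (e ⊗ f)    rewrite eval-sound e | eval-sound f = refl
          eval-sound (e ⊞ f)    rewrite eval-sound e | eval-sound f = refl
          eval-sound δ⟨ e , f ⟩ rewrite eval-sound e | eval-sound f = refl
          eval-sound (wt e)     rewrite eval-sound e = refl

          cell-sound : ∀ {s} (x : Var s) e → eval ρ μ (cell x e) ≡ just (addr x (ev e σ))
          cell-sound x e rewrite eval-sound e = refl

          test-sound : ∀ t → test ρ μ (compT t) ≡ just (does (holds? t σ))
          test-sound (e ≼ f) rewrite eval-sound e | eval-sound f = refl
          test-sound (e ⊑ f) rewrite eval-sound e | eval-sound f = refl

      Runs : ∀ {m} → Item m → Cmd m → Memory → ℕ → State → Set
      Runs ρ c μ p τ = ∃[ μ′ ] Exec ρ c μ p μ′ × Rep μ′ τ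

      module _ {m : Mode} {ρ : Item m} where

        put-sound : ∀ {s} (x : Var s) e {μ σ} → same x sz ≡ false → Rep μ σ →
                    0 ℕ.< σ · sz → Fits σ → Runs ρ (put x e) μ 0 (upd x 0 (ev e σ) σ)
        put-sound {s} x e {μ} {σ} x≢sz rep pos fits =
          _ , store refl lt (eval-sound {ρ = ρ} rep pos e) , Rep-upd {σ = σ} x 0 (ev e σ) lt x≢sz rep
          where
          lt : addr x 0 ℕ.< M
          lt = addr<M x pos fits

        -- The simulation. Row 0 must exist because scalars live there, and the table must fit
        -- because the machine checks its bounds.
        sound : ∀ c {μ σ} → wf c ≡ true → Rep μ σ → 0 ℕ.< σ · sz → Fits σ → Runs ρ (compile c) μ 0 (run c σ)
        wf⇒sz : ∀ c σ → wf c ≡ true → run c σ · sz ≡ σ · sz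

        -- Induction on `k`, the number of turns that remain; this is what makes the machine's
        -- `while` terminate.
        loop-sound : ∀ i b c → wf (for i b c) ≡ true → ∀ k {μ τ} → Rep μ τ → 0 ℕ.< τ · sz → Fits τ →
                     τ · i ℕ.+ k ≡ τ · b →
                     Runs ρ (while (compT ((! i ⊕ # 1) ≼ ! b)) (compile c ⨾ put i (! i ⊕ # 1))) μ 0
                            (iterate (λ τ → bump i (run c τ)) k τ)

        wf⇒sz c@nop           σ ok = frame c σ sz (not-true ok) 0
        wf⇒sz c@(x ≔ e)       σ ok = frame c σ sz (not-true ok) 0
        wf⇒sz c@(fetch x a e) σ ok = frame c σ sz (not-true ok) 0
        wf⇒sz c@(save a e f)  σ ok = frame c σ sz (not-true ok) 0
        wf⇒sz (c ⨟ c′)      σ ok with ∧-true (wf c) ok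
        ... | p , q = trans (wf⇒sz c′ (run c σ) q) (wf⇒sz c σ p)
        wf⇒sz (when t c c′) σ ok with ∧-true (wf c) ok | does (holds? t σ)
        ... | p , q | true  = wf⇒sz c σ p
        ... | p , q | false = wf⇒sz c′ σ q
        wf⇒sz (for i b c) σ ok =
          trans (iterate-frame _ sz 0 (λ τ → trans (upd-var i 0 _ (run c τ) sz 0 i≢sz) (wf⇒sz c τ wfc)) (σ · b) _)
                (upd-var i 0 0 σ sz 0 i≢sz)
          where open WfFor (wf-for⁻ i b c ok)

        loop-sound i b c ok k {μ} {τ} rep pos fits eq
          with record { i≢sz = i≢sz ; i∉c = i∉c ; b∉c = b∉c ; i≢b = i≢b ; wfc = okc } ← wf-for⁻ i b c ok
          with k
        ... | zero  = _ , stop (trans (test-sound {ρ = ρ} rep pos ((! i ⊕ # 1) ≼ ! b)) (cong just is-false)) , rep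
          where
          is-false : does (τ · i ℕ.+ 1 ℕₚ.≤? τ · b) ≡ false
          is-false = dec-false (τ · i ℕ.+ 1 ℕₚ.≤? τ · b) λ le →
            ℕₚ.≤⇒≯ (ℕₚ.≤-reflexive (trans (sym eq) (ℕₚ.+-identityʳ _)))
              (subst (ℕ._≤ τ · b) (ℕₚ.+-comm (τ · i) 1) le)
        ... | suc k
          with sound c okc rep pos fits
        ... | μ₁ , ex₁ , rep₁
          with size₁ ← wf⇒sz c τ okc
          with pos₁ ← subst (0 ℕ.<_) (sym size₁) pos
             | fits₁ ← subst (λ q → q ℕ.* W ℕ.≤ M) (sym size₁) fits
          with put-sound i (! i ⊕ # 1) i≢sz rep₁ pos₁ fits₁
        ... | μ₂ , ex₂ , rep₂
          with size₂ ← upd-var i 0 (run c τ · i ℕ.+ 1) (run c τ) sz 0 i≢sz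
          with loop-sound i b c ok k rep₂ (subst (0 ℕ.<_) (sym size₂) pos₁)
                 (subst (λ q → q ℕ.* W ℕ.≤ M) (sym size₂) fits₁) next
          where
          next : bump i (run c τ) · i ℕ.+ k ≡ bump i (run c τ) · b
          next = begin
            bump i (run c τ) · i ℕ.+ k  ≡⟨ cong (ℕ._+ k) (upd-same i 0 _ (run c τ)) ⟩
            run c τ · i ℕ.+ 1 ℕ.+ k     ≡⟨ cong (λ q → q ℕ.+ 1 ℕ.+ k) (frame c τ i i∉c 0) ⟩
            τ · i ℕ.+ 1 ℕ.+ k           ≡⟨ ℕₚ.+-assoc (τ · i) 1 k ⟩
            τ · i ℕ.+ suc k             ≡⟨ eq ⟩
            τ · b                       ≡⟨ frame c τ b b∉c 0 ⟨
            run c τ · b                 ≡⟨ upd-var i 0 _ (run c τ) b 0 i≢b ⟨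
            bump i (run c τ) · b        ∎
            where open ≡-Reasoning
        ... | μ₃ , ex₃ , rep₃ =
          _ , step (trans (test-sound {ρ = ρ} rep pos ((! i ⊕ # 1) ≼ ! b)) (cong just is-true))
                   (seq (seq ex₁ ex₂) ex₃) , rep₃
          where
          is-true : does (τ · i ℕ.+ 1 ℕₚ.≤? τ · b) ≡ true
          is-true = dec-true (τ · i ℕ.+ 1 ℕₚ.≤? τ · b)
            (subst (τ · i ℕ.+ 1 ℕ.≤_) eq (ℕₚ.+-monoʳ-≤ (τ · i) (s≤s z≤n)))

        sound nop           ok rep pos fits = _ , skip , rep
        sound (x ≔ e)       ok rep pos fits = put-sound x e (not-true ok) rep pos fits
        sound (fetch x a e) {μ} {σ} ok rep pos fits = aux (ev e σ ℕ.+ 1 ℕₚ.≤? σ · sz) refl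
          where
          aux : (de : Dec (ev e σ ℕ.+ 1 ℕ.≤ σ · sz)) → de ≡ (ev e σ ℕ.+ 1 ℕₚ.≤? σ · sz) →
                Runs ρ (compile (fetch x a e)) μ 0 (if does de then upd x 0 (at σ a (ev e σ)) σ else σ)
          aux (yes le) de =
            _ , cond (trans (test-sound {ρ = ρ} rep pos ((e ⊕ # 1) ≼ ! sz)) (cong (just ∘ does) (sym de)))
                     (store refl (addr<M x pos fits)
                       (eval-load {ρ = ρ} rep (cell a e) a (subst (ℕ._≤ σ · sz) (ℕₚ.+-comm (ev e σ) 1) le)
                         (cell-sound {ρ = ρ} rep pos a e)))
              , Rep-upd {σ = σ} x 0 (at σ a (ev e σ)) (addr<M x pos fits) (not-true ok) rep
          aux (no _) de =
            _ , cond (trans (test-sound {ρ = ρ} rep pos ((e ⊕ # 1) ≼ ! sz)) (cong (just ∘ does) (sym de))) skip , rep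
        sound (save a e f)  {μ} {σ} ok rep pos fits = aux (ev e σ ℕ.+ 1 ℕₚ.≤? σ · sz) refl
          where
          aux : (de : Dec (ev e σ ℕ.+ 1 ℕ.≤ σ · sz)) → de ≡ (ev e σ ℕ.+ 1 ℕₚ.≤? σ · sz) →
                Runs ρ (compile (save a e f)) μ 0 (if does de then upd a (ev e σ) (ev f σ) σ else σ)
          aux (yes le) de =
            _ , cond (trans (test-sound {ρ = ρ} rep pos ((e ⊕ # 1) ≼ ! sz)) (cong (just ∘ does) (sym de)))
                     (store (cell-sound {ρ = ρ} rep pos a e) lt (eval-sound {ρ = ρ} rep pos f))
              , Rep-upd {σ = σ} a (ev e σ) (ev f σ) lt (not-true ok) rep
            where
            lt : addr a (ev e σ) ℕ.< M
            lt = addr<M a (subst (ℕ._≤ σ · sz) (ℕₚ.+-comm (ev e σ) 1) le) fits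
          aux (no _) de =
            _ , cond (trans (test-sound {ρ = ρ} rep pos ((e ⊕ # 1) ≼ ! sz)) (cong (just ∘ does) (sym de))) skip , rep
        sound (c ⨟ c′)      {μ} {σ} ok rep pos fits with ∧-true (wf c) ok
        ... | p , q with sound c p rep pos fits
        ... | μ₁ , ex₁ , rep₁
          with size₁ ← wf⇒sz c σ p
          with sound c′ q rep₁ (subst (0 ℕ.<_) (sym size₁) pos) (subst (λ q → q ℕ.* W ℕ.≤ M) (sym size₁) fits)
        ... | μ₂ , ex₂ , rep₂ = _ , seq ex₁ ex₂ , rep₂
        sound (when t c c′) {μ} {σ} ok rep pos fits with ∧-true (wf c) ok
        ... | p , q = aux (does (holds? t σ)) refl
          where
          aux : ∀ b → b ≡ does (holds? t σ) →
                Runs ρ (cond (compT t) (compile c) (compile c′)) μ 0 (if b then run c σ else run c′ σ)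
          aux true eq with sound c p rep pos fits
          ... | μ₁ , ex₁ , rep₁ =
            _ , cond (trans (test-sound {ρ = ρ} rep pos t) (cong just (sym eq))) ex₁ , rep₁
          aux false eq with sound c′ q rep pos fits
          ... | μ₁ , ex₁ , rep₁ =
            _ , cond (trans (test-sound {ρ = ρ} rep pos t) (cong just (sym eq))) ex₁ , rep₁
        sound (for i b c)   {μ} {σ} ok rep pos fits
          with record { i≢sz = i≢sz ; i≢b = i≢b } ← wf-for⁻ i b c ok
          with put-sound i (# 0) i≢sz rep pos fits
        ... | μ₁ , ex₁ , rep₁
          with size₁ ← upd-var i 0 0 σ sz 0 i≢sz
          with loop-sound i b c ok (σ · b) rep₁ (subst (0 ℕ.<_) (sym size₁) pos)
                 (subst (λ q → q ℕ.* W ℕ.≤ M) (sym size₁) fits)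
                 (trans (cong (ℕ._+ σ · b) (upd-same i 0 0 σ)) (sym (upd-var i 0 0 σ b 0 i≢b)))
        ... | μ₂ , ex₂ , rep₂ = _ , seq ex₁ ex₂ , rep₂

-- The doubling algorithm: a separated set of at most m pivots in one pass.

module FirstPass (R : Reals) where
  open Reals R
  open RKC R
  open Streaming R
  open Machine R public

  -- Arrays, indexed by clusters: pivots Pv, cheapest representatives B, sizes
  -- C and the candidate's bits F.  All other variables are scalars.
  nn m cnt acc gg i j a b S q u bit h t f far old hit c cov pw fnd bS C F s : Var nat
  nn  = N (Fin.# 1)
  m   = N (Fin.# 2)
  cnt = N (Fin.# 3)
  acc = N (Fin.# 4)
  gg  = N (Fin.# 5)
  i   = N (Fin.# 6)
  j   = N (Fin.# 7)
  a   = N (Fin.# 8)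
  b   = N (Fin.# 9)
  S   = N (Fin.# 10)
  q   = N (Fin.# 11)
  u   = N (Fin.# 12)
  bit = N (Fin.# 13)
  h   = N (Fin.# 14)
  t   = N (Fin.# 15)
  f   = N (Fin.# 16)
  far = N (Fin.# 17)
  old = N (Fin.# 18)
  hit = N (Fin.# 19)
  c   = N (Fin.# 20)
  cov = N (Fin.# 21)
  pw  = N (Fin.# 22)
  fnd = N (Fin.# 23)
  bS  = N (Fin.# 24)
  C   = N (Fin.# 25)
  F   = N (Fin.# 26)
  s   = N (Fin.# 27)

  ρ RR dl v bv ws : Var num
  ρ  = Q (Fin.# 0)
  RR = Q (Fin.# 1)
  dl = Q (Fin.# 2)
  v  = Q (Fin.# 3)
  bv = Q (Fin.# 4)
  ws = Q (Fin.# 5)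

  x y y′ Pv B : Var point
  x  = P (Fin.# 0)
  y  = P (Fin.# 1)
  y′ = P (Fin.# 2)
  Pv = P (Fin.# 3)
  B  = P (Fin.# 4)

  farLoop insert minRow minDist refilter body₁ : HCmd
  farLoop = for j cnt (fetch y Pv (! j) ⨟ when (δ⟨ ! x , ! y ⟩ ⊑ ! ρ) (far ≔ # 0) nop)
  insert =
    far ≔ # 1 ⨟
    farLoop ⨟
    when (# 1 ≼ ! far) (save Pv (! cnt) (! x) ⨟ cnt ≔ ! cnt ⊕ # 1) nop
  minRow =
    for b cnt (
      fetch y Pv (! a) ⨟
      fetch y′ Pv (! b) ⨟
      when (! a ⊕ # 1 ≼ ! b)
        (when (δ⟨ ! y , ! y′ ⟩ ⊑ ! dl) (dl ≔ δ⟨ ! y , ! y′ ⟩) nop)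
        nop)
  minDist =
    fetch y Pv (# 0) ⨟ fetch y′ Pv (# 1) ⨟ dl ≔ δ⟨ ! y , ! y′ ⟩ ⨟
    for a cnt minRow
  -- This works in place: pivot `i` is read before it can be overwritten, since at most `i` pivots
  -- have been kept by then.
  refilter =
    ρ ≔ ! dl ⊞ ! dl ⨟ old ≔ ! cnt ⨟ cnt ≔ # 0 ⨟
    for i old (fetch x Pv (! i) ⨟ insert)
  body₁ = insert ⨟ when (! m ⊕ # 1 ≼ ! cnt) (minDist ⨟ refilter) nop

  module FirstPassSpec (I : Instance) where
    open Instance I
    open Run I public

    V : Set
    V = Fin n

    Cov : State → ℝ → V → Set
    Cov σ r p = ∃[ k ] k ℕ.< σ · cnt × d p (at σ Pv k) ≤ r

    Far : State → ℕ → V → ℝ → Set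
    Far σ l p r = ∀ k → k ℕ.< l → ¬ d p (at σ Pv k) ≤ r

    <-suc⁻ : ∀ {k l} → k ℕ.< suc l → k ≡ l ⊎ k ℕ.< l
    <-suc⁻ (s≤s le) = [ inj₂ , inj₁ ] (ℕₚ.m≤n⇒m<n∨m≡n le)

    InsertPost : State → State → Set
    InsertPost σ τ =
      (τ · cnt ≡ σ · cnt × (∀ k → at τ Pv k ≡ at σ Pv k) × Cov σ (σ · ρ) (σ · x))
      ⊎
      (τ · cnt ≡ suc (σ · cnt) × at τ Pv (σ · cnt) ≡ σ · x ×
       (∀ k → k ≢ σ · cnt → at τ Pv k ≡ at σ Pv k) × Far σ (σ · cnt) (σ · x) (σ · ρ))

    farLoopW : ∀ σ → σ · cnt ℕ.≤ σ · sz → σ · far ≡ 1 →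
      Wp farLoop (λ τ → (τ · far ≡ 0 × Cov σ (σ · ρ) (σ · x)) ⊎ (τ · far ≡ 1 × Far σ (σ · cnt) (σ · x) (σ · ρ))) σ
    farLoopW σ le far1 = forW {wf-for = refl} Inv
      (inj₂ (far1 , λ _ ()))
      (λ k τ lt ik sm inv → seqW (fetchW (subst₂ ℕ._<_ (sym ik) (sym (sm sz refl 0)) (ℕₚ.<-≤-trans lt le))
        (whenW
          (λ near → assignW (inj₁ (refl , k , lt , transport τ sm ik near)))
          (λ ¬near → nopW (step k τ sm ik inv ¬near)))))
      (λ τ sm inv → fin τ inv)
      where
      Inv : ℕ → State → Set
      Inv k τ = (τ · far ≡ 0 × Cov σ (σ · ρ) (σ · x)) ⊎ (τ · far ≡ 1 × Far σ k (σ · x) (σ · ρ))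
      transport : ∀ τ → Same farLoop σ τ → ∀ {k} → τ · j ≡ k → d (τ · x) (at τ Pv (τ · j)) ≤ τ · ρ →
                  d (σ · x) (at σ Pv k) ≤ σ · ρ
      transport τ sm refl near = subst₂ _≤_ (cong₂ d (sm x refl 0) (sm Pv refl _)) (sm ρ refl 0) near
      step : ∀ k τ → Same farLoop σ τ → τ · j ≡ k → Inv k τ → ¬ d (τ · x) (at τ Pv (τ · j)) ≤ τ · ρ →
             Inv (suc k) τ
      step k τ sm ik (inj₁ e) ¬near = inj₁ e
      step k τ sm refl (inj₂ (e , fr)) ¬near = inj₂ (e , λ l lt →
        [ (λ { refl near → ¬near (subst₂ _≤_ (sym (cong₂ d (sm x refl 0) (sm Pv refl _))) (sym (sm ρ refl 0)) near) })
        , fr l ] (<-suc⁻ lt))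
      fin : ∀ τ → Inv (σ · cnt) τ → Inv (σ · cnt) τ
      fin τ inv = inv

    insertW : ∀ σ → σ · cnt ℕ.< σ · sz → Wp insert (InsertPost σ) σ
    insertW σ lt = seqW (assignW (seqW (conseq (farLoopW (upd far 0 1 σ) (ℕₚ.<⇒≤ lt) refl)
      (λ τ sm → λ
        { (inj₁ (e , cv)) → whenW
            (λ 1≤far → contradiction (subst (1 ℕ.≤_) e 1≤far) λ ())
            (λ _ → nopW (inj₁ (sm cnt refl 0 , sm Pv refl , cv)))
        ; (inj₂ (e , fr)) → whenW
            (λ _ → seqW (saveW (subst₂ ℕ._<_ (sym (sm cnt refl 0)) (sym (sm sz refl 0)) lt)
              (assignW (inj₂ (new τ sm fr)))))
            (λ ¬1≤far → contradiction (ℕₚ.≤-reflexive (sym e)) ¬1≤far) }))))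
      where
      new : ∀ τ → Same farLoop (upd far 0 1 σ) τ → Far σ (σ · cnt) (σ · x) (σ · ρ) →
            let τ′ = upd Pv (τ · cnt) (τ · x) τ in
            τ · cnt ℕ.+ 1 ≡ suc (σ · cnt) × at τ′ Pv (σ · cnt) ≡ σ · x ×
            (∀ k → k ≢ σ · cnt → at τ′ Pv k ≡ at σ Pv k) × Far σ (σ · cnt) (σ · x) (σ · ρ)
      new τ sm fr with τ · cnt | sm cnt refl 0
      ... | _ | refl = ℕₚ.+-comm _ 1
        , trans (upd-same Pv (σ · cnt) (τ · x) τ) (sm x refl 0)
        , (λ k ne → trans (upd-index Pv (σ · cnt) (τ · x) τ (λ e → ne (sym e))) (sm Pv refl k))
        , fr

    module Metric = IsGeneralMetric isMetric
    open RealLemmas R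

    -- Oriented from the later pivot to the earlier one, as `insert` measures it.
    Sep : State → ℝ → Set
    Sep σ r = ∀ {k l} → k ℕ.< l → l ℕ.< σ · cnt → ¬ d (at σ Pv l) (at σ Pv k) ≤ r

    insert-cov : ∀ {σ τ} → InsertPost σ τ → ∀ {r p} → Cov σ r p → Cov τ r p
    insert-cov {σ} {τ} ip {r} {p} (k , lt , le) with ip
    ... | inj₁ (e , same , _) =
      k , subst (k ℕ.<_) (sym e) lt , subst (λ e → d p e ≤ r) (sym (same k)) le
    ... | inj₂ (e , _ , same , _) =
      k , subst (k ℕ.<_) (sym e) (ℕₚ.m<n⇒m<1+n lt) ,
      subst (λ e → d p e ≤ r) (sym (same k (ℕₚ.<⇒≢ lt))) le

    insert-x : ∀ {σ τ} → InsertPost σ τ → 0# ≤ σ · ρ → Cov τ (σ · ρ) (σ · x)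
    insert-x {σ} {τ} ip 0≤ρ with ip
    ... | inj₁ (e , same , cv) = insert-cov {σ} {τ} ip cv
    ... | inj₂ (e , new , _ , _) =
      σ · cnt , ℕₚ.≤-reflexive (sym e) ,
      subst (_≤ σ · ρ) (sym (Metric.≈⇒0 (sym new))) 0≤ρ

    insert-sep : ∀ {σ τ} → InsertPost σ τ → Sep σ (σ · ρ) → Sep τ (σ · ρ)
    insert-sep {σ} {τ} ip sep {k} {l} k<l l<cnt with ip
    ... | inj₁ (e , same , _) = λ le → sep k<l (subst (l ℕ.<_) e l<cnt)
          (subst (_≤ σ · ρ) (cong₂ d (same l) (same k)) le)
    ... | inj₂ (e , new , same , fr) with <-suc⁻ (subst (l ℕ.<_) e l<cnt)
    ... | inj₁ refl = λ le → fr k k<l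
          (subst (_≤ σ · ρ) (cong₂ d new (same k (ℕₚ.<⇒≢ k<l))) le)
    ... | inj₂ lt = λ le → sep k<l lt
          (subst (_≤ σ · ρ) (cong₂ d (same l (ℕₚ.<⇒≢ lt)) (same k (ℕₚ.<⇒≢ (ℕₚ.<-trans k<l lt)))) le)

    -- The minimum has to come with a pair that realises it: this pair forces `refilter` to drop a
    -- pivot, and it bounds the old radius by `dl`.
    Attained : State → ℝ → Set
    Attained σ r = ∃[ k ] ∃[ l ] k ℕ.< l × l ℕ.< σ · cnt × d (at σ Pv k) (at σ Pv l) ≡ r

    minRowW : ∀ σ → σ · a ℕ.< σ · cnt → σ · cnt ℕ.≤ σ · sz → Attained σ (σ · dl) →
      Wp minRow (λ τ → Attained σ (τ · dl) × τ · dl ≤ σ · dl ×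
        (∀ l → σ · a ℕ.< l → l ℕ.< σ · cnt → τ · dl ≤ d (at σ Pv (σ · a)) (at σ Pv l))) σ
    minRowW σ a<cnt cnt≤sz att = forW {wf-for = refl} Inv
      (att , ≤-refl , λ _ _ ())
      (λ k τ lt ik sm inv → seqW (fetchW (idx τ sm (sm a refl 0) a<cnt) (seqW (fetchW (idx τ sm ik lt)
        (whenW
          (λ le → whenW
            (λ d≤ → assignW (new τ k lt ik sm inv (subst₂ ℕ._≤_ (trans (ℕₚ.+-comm _ 1) (cong suc (sm a refl 0))) ik le) d≤))
            (λ d≰ → nopW (keep τ k ik sm inv λ _ → ≰⇒≥ d≰)))
          (λ nle → nopW (keep τ k ik sm inv λ gt → contradiction
             (subst₂ ℕ._≤_ (sym (trans (ℕₚ.+-comm _ 1) (cong suc (sm a refl 0)))) (sym ik) gt) nle)))))))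
      (λ τ sm inv → inv)
      where
      Inv : ℕ → State → Set
      Inv k τ = Attained σ (τ · dl) × τ · dl ≤ σ · dl ×
        (∀ l → σ · a ℕ.< l → l ℕ.< k → τ · dl ≤ d (at σ Pv (σ · a)) (at σ Pv l))
      idx : ∀ τ → Same minRow σ τ → ∀ {p q} → p ≡ q → q ℕ.< σ · cnt → p ℕ.< τ · sz
      idx τ sm refl lt = subst (_ ℕ.<_) (sym (sm sz refl 0)) (ℕₚ.<-≤-trans lt cnt≤sz)
      dist≡ : ∀ τ k → τ · b ≡ k → Same minRow σ τ →
              d (at τ Pv (τ · a)) (at τ Pv (τ · b)) ≡ d (at σ Pv (σ · a)) (at σ Pv k)
      dist≡ τ k refl sm = cong₂ d (trans (sm Pv refl _) (cong (at σ Pv) (sm a refl 0))) (sm Pv refl _)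
      new : ∀ τ k → k ℕ.< σ · cnt → τ · b ≡ k → Same minRow σ τ → Inv k τ → σ · a ℕ.< k →
            d (at τ Pv (τ · a)) (at τ Pv (τ · b)) ≤ τ · dl →
            Inv (suc k) (upd dl 0 (d (at τ Pv (τ · a)) (at τ Pv (τ · b))) τ)
      new τ k lt ik sm (_ , le , all) a<k d≤ =
        (σ · a , k , a<k , lt , sym (dist≡ τ k ik sm)) , ≤-trans d≤ le ,
        λ l a<l l<k → [ (λ { refl → ≤-reflexive (dist≡ τ k ik sm) }) ,
                        (λ l<k → ≤-trans d≤ (all l a<l l<k)) ] (<-suc⁻ l<k)
      keep : ∀ τ k → τ · b ≡ k → Same minRow σ τ → Inv k τ →
             (σ · a ℕ.< k → τ · dl ≤ d (at τ Pv (τ · a)) (at τ Pv (τ · b))) →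
             Inv (suc k) τ
      keep τ k ik sm (at′ , le , all) ge = at′ , le ,
        λ l a<l l<k → [ (λ { refl → subst (τ · dl ≤_) (dist≡ τ k ik sm) (ge a<l) }) ,
                        (λ l<k → all l a<l l<k) ] (<-suc⁻ l<k)

    minDistW : ∀ σ → 2 ℕ.≤ σ · cnt → σ · cnt ℕ.≤ σ · sz →
      Wp minDist (λ τ → Attained σ (τ · dl) ×
        (∀ k l → k ℕ.< l → l ℕ.< σ · cnt → τ · dl ≤ d (at σ Pv k) (at σ Pv l))) σ
    minDistW σ 2≤cnt cnt≤sz =
      seqW (fetchW (ℕₚ.<-≤-trans (s≤s z≤n) 2≤sz) (seqW (fetchW 2≤sz (seqW (assignW (forW {wf-for = refl} Inv
        ((0 , 1 , s≤s z≤n , 2≤cnt , refl) , λ _ _ ())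
        (λ k τ lt ik sm inv → conseq (minRowW τ (subst₂ ℕ._<_ (sym ik) (sym (sm cnt refl 0)) lt)
            (subst₂ ℕ._≤_ (sym (sm cnt refl 0)) (sym (sm sz refl 0)) cnt≤sz)
            (toτ τ sm (proj₁ inv)))
          (λ τ′ sm′ post → step k τ τ′ ik sm inv post))
        (λ τ sm (at′ , all) → at′ , λ k l k<l l<cnt → all k l (ℕₚ.<-trans k<l l<cnt) k<l l<cnt)))))))
      where
      2≤sz : 2 ℕ.≤ σ · sz
      2≤sz = ℕₚ.≤-trans 2≤cnt cnt≤sz
      Inv : ℕ → State → Set
      Inv r τ = Attained σ (τ · dl) ×
        (∀ k l → k ℕ.< r → k ℕ.< l → l ℕ.< σ · cnt → τ · dl ≤ d (at σ Pv k) (at σ Pv l))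
      σ₁ : State
      σ₁ = run (dl ≔ δ⟨ ! y , ! y′ ⟩) (upd y′ 0 (at σ Pv 1) (upd y 0 (at σ Pv 0) σ))
      toτ : ∀ τ → Same (for a cnt minRow) σ₁ τ →
            ∀ {r} → Attained σ r → Attained τ r
      toτ τ sm (k , l , k<l , l<c , e) =
        k , l , k<l , subst (l ℕ.<_) (sym (sm cnt refl 0)) l<c , trans (cong₂ d (sm Pv refl k) (sm Pv refl l)) e
      step : ∀ k τ τ′ → τ · a ≡ k →
             Same (for a cnt minRow) σ₁ τ → Inv k τ →
             Attained τ (τ′ · dl) × τ′ · dl ≤ τ · dl ×
               (∀ l → τ · a ℕ.< l → l ℕ.< τ · cnt → τ′ · dl ≤ d (at τ Pv (τ · a)) (at τ Pv l)) →
             Inv (suc k) τ′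
      step k τ τ′ refl sm (_ , all) ((k′ , l′ , k<l , l<c , e) , le , row) =
        (k′ , l′ , k<l , subst (l′ ℕ.<_) (sm cnt refl 0) l<c , trans (sym (cong₂ d (sm Pv refl k′) (sm Pv refl l′))) e) ,
        λ k₁ l₁ k<r k<l l<c → [ (λ { refl → subst (τ′ · dl ≤_) (cong₂ d (sm Pv refl _) (sm Pv refl _))
                                    (row l₁ k<l (subst (l₁ ℕ.<_) (sym (sm cnt refl 0)) l<c)) })
                              , (λ k<r → ≤-trans le (all k₁ l₁ k<r k<l l<c)) ] (<-suc⁻ k<r)

    d-sym : ∀ {p q} → d p q ≡ d q p
    d-sym = Metric.sym _ _

    -- The last conclusion serves to show that the count falls: if every pivot survived, the array
    -- would be unchanged, and its closest pair would contradict the new separation.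
    refilterW : ∀ σ → 0# ≤ σ · dl → σ · cnt ℕ.≤ σ · sz →
      Wp refilter (λ τ → τ · cnt ℕ.≤ σ · cnt × Sep τ (τ · ρ) × τ · ρ ≡ σ · dl + σ · dl ×
        (∀ k → k ℕ.< σ · cnt → Cov τ (τ · ρ) (at σ Pv k)) ×
        (τ · cnt ≡ σ · cnt → ∀ k → at τ Pv k ≡ at σ Pv k)) σ
    refilterW σ 0≤dl cnt≤sz = seqW (assignW (seqW (assignW (seqW (assignW (forW {wf-for = refl} Inv
      (z≤n , (λ _ ()) , refl , (λ _ ()) , (λ _ _ → refl) , λ _ _ → refl)
      (λ k τ lt ik sm inv@(cnt≤k , _) →
        seqW (fetchW (subst₂ ℕ._<_ (sym ik) (sym (sm sz refl 0)) (ℕₚ.<-≤-trans lt cnt≤sz))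
        (conseq (insertW (upd x 0 (at τ Pv (τ · i)) τ)
                   (ℕₚ.≤-<-trans cnt≤k (subst (k ℕ.<_) (sym (sm sz refl 0)) (ℕₚ.<-≤-trans lt cnt≤sz))))
          (λ τ′ sm′ ip → step k τ τ′ ik (sm′ ρ refl 0) inv ip))))
      (λ τ sm (le , sep , e , cv , _ , unch) → le , sep , e , cv , unch)))))))
      where
      Inv : ℕ → State → Set
      Inv k τ = τ · cnt ℕ.≤ k × Sep τ (τ · ρ) × τ · ρ ≡ σ · dl + σ · dl ×
        (∀ l → l ℕ.< k → Cov τ (τ · ρ) (at σ Pv l)) ×
        (∀ l → k ℕ.≤ l → at τ Pv l ≡ at σ Pv l) ×
        (τ · cnt ≡ k → ∀ l → at τ Pv l ≡ at σ Pv l)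
      step : ∀ k τ τ′ → τ · i ≡ k → τ′ · ρ ≡ τ · ρ → Inv k τ →
             InsertPost (upd x 0 (at τ Pv (τ · i)) τ) τ′ → Inv (suc k) τ′
      step k τ τ′ refl eρ (cnt≤k , sep , e , cv , rest , unch) ip rewrite eρ =
        cnt≤ ip , insert-sep {τ₁} {τ′} ip sep , e ,
        (λ l lt → [ (λ { refl → subst (Cov τ′ (τ · ρ)) (rest k ℕₚ.≤-refl)
                          (insert-x {τ₁} {τ′} ip (subst (0# ≤_) (sym e) (+-nonNegative 0≤dl 0≤dl))) })
                  , (λ lt → insert-cov {τ₁} {τ′} ip (cv l lt)) ] (<-suc⁻ lt)) ,
        rest′ ip , unch′ ip
        where
        τ₁ : State
        τ₁ = upd x 0 (at τ Pv k) τ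
        cnt≤ : InsertPost τ₁ τ′ → τ′ · cnt ℕ.≤ suc k
        cnt≤ (inj₁ (e , _)) = subst (ℕ._≤ suc k) (sym e) (ℕₚ.m≤n⇒m≤1+n cnt≤k)
        cnt≤ (inj₂ (e , _)) = subst (ℕ._≤ suc k) (sym e) (s≤s cnt≤k)
        rest′ : InsertPost τ₁ τ′ → ∀ l → suc k ℕ.≤ l → at τ′ Pv l ≡ at σ Pv l
        rest′ (inj₁ (_ , same , _)) l k<l = trans (same l) (rest l (ℕₚ.<⇒≤ k<l))
        rest′ (inj₂ (_ , _ , same , _)) l k<l =
          trans (same l λ { refl → ℕₚ.<⇒≱ k<l cnt≤k }) (rest l (ℕₚ.<⇒≤ k<l))
        unch′ : InsertPost τ₁ τ′ → τ′ · cnt ≡ suc k → ∀ l → at τ′ Pv l ≡ at σ Pv l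
        unch′ (inj₁ (e , _)) e′ = contradiction (subst (ℕ._≤ k) (trans (sym e) e′) cnt≤k) (ℕₚ.<⇒≱ ℕₚ.≤-refl)
        unch′ (inj₂ (e , new , same , _)) e′ l with ℕₚ.suc-injective (trans (sym e) e′)
        ... | cnt≡k with l ℕₚ.≟ τ · cnt
        ... | yes refl = trans new (trans (cong (at τ Pv) (sym cnt≡k)) (unch cnt≡k l))
        ... | no ne    = trans (same l ne) (unch cnt≡k l)

    Spread : ℕ → ℝ → Set
    Spread k e = Σ (ℕ → V) λ g → ∀ l l′ → l ℕ.< l′ → l′ ℕ.< k → e ≤ d (g l) (g l′)

    -- Invariant of the doubling algorithm, where L lists the points still to be
    -- read.  A net of radius 2ρ is affordable because `low` shows that m points
    -- cannot cover at any radius below ρ/4.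
    record Pivots (L : List V) (k : ℕ) (σ : State) : Set where
      field
        cnt≤  : σ · cnt ℕ.≤ k
        sep   : Sep σ (σ · ρ)
        0≤ρ   : 0# ≤ σ · ρ
        low   : σ · ρ ≡ 0# ⊎ (∃[ e ] σ · ρ ≡ e + e × Spread (suc (σ · m)) e)
        cover : ∀ p → p ∈ L ⊎ Cov σ (σ · ρ + σ · ρ) p

    -- Old pivots are more than ρ apart, so ρ ≤ `dl` and the old cover radius 2ρ is at most the new
    -- ρ, which is 2 `dl`. Moving on from an old pivot to a surviving one costs another new ρ, which
    -- adds up to at most the new cover radius.
    overflowW : ∀ {L} σ → Pivots L (suc (σ · m)) σ → 1 ℕ.≤ σ · m → suc (σ · m) ℕ.≤ σ · sz →
      Wp (when (! m ⊕ # 1 ≼ ! cnt) (minDist ⨟ refilter) nop) (Pivots L (σ · m)) σ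
    overflowW {L} σ piv 1≤m m<sz = whenW
      (λ full → seqW (conseq (minDistW σ (ℕₚ.≤-trans (s≤s 1≤m) (m<cnt full)) cnt≤sz)
        (λ τ sm (att , mini) → conseq (refilterW τ (0≤dl att)
             (subst₂ ℕ._≤_ (sym (sm cnt refl 0)) (sym (sm sz refl 0)) cnt≤sz))
          (λ τ′ sm′ post → new τ τ′ full sm sm′ att mini post))))
      (λ ¬full → nopW (record { cnt≤ = ℕ.s≤s⁻¹ (ℕₚ.≰⇒> λ le → ¬full (subst (ℕ._≤ σ · cnt) (ℕₚ.+-comm 1 (σ · m)) le))
                              ; sep = sep ; 0≤ρ = 0≤ρ ; low = low ; cover = cover }))
      where
      open Pivots piv
      cnt≤sz : σ · cnt ℕ.≤ σ · sz
      cnt≤sz = ℕₚ.≤-trans cnt≤ m<sz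
      m<cnt : σ · m ℕ.+ 1 ℕ.≤ σ · cnt → suc (σ · m) ℕ.≤ σ · cnt
      m<cnt = subst (ℕ._≤ σ · cnt) (ℕₚ.+-comm (σ · m) 1)
      0≤dl : ∀ {r} → Attained σ r → 0# ≤ r
      0≤dl (k , l , _ , _ , refl) = Metric.nonNegative
      new : ∀ τ τ′ → σ · m ℕ.+ 1 ℕ.≤ σ · cnt → Same minDist σ τ → Same refilter τ τ′ → Attained σ (τ · dl) →
            (∀ k l → k ℕ.< l → l ℕ.< σ · cnt → τ · dl ≤ d (at σ Pv k) (at σ Pv l)) →
            τ′ · cnt ℕ.≤ τ · cnt × Sep τ′ (τ′ · ρ) × τ′ · ρ ≡ τ · dl + τ · dl ×
              (∀ k → k ℕ.< τ · cnt → Cov τ′ (τ′ · ρ) (at τ Pv k)) ×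
              (τ′ · cnt ≡ τ · cnt → ∀ k → at τ′ Pv k ≡ at τ Pv k) →
            Pivots L (σ · m) τ′
      new τ τ′ full sm sm′ att@(k , l , k<l , l<c , e) mini (le , sep′ , eρ , cv , unch) = record
        { cnt≤  = [ (λ lt → ℕ.s≤s⁻¹ (ℕₚ.<-≤-trans (subst (τ′ · cnt ℕ.<_) (sm cnt refl 0) lt) cnt≤))
                  -- If no pivot was dropped, the closest pair of the old pivots is still present,
                  -- `dl` apart and thus within the new ρ.
                  , (λ eq → contradiction
                      (subst (_≤ τ′ · ρ) (trans (sym e) (trans (cong₂ d (unch′ eq k) (unch′ eq l)) d-sym)) dl≤ρ)
                      (sep′ k<l (subst (l ℕ.<_) (trans (sym (sm cnt refl 0)) (sym eq)) l<c))) ] (ℕₚ.m≤n⇒m<n∨m≡n le)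
        ; sep   = sep′
        ; 0≤ρ   = subst (0# ≤_) (sym eρ) (+-nonNegative (0≤dl att) (0≤dl att))
        -- The m + 1 pivots that caused the overflow are themselves the spread points.
        ; low   = inj₂ (τ · dl , eρ , at σ Pv , λ k l k<l l<m → mini k l k<l
                    (ℕₚ.<-≤-trans (subst (λ v → l ℕ.< suc v) (trans (sm′ m refl 0) (sm m refl 0)) l<m) (m<cnt full)))
        ; cover = λ p → [ inj₁ , (λ c → inj₂ (far-cover p c)) ] (cover p)
        }
        where
        dl≤ρ : τ · dl ≤ τ′ · ρ
        dl≤ρ = subst (τ · dl ≤_) (sym eρ) (x≤x+y (0≤dl att))
        unch′ : τ′ · cnt ≡ τ · cnt → ∀ k → at σ Pv k ≡ at τ′ Pv k
        unch′ eq k = sym (trans (unch eq k) (sm Pv refl k))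
        ρ≤dl : σ · ρ ≤ τ · dl
        ρ≤dl = subst (σ · ρ ≤_) e (subst (σ · ρ ≤_) d-sym (≰⇒≥ (sep k<l l<c)))
        far-cover : ∀ p → Cov σ (σ · ρ + σ · ρ) p → Cov τ′ (τ′ · ρ + τ′ · ρ) p
        far-cover p (k , lt , le) with cv k (subst (k ℕ.<_) (sym (sm cnt refl 0)) lt)
        ... | k′ , lt′ , le′ = k′ , lt′ , ≤-trans (Metric.triangle p (at σ Pv k) (at τ′ Pv k′))
          (+-mono-≤ (≤-trans le (subst (σ · ρ + σ · ρ ≤_) (sym eρ) (+-mono-≤ ρ≤dl ρ≤dl)))
            (subst (λ v → d v (at τ′ Pv k′) ≤ τ′ · ρ) (sm Pv refl k) le′))

    -- The row beyond `m` is the room for the one pivot too many that triggers `refilter`.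
    body₁W : ∀ {p L} σ → Pivots (p ∷ L) (σ · m) σ → 1 ℕ.≤ σ · m → σ · sz ≡ suc (σ · m) →
      Wp body₁ (λ τ → Pivots L (σ · m) τ) (upd x 0 p σ)
    body₁W {p} {L} σ piv 1≤m eq =
      seqW (conseq (insertW (upd x 0 p σ) (subst (σ · cnt ℕ.<_) (sym eq) (s≤s cnt≤)))
        (λ τ sm ip → conseq (overflowW τ (subst (λ v → Pivots L (suc v) τ) (sym (sm m refl 0)) (ins τ sm ip))
              (subst (1 ℕ.≤_) (sym (sm m refl 0)) 1≤m)
              (ℕₚ.≤-reflexive (trans (cong suc (sm m refl 0)) (trans (sym eq) (sym (sm sz refl 0))))))
          (λ τ′ _ → subst (λ v → Pivots L v τ′) (sm m refl 0))))
      where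
      open Pivots piv
      ins : ∀ τ → Same insert (upd x 0 p σ) τ → InsertPost (upd x 0 p σ) τ → Pivots L (suc (σ · m)) τ
      ins τ sm ip = record
        { cnt≤  = [ (λ (e , _) → subst (ℕ._≤ suc (σ · m)) (sym e) (ℕₚ.m≤n⇒m≤1+n cnt≤))
                  , (λ (e , _) → subst (ℕ._≤ suc (σ · m)) (sym e) (s≤s cnt≤)) ] ip
        ; sep   = subst (Sep τ) (sym (sm ρ refl 0)) (insert-sep {upd x 0 p σ} {τ} ip sep)
        ; 0≤ρ   = subst (0# ≤_) (sym (sm ρ refl 0)) 0≤ρ
        ; low   = subst₂ (λ r k → r ≡ 0# ⊎ (∃[ e ] r ≡ e + e × Spread (suc k) e)) (sym (sm ρ refl 0)) (sym (sm m refl 0)) low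
        ; cover = λ p′ → [ (λ { (here refl) → inj₂ (here′ (insert-x {upd x 0 p σ} {τ} ip 0≤ρ)) ; (there p∈) → inj₁ p∈ })
                         , (λ cv → inj₂ (subst (λ r → Cov τ (r + r) p′) (sym (sm ρ refl 0))
                              (insert-cov {upd x 0 p σ} {τ} ip cv))) ] (cover p′)
        }
        where
        here′ : ∀ {p′} → Cov τ (σ · ρ) p′ → Cov τ (τ · ρ + τ · ρ) p′
        here′ (k , lt , le) rewrite sm ρ refl 0 = k , lt , ≤-trans le (x≤x+y 0≤ρ)

    scanRun : HCmd → List V → State → State
    scanRun c []      σ = σ
    scanRun c (p ∷ L) σ = scanRun c L (run c (upd x 0 p σ))

    -- The command `x ≔ ! x ⨟ c` appears only for its frame: it marks `x`, which every item
    -- overwrites, as touched along with all that `c` writes.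
    scanW : ∀ c σ (Inv : List V → State → Set) L → Inv L σ →
            (∀ p L τ → Same (x ≔ ! x ⨟ c) σ τ → Inv (p ∷ L) τ → Wp c (Inv L) (upd x 0 p τ)) →
            Inv [] (scanRun c L σ) × Same (x ≔ ! x ⨟ c) σ (scanRun c L σ)
    scanW c σ Inv L inv step = go L σ inv (λ _ _ _ → refl)
      where
      go : ∀ L τ → Inv L τ → Same (x ≔ ! x ⨟ c) σ τ →
           Inv [] (scanRun c L τ) × Same (x ≔ ! x ⨟ c) σ (scanRun c L τ)
      go []      τ inv sm = inv , sm
      go (p ∷ L) τ inv sm = go L _ (run-wp (step p L τ sm inv)) λ v v∉ k →
        let x≠v , c∌v = ∨-false (same x v) v∉ in
        trans (frame c (upd x 0 p τ) v c∌v k) (trans (upd-var x 0 p τ v k x≠v) (sm v v∉ k))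

if-yes : ∀ {A B : Set} (a? : Dec A) {x y : B} → A → (if does a? then x else y) ≡ x
if-yes a? a rewrite dec-true a? a = refl

if-no : ∀ {A B : Set} (a? : Dec A) {x y : B} → ¬ A → (if does a? then x else y) ≡ y
if-no a? ¬a rewrite dec-false a? ¬a = refl

tally : {A : Set} → (A → Bool) → List A → ℕ
tally f []      = 0
tally f (p ∷ L) = (if f p then 1 else 0) ℕ.+ tally f L

-- Cluster sizes and cheapest representatives in one pass.

module SecondPass (R : Reals) where
  open Reals R
  open RKC R
  open Streaming R
  open FirstPass R public

  hitLoop body₂ reset : HCmd
  -- `RR` is the radius 2ρ within which the first pass leaves every point covered; it bounds the
  -- distance from a point to its pivot from here on.
  reset = RR ≔ ! ρ ⊞ ! ρ ⨟
    for j cnt (save C (! j) (# 0) ⨟ fetch y Pv (! j) ⨟ save B (! j) (! y))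
  hitLoop =
    for j cnt (
      fetch y Pv (! j) ⨟
      when (δ⟨ ! x , ! y ⟩ ⊑ ! RR)
        -- Every pivot near `x` may take `x` as its representative, while `hit` keeps only the last
        -- such pivot, the one cluster in which `x` is counted.
        (hit ≔ ! j ⨟ fetch y′ B (! j) ⨟ when (wt (! x) ⊑ wt (! y′)) (save B (! j) (! x)) nop)
        nop)
  body₂ = hit ≔ # 0 ⨟ hitLoop ⨟ fetch c C (! hit) ⨟ save C (! hit) (! c ⊕ # 1)

  module SecondPassSpec (I : Instance) where
    open Instance I
    open FirstPassSpec I public
    open RealLemmas R

    resetW : ∀ σ → σ · cnt ℕ.≤ σ · sz →
      Wp reset (λ τ → τ · RR ≡ σ · ρ + σ · ρ ×
        (∀ k → k ℕ.< σ · cnt → at τ C k ≡ 0 × at τ B k ≡ at σ Pv k)) σ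
    resetW σ le = seqW (assignW (forW {wf-for = refl} Inv (refl , λ _ ())
      (λ k τ lt ik sm inv → let k<sz = subst₂ ℕ._<_ (sym ik) (sym (sm sz refl 0)) (ℕₚ.<-≤-trans lt le) in
        seqW (saveW k<sz (seqW (fetchW k<sz (saveW k<sz (step k τ ik (sm Pv refl) inv))))))
      (λ τ sm inv → inv)))
      where
      Inv : ℕ → State → Set
      Inv r τ = τ · RR ≡ σ · ρ + σ · ρ × (∀ k → k ℕ.< r → at τ C k ≡ 0 × at τ B k ≡ at σ Pv k)
      step : ∀ k τ → τ · j ≡ k → (∀ l → at τ Pv l ≡ at σ Pv l) → Inv k τ →
             let τ₁ = upd y 0 (at τ Pv (τ · j)) (upd C (τ · j) 0 τ) in
             Inv (suc k) (upd B (τ · j) (at τ Pv (τ · j)) τ₁)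
      step k τ refl smP (e , inv) = e , λ l lt → cell-ok l (<-suc⁻ lt)
        where
        τ₁ : State
        τ₁ = upd y 0 (at τ Pv (τ · j)) (upd C (τ · j) 0 τ)
        cell-ok : ∀ l → l ≡ τ · j ⊎ l ℕ.< τ · j →
                  at (upd C (τ · j) 0 τ) C l ≡ 0 × at (upd B (τ · j) (at τ Pv (τ · j)) τ₁) B l ≡ at σ Pv l
        cell-ok l (inj₁ refl) = upd-same C l 0 τ , trans (upd-same B l _ τ₁) (smP l)
        cell-ok l (inj₂ lt)   = trans (upd-index C (τ · j) 0 τ (ℕₚ.<⇒≢ lt ∘ sym)) (proj₁ (inv l lt))
                              , trans (upd-index B (τ · j) _ τ₁ (ℕₚ.<⇒≢ lt ∘ sym)) (proj₂ (inv l lt))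

    -- The default 0 stands for a point with no near pivot, a case that the cover of the first pass
    -- excludes.
    lastHit : State → V → ℕ → ℕ
    lastHit σ p zero    = 0
    lastHit σ p (suc k) = if does (d p (at σ Pv k) ≤? σ · RR) then k else lastHit σ p k

    home : State → V → ℕ
    home σ p = lastHit σ p (σ · cnt)

    home-near : ∀ σ p → Cov σ (σ · RR) p → home σ p ℕ.< σ · cnt × d p (at σ Pv (home σ p)) ≤ σ · RR
    home-near σ p (k , lt , le) = go (σ · cnt) lt
      where
      go : ∀ l → k ℕ.< l → lastHit σ p l ℕ.< l × d p (at σ Pv (lastHit σ p l)) ≤ σ · RR
      go (suc l) k<l with d p (at σ Pv l) ≤? σ · RR
      ... | yes near = ℕₚ.≤-refl , near
      ... | no ¬near with <-suc⁻ k<l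
      ... | inj₁ refl = contradiction le ¬near
      ... | inj₂ k<l′ with go l k<l′
      ... | lt′ , near = ℕₚ.m<n⇒m<1+n lt′ , near

    -- `cheap` ranges over the whole ball of radius `RR` around the pivot, which contains every
    -- point counted in that cluster.
    record Clusters (σ : State) : Set where
      field
        at-home : ∀ p → home σ p ℕ.< σ · cnt × d p (at σ Pv (home σ p)) ≤ σ · RR
        count   : ∀ k → k ℕ.< σ · cnt → at σ C k ≡ tally (λ p → does (home σ p ℕₚ.≟ k)) (allFin n)
        rep     : ∀ k → k ℕ.< σ · cnt → d (at σ B k) (at σ Pv k) ≤ σ · RR
        cheap   : ∀ k → k ℕ.< σ · cnt → ∀ p → d p (at σ Pv k) ≤ σ · RR → w (at σ B k) ≤ w p

    module _ (σ : State) (p : V) where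

      HitPost : ℕ → State → Set
      HitPost k τ = τ · hit ≡ lastHit σ p k ×
        (∀ l → l ℕ.< k →
          (d (at σ B l) (at σ Pv l) ≤ σ · RR → d (at τ B l) (at σ Pv l) ≤ σ · RR) ×
          w (at τ B l) ≤ w (at σ B l) ×
          (d p (at σ Pv l) ≤ σ · RR → w (at τ B l) ≤ w p)) ×
        (∀ l → k ℕ.≤ l → at τ B l ≡ at σ B l)

      hitLoopW : σ · cnt ℕ.≤ σ · sz → σ · x ≡ p → σ · hit ≡ 0 → Wp hitLoop (HitPost (σ · cnt)) σ
      hitLoopW cnt≤sz refl hit≡0 = forW {wf-for = refl} HitPost
        (hit≡0 , (λ _ ()) , λ _ _ → refl)
        (λ k τ lt ik sm inv → let k<sz = subst₂ ℕ._<_ (sym ik) (sym (sm sz refl 0)) (ℕₚ.<-≤-trans lt cnt≤sz) in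
          seqW (fetchW k<sz (whenW
            (λ near → seqW (assignW (seqW (fetchW k<sz (whenW
              (λ le → saveW k<sz (replaced k τ ik sm inv (near′ τ k ik sm near) le))
              (λ nle → nopW (kept k τ ik sm inv (near′ τ k ik sm near) nle)))))))
            (λ ¬near → nopW (skipped k τ ik sm inv (¬near ∘ ¬near′ τ k ik sm))))))
        (λ τ sm inv → inv)
        where
        near′ : ∀ τ k → τ · j ≡ k → Same hitLoop σ τ → d (τ · x) (at τ Pv (τ · j)) ≤ τ · RR →
                d (σ · x) (at σ Pv k) ≤ σ · RR
        near′ τ k refl sm near = subst₂ _≤_ (cong₂ d (sm x refl 0) (sm Pv refl k)) (sm RR refl 0) near
        ¬near′ : ∀ τ k → τ · j ≡ k → Same hitLoop σ τ → d (σ · x) (at σ Pv k) ≤ σ · RR →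
                 d (τ · x) (at τ Pv (τ · j)) ≤ τ · RR
        ¬near′ τ k refl sm near = subst₂ _≤_ (sym (cong₂ d (sm x refl 0) (sm Pv refl k))) (sym (sm RR refl 0)) near
        replaced : ∀ k τ → τ · j ≡ k → Same hitLoop σ τ → HitPost k τ → d (σ · x) (at σ Pv k) ≤ σ · RR →
                   w (τ · x) ≤ w (at τ B (τ · j)) →
                   let τ₁ = upd y′ 0 (at τ B (τ · j)) (upd hit 0 (τ · j) (upd y 0 (at τ Pv (τ · j)) τ)) in
                   HitPost (suc k) (upd B (τ · j) (τ · x) τ₁)
        replaced k τ refl sm (eh , below , above) near le with τ · x | sm x refl 0
        ... | _ | refl =
          sym (if-yes (d (σ · x) (at σ Pv k) ≤? σ · RR) near) ,
          (λ l lt → go l (<-suc⁻ lt)) ,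
          λ l k<l → trans (upd-index B (τ · j) _ τ₁ (ℕₚ.<⇒≢ k<l)) (above l (ℕₚ.<⇒≤ k<l))
          where
          τ₁ τ₂ : State
          τ₁ = upd y′ 0 (at τ B (τ · j)) (upd hit 0 (τ · j) (upd y 0 (at τ Pv (τ · j)) τ))
          τ₂ = upd B (τ · j) (σ · x) τ₁
          go : ∀ l → l ≡ τ · j ⊎ l ℕ.< τ · j →
            (d (at σ B l) (at σ Pv l) ≤ σ · RR → d (at τ₂ B l) (at σ Pv l) ≤ σ · RR) ×
            w (at τ₂ B l) ≤ w (at σ B l) ×
            (d (σ · x) (at σ Pv l) ≤ σ · RR → w (at τ₂ B l) ≤ w (σ · x))
          go l (inj₁ refl) rewrite upd-same B l (σ · x) τ₁ =
            (λ _ → near) , subst (λ e → w (σ · x) ≤ w e) (above l ℕₚ.≤-refl) le , λ _ → ≤-refl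
          go l (inj₂ lt) rewrite upd-index B (τ · j) (σ · x) τ₁ (ℕₚ.<⇒≢ lt ∘ sym) = below l lt
        kept : ∀ k τ → τ · j ≡ k → Same hitLoop σ τ → HitPost k τ → d (σ · x) (at σ Pv k) ≤ σ · RR →
               ¬ w (τ · x) ≤ w (at τ B (τ · j)) →
               HitPost (suc k) (upd hit 0 (τ · j) τ)
        kept k τ refl sm (eh , below , above) near nle =
          sym (if-yes (d (σ · x) (at σ Pv k) ≤? σ · RR) near) ,
          (λ l lt → [ (λ { refl →
              subst (λ e → d e (at σ Pv l) ≤ σ · RR) (sym (above l ℕₚ.≤-refl)) ,
              ≤-reflexive (cong w (above l ℕₚ.≤-refl)) ,
              λ _ → subst (λ e → w (at τ B l) ≤ w e) (sm x refl 0) (≰⇒≥ nle) }) , below l ] (<-suc⁻ lt)) ,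
          λ l k<l → above l (ℕₚ.<⇒≤ k<l)
        skipped : ∀ k τ → τ · j ≡ k → Same hitLoop σ τ → HitPost k τ → ¬ d (σ · x) (at σ Pv k) ≤ σ · RR →
                  HitPost (suc k) τ
        skipped k τ refl sm (eh , below , above) ¬near =
          trans eh (sym (if-no (d (σ · x) (at σ Pv k) ≤? σ · RR) ¬near)) ,
          (λ l lt → [ (λ { refl →
              subst (λ e → d e (at σ Pv l) ≤ σ · RR) (sym (above l ℕₚ.≤-refl)) ,
              ≤-reflexive (cong w (above l ℕₚ.≤-refl)) ,
              λ near → contradiction near ¬near }) , below l ] (<-suc⁻ lt)) ,
          λ l k<l → above l (ℕₚ.<⇒≤ k<l)

    lastHit-cong : ∀ σ τ p → (∀ k → at τ Pv k ≡ at σ Pv k) → τ · RR ≡ σ · RR →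
                   ∀ k → lastHit τ p k ≡ lastHit σ p k
    lastHit-cong σ τ p eP eR zero    = refl
    lastHit-cong σ τ p eP eR (suc k)
      rewrite eP k | eR | lastHit-cong σ τ p eP eR k = refl

    home-cong : ∀ σ τ p → (∀ k → at τ Pv k ≡ at σ Pv k) → τ · RR ≡ σ · RR → τ · cnt ≡ σ · cnt →
                home τ p ≡ home σ p
    home-cong σ τ p eP eR ec = trans (cong (lastHit τ p) ec) (lastHit-cong σ τ p eP eR (σ · cnt))

    -- L lists the points that are still to be read.
    record Partial (σ : State) (L : List V) (τ : State) : Set where
      field
        count : ∀ k → k ℕ.< σ · cnt →
                at τ C k ℕ.+ tally (λ p → does (home σ p ℕₚ.≟ k)) L ≡ tally (λ p → does (home σ p ℕₚ.≟ k)) (allFin n)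
        rep   : ∀ k → k ℕ.< σ · cnt → d (at τ B k) (at σ Pv k) ≤ σ · RR
        cheap : ∀ k → k ℕ.< σ · cnt → ∀ p → p ∈ L ⊎ (d p (at σ Pv k) ≤ σ · RR → w (at τ B k) ≤ w p)

    body₂W : ∀ σ p L τ → σ · cnt ℕ.≤ σ · sz → (∀ p → Cov σ (σ · RR) p) →
             Same (x ≔ ! x ⨟ body₂) σ τ → Partial σ (p ∷ L) τ → Wp body₂ (Partial σ L) (upd x 0 p τ)
    body₂W σ p L τ cnt≤sz cv sm par =
      seqW (assignW (seqW (conseq (hitLoopW τ₁ p (subst₂ ℕ._≤_ (sym (sm cnt refl 0)) (sym (sm sz refl 0)) cnt≤sz) refl refl)
        (λ τ′ sm′ post → let hit<sz = hit-lt τ′ sm′ post in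
          seqW (fetchW hit<sz (saveW hit<sz (step τ′ sm′ post)))))))
      where
      open Partial par
      τ₁ : State
      τ₁ = upd hit 0 0 (upd x 0 p τ)
      hit≡ : ∀ τ′ → HitPost τ₁ p (τ₁ · cnt) τ′ → τ′ · hit ≡ home σ p
      hit≡ τ′ (e , _) = trans e (home-cong σ τ₁ p (sm Pv refl) (sm RR refl 0) (sm cnt refl 0))
      hit-lt : ∀ τ′ → Same hitLoop τ₁ τ′ → HitPost τ₁ p (τ₁ · cnt) τ′ → τ′ · hit ℕ.< τ′ · sz
      hit-lt τ′ sm′ post = subst₂ ℕ._<_ (sym (hit≡ τ′ post)) (sym (trans (sm′ sz refl 0) (sm sz refl 0)))
        (ℕₚ.<-≤-trans (proj₁ (home-near σ p (cv p))) cnt≤sz)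
      step : ∀ τ′ → Same hitLoop τ₁ τ′ → HitPost τ₁ p (τ₁ · cnt) τ′ →
             let τ″ = upd c 0 (at τ′ C (τ′ · hit)) τ′ in
             Partial σ L (upd C (τ′ · hit) (at τ′ C (τ′ · hit) ℕ.+ 1) τ″)
      step τ′ sm′ post@(_ , below , _) with τ′ · hit | hit≡ τ′ post
      ... | _ | refl = record
        { count = λ k lt → counted k (count k lt)
        ; rep   = λ k lt → subst₂ (λ e r → d (at τ′ B k) e ≤ r) (sm Pv refl k) (sm RR refl 0)
                    (proj₁ (below k (lt′ lt)) (subst₂ (λ e r → d (at τ B k) e ≤ r) (sym (sm Pv refl k)) (sym (sm RR refl 0)) (rep k lt)))
        ; cheap = λ k lt p′ → [ (λ { (here refl) → inj₂ λ near → proj₂ (proj₂ (below k (lt′ lt)))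
                                       (subst₂ (λ e r → d p e ≤ r) (sym (sm Pv refl k)) (sym (sm RR refl 0)) near)
                                   ; (there p∈) → inj₁ p∈ })
                              , (λ ok → inj₂ λ near → ≤-trans (proj₁ (proj₂ (below k (lt′ lt)))) (ok near)) ] (cheap k lt p′)
        }
        where
        lt′ : ∀ {k} → k ℕ.< σ · cnt → k ℕ.< τ₁ · cnt
        lt′ = subst (_ ℕ.<_) (sym (sm cnt refl 0))
        τ″ : State
        τ″ = upd c 0 (at τ′ C (home σ p)) τ′
        T : ℕ → List V → ℕ
        T k = tally (λ p → does (home σ p ℕₚ.≟ k))
        counted : ∀ k → at τ C k ℕ.+ T k (p ∷ L) ≡ T k (allFin n) →
                  at (upd C (home σ p) (at τ′ C (home σ p) ℕ.+ 1) τ″) C k ℕ.+ T k L ≡ T k (allFin n)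
        counted k eq = aux (home σ p ℕₚ.≟ k)
          where
          head≡ : ∀ {v} → (if does (home σ p ℕₚ.≟ k) then 1 else 0) ≡ v →
                  at τ C k ℕ.+ (v ℕ.+ T k L) ≡ T k (allFin n)
          head≡ refl = eq
          aux : Dec (home σ p ≡ k) → at (upd C (home σ p) (at τ′ C (home σ p) ℕ.+ 1) τ″) C k ℕ.+ T k L ≡ T k (allFin n)
          aux (yes refl) = trans (cong (ℕ._+ T k L) (trans (upd-same C k _ τ″) (cong (ℕ._+ 1) (sm′ C refl k))))
                             (trans (ℕₚ.+-assoc (at τ C k) 1 (T k L)) (head≡ (if-yes (home σ p ℕₚ.≟ k) refl)))
          aux (no ne)    = trans (cong (ℕ._+ T k L) (trans (upd-index C (home σ p) _ τ″ ne) (sm′ C refl k)))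
                             (head≡ (if-no (home σ p ℕₚ.≟ k) ne))

cnt-of : ∀ {A B C D E : Set} → A × B × C × D × E → D
cnt-of (_ , _ , _ , e , _) = e

-- Subsets as binary numbers.

parity : ℕ → ℕ
parity zero    = 0
parity (suc k) = 1 ℕ.∸ parity k

-- Halving by counting, since the machine has no division: the half goes up at each even number.
-- `digit` will follow this recursion literally.
half : ℕ → ℕ
half zero    = 0
half (suc k) = if does (parity (suc k) ℕₚ.≤? 0) then half k ℕ.+ 1 else half k

halves : ℕ → ℕ → ℕ
halves zero    S = S
halves (suc l) S = half (halves l S)

bitOf : ℕ → ℕ → ℕ
bitOf S l = parity (halves l S)

parity-even : ∀ k → parity (k ℕ.+ k) ≡ 0
parity-even zero = refl
parity-even (suc k) rewrite ℕₚ.+-suc k k | parity-even k = refl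

half-even : ∀ k → half (k ℕ.+ k) ≡ k
half-odd : ∀ k → half (suc (k ℕ.+ k)) ≡ k
half-odd k rewrite parity-even k = half-even k
half-even zero = refl
half-even (suc k) rewrite ℕₚ.+-suc k k | parity-even k | half-even k = ℕₚ.+-comm k 1

halves-suc : ∀ l S → halves (suc l) S ≡ halves l (half S)
halves-suc zero    S = refl
halves-suc (suc l) S = cong half (halves-suc l S)

-- Guarantees that running through the numbers below 2 ^ k misses no selection of clusters. A digit
-- is put in front by doubling, or doubling and adding one.
encode : ∀ k (f : ℕ → Bool) → ∃[ S ] S ℕ.< 2 ℕ.^ k × (∀ l → l ℕ.< k → bitOf S l ≡ (if f l then 1 else 0))
encode zero    f = 0 , s≤s z≤n , λ _ ()
encode (suc k) f with encode k (f ∘ suc) | f 0 in f0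
... | S , lt , bits | false = S ℕ.+ S , lt′ , λ
        { zero _ → trans (parity-even S) (sym (cong (if_then 1 else 0) f0))
        ; (suc l) (s≤s l<k) → trans (cong parity (trans (halves-suc l (S ℕ.+ S)) (cong (halves l) (half-even S)))) (bits l l<k) }
  where
  lt′ : S ℕ.+ S ℕ.< 2 ℕ.^ suc k
  lt′ rewrite ℕₚ.+-identityʳ (2 ℕ.^ k) = ℕₚ.+-mono-< lt lt
... | S , lt , bits | true = suc (S ℕ.+ S) , lt′ , λ
        { zero _ → trans (cong (1 ℕ.∸_) (parity-even S)) (sym (cong (if_then 1 else 0) f0))
        ; (suc l) (s≤s l<k) → trans (cong parity (trans (halves-suc l (suc (S ℕ.+ S))) (cong (halves l) (half-odd S)))) (bits l l<k) }
  where
  lt′ : suc (S ℕ.+ S) ℕ.< 2 ℕ.^ suc k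
  lt′ rewrite ℕₚ.+-identityʳ (2 ℕ.^ k) | sym (ℕₚ.+-suc S S) = ℕₚ.+-mono-<-≤ lt lt

-- Exhaustive search over selections of clusters and radii.

module Selection (R : Reals) where
  open Reals R
  open RKC R
  open Streaming R
  open SecondPass R public

  digit weighLoop weigh hitLoop₂ hitRow coverLoop coverage update choose trial search decide : HCmd
  decode : Var nat → HCmd
  digit =
    bit ≔ # 0 ⨟ h ≔ # 0 ⨟
    for u q (bit ≔ # 1 ⊖ ! bit ⨟ when (! bit ≼ # 0) (h ≔ ! h ⊕ # 1) nop)
  decode src =
    q ≔ ! src ⨟
    for t cnt (digit ⨟ save F (! t) (! bit) ⨟ q ≔ ! h)
  weighLoop =
    for t cnt (fetch f F (! t) ⨟ when (# 1 ≼ ! f) (fetch y B (! t) ⨟ ws ≔ ! ws ⊞ wt (! y)) nop)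
  weigh =
    ws ≔ real# 0# ⨟ weighLoop
  hitLoop₂ =
    for s cnt (
      fetch f F (! s) ⨟ fetch y′ Pv (! s) ⨟
      when (# 1 ≼ ! f) (when (δ⟨ ! y , ! y′ ⟩ ⊑ ! v) (hit ≔ # 1) nop) nop)
  hitRow = hit ≔ # 0 ⨟ hitLoop₂
  coverLoop =
    for t cnt (
      fetch y Pv (! t) ⨟ hitRow ⨟
      when (# 1 ≼ ! hit) (fetch c C (! t) ⨟ cov ≔ ! cov ⊕ ! c) nop)
  coverage = cov ≔ # 0 ⨟ coverLoop
  update = fnd ≔ # 1 ⨟ bv ≔ ! v ⨟ bS ≔ ! S
  choose =
    when (! ws ⊑ real# 1#)
      (when (! nn ⊖ zin ≼ ! cov) (when (# 1 ≼ ! fnd) (when (! bv ⊑ ! v) nop update) update) nop)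
      nop
  trial =
    decode S ⨟ weigh ⨟
    fetch y Pv (! a) ⨟ fetch y′ Pv (! b) ⨟ v ≔ δ⟨ ! y , ! y′ ⟩ ⨟
    coverage ⨟
    choose
  -- What a selection covers changes only at radii that are distances between two pivots, so only
  -- these are tried; the pairs with `a` equal to `b` supply radius 0.
  search =
    pw ≔ # 1 ⨟ for t cnt (pw ≔ ! pw ⊕ ! pw) ⨟
    fnd ≔ # 0 ⨟
    for a cnt (for b cnt (for S pw trial))
  -- With bv ≤ o + 2 RR, acceptance means 2 RR ≤ o, so the cost of the selected
  -- set is at most bv + 2 RR ≤ 3 o, where o is the optimal cost.
  decide = when ((! RR ⊞ ! RR) ⊞ (! RR ⊞ ! RR) ⊑ ! bv) (acc ≔ # 1) (m ≔ ! m ⊗ ! gg)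

  module SelectionSpec (I : Instance) where
    open Instance I
    open SecondPassSpec I public
    open RealLemmas R

    digitW : ∀ σ → Wp digit (λ τ → τ · bit ≡ parity (σ · q) × τ · h ≡ half (σ · q)) σ
    digitW σ = seqW (assignW (seqW (assignW (forW {wf-for = refl}
      (λ k τ → τ · bit ≡ parity k × τ · h ≡ half k)
      (refl , refl)
      (λ k τ lt ik sm (eb , eh) → seqW (assignW (whenW
        (λ le → assignW (cong (1 ℕ.∸_) eb , trans (cong (ℕ._+ 1) eh)
           (sym (if-yes (parity (suc k) ℕₚ.≤? 0) (subst (λ e → 1 ℕ.∸ e ℕ.≤ 0) eb le)))))
        (λ nle → nopW (cong (1 ℕ.∸_) eb , trans eh
           (sym (if-no (parity (suc k) ℕₚ.≤? 0) (nle ∘ subst (λ e → 1 ℕ.∸ e ℕ.≤ 0) (sym eb)))))))))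
      (λ τ sm inv → inv)))))

    decodeW : ∀ src σ → σ · cnt ℕ.≤ σ · sz →
      Wp (decode src) (λ τ → ∀ l → l ℕ.< σ · cnt → at τ F l ≡ bitOf (σ · src) l) σ
    decodeW src σ le = seqW (assignW (forW {wf-for = refl} Inv
      (refl , λ _ ())
      (λ k τ lt ik sm inv → seqW (conseq (digitW τ) λ τ′ sm′ (eb , eh) →
        seqW (saveW (subst₂ ℕ._<_ (sym (trans (sm′ t refl 0) ik)) (sym (trans (sm′ sz refl 0) (sm sz refl 0))) (ℕₚ.<-≤-trans lt le))
        (assignW (step k τ τ′ (trans (sm′ t refl 0) ik) (sm′ F refl) inv eb eh)))))
      (λ τ sm inv → proj₂ inv)))
      where
      Inv : ℕ → State → Set
      Inv k τ = τ · q ≡ halves k (σ · src) × (∀ l → l ℕ.< k → at τ F l ≡ bitOf (σ · src) l)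
      step : ∀ k τ τ′ → τ′ · t ≡ k → (∀ l → at τ′ F l ≡ at τ F l) → Inv k τ →
             τ′ · bit ≡ parity (τ · q) → τ′ · h ≡ half (τ · q) →
             τ′ · h ≡ halves (suc k) (σ · src) × (∀ l → l ℕ.< suc k → at (upd F (τ′ · t) (τ′ · bit) τ′) F l ≡ bitOf (σ · src) l)
      step k τ τ′ refl eF (eq , bits) eb eh = trans eh (cong half eq) , λ l lt →
        [ (λ { refl → trans (upd-same F l _ τ′) (trans eb (cong parity eq)) })
        , (λ lt → trans (upd-index F (τ′ · t) _ τ′ (ℕₚ.<⇒≢ lt ∘ sym)) (trans (eF l) (bits l lt))) ] (<-suc⁻ lt)

    module Search (σ₀ : State) (cnt≤sz : σ₀ · cnt ℕ.≤ σ₀ · sz) where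

      Base : State → Set
      Base τ = (∀ k → at τ Pv k ≡ at σ₀ Pv k) × (∀ k → at τ B k ≡ at σ₀ B k) × (∀ k → at τ C k ≡ at σ₀ C k) ×
               τ · cnt ≡ σ₀ · cnt × τ · sz ≡ σ₀ · sz × τ · nn ≡ σ₀ · nn

      keeps : HCmd → Bool
      keeps c = not (touches c Pv ∨ (touches c B ∨ (touches c C ∨ (touches c cnt ∨ (touches c sz ∨ touches c nn)))))

      keep : ∀ {c τ τ′} → keeps c ≡ true → Base τ → Same c τ τ′ → Base τ′
      keep {c} ok (eP , eB , eC , ec , es , en) sm
        with k₁ , r₁ ← ∨-false (touches c Pv) (not-true ok)
        with k₂ , r₂ ← ∨-false (touches c B) r₁
        with k₃ , r₃ ← ∨-false (touches c C) r₂
        with k₄ , r₄ ← ∨-false (touches c cnt) r₃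
        with k₅ , k₆ ← ∨-false (touches c sz) r₄ =
          (λ k → trans (sm Pv k₁ k) (eP k)) , (λ k → trans (sm B k₂ k) (eB k)) , (λ k → trans (sm C k₃ k) (eC k)) ,
          trans (sm cnt k₄ 0) ec , trans (sm sz k₅ 0) es , trans (sm nn k₆ 0) en

      base-idx : ∀ {τ k l} → Base τ → l ≡ k → k ℕ.< σ₀ · cnt → l ℕ.< τ · sz
      base-idx {τ} {k} (_ , _ , _ , _ , es , _) refl lt = subst (k ℕ.<_) (sym es) (ℕₚ.<-≤-trans lt cnt≤sz)

      weight-below : (ℕ → ℕ) → ℕ → ℝ
      weight-below bt zero    = 0#
      weight-below bt (suc k) =
        if does (1 ℕₚ.≤? bt k) then weight-below bt k + w (at σ₀ B k) else weight-below bt k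

      hits : (ℕ → ℕ) → ℝ → V → ℕ → ℕ
      hits bt r p zero    = 0
      hits bt r p (suc k) =
        if does (1 ℕₚ.≤? bt k) then (if does (d p (at σ₀ Pv k) ≤? r) then 1 else hits bt r p k) else hits bt r p k

      covered : (ℕ → ℕ) → ℝ → ℕ → ℕ
      covered bt r zero    = 0
      covered bt r (suc k) =
        if does (1 ℕₚ.≤? hits bt r (at σ₀ Pv k) (σ₀ · cnt)) then covered bt r k ℕ.+ at σ₀ C k else covered bt r k

      Ok : ℕ → ℝ → Set
      Ok S r = weight-below (bitOf S) (σ₀ · cnt) ≤ 1# × σ₀ · nn ℕ.∸ z ℕ.≤ covered (bitOf S) r (σ₀ · cnt)

      module _ (bt : ℕ → ℕ) where

        Bits : State → Set
        Bits τ = ∀ l → l ℕ.< σ₀ · cnt → at τ F l ≡ bt l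

        weighW : ∀ τ → Base τ → Bits τ → Wp weigh (λ τ′ → τ′ · ws ≡ weight-below bt (σ₀ · cnt)) τ
        weighW τ bs bits = seqW (assignW (forW {wf-for = refl}
          (λ k τ′ → τ′ · ws ≡ weight-below bt k) refl
          (λ k τ′ lt ik sm inv →
            let lt₀ = subst (k ℕ.<_) (cnt-of bs) lt
                bs′ = keep {weigh} refl bs (same-⨟ (ws ≔ real# 0#) weighLoop sm)
                bit≡ = trans (cong (at τ′ F) ik) (trans (sm F refl k) (bits k lt₀)) in
            seqW (fetchW (base-idx {τ′} bs′ ik lt₀) (whenW
              (λ 1≤f → seqW (fetchW (base-idx {τ′} bs′ ik lt₀) (assignW
                 (trans (cong₂ _+_ inv (cong w (trans (cong (at τ′ B) ik) (proj₁ (proj₂ bs′) k))))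
                    (sym (if-yes (1 ℕₚ.≤? bt k) (subst (1 ℕ.≤_) bit≡ 1≤f)))))))
              (λ ¬1≤f → nopW (trans inv (sym (if-no (1 ℕₚ.≤? bt k) (¬1≤f ∘ subst (1 ℕ.≤_) (sym bit≡)))))))))
          (λ τ′ sm inv → trans inv (cong (weight-below bt) (cnt-of bs)))))

        hitRowW : ∀ τ → Base τ → Bits τ →
          Wp hitRow (λ τ′ → τ′ · hit ≡ hits bt (τ · v) (τ · y) (σ₀ · cnt)) τ
        hitRowW τ bs bits = seqW (assignW (forW {wf-for = refl}
          (λ k τ′ → τ′ · hit ≡ hits bt (τ · v) (τ · y) k) refl
          (λ k τ′ lt ik sm inv →
            let lt₀ = subst (k ℕ.<_) (cnt-of bs) lt
                bs′ = keep {hitRow} refl bs (same-⨟ (hit ≔ # 0) hitLoop₂ sm)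
                bit≡ = trans (cong (at τ′ F) ik) (trans (sm F refl k) (bits k lt₀))
                dist≡ = cong₂ d (sm y refl 0) (trans (cong (at τ′ Pv) ik) (proj₁ bs′ k)) in
            seqW (fetchW (base-idx {τ′} bs′ ik lt₀) (seqW (fetchW (base-idx {τ′} bs′ ik lt₀) (whenW
              (λ 1≤f → let pick = if-yes (1 ℕₚ.≤? bt k) (subst (1 ℕ.≤_) bit≡ 1≤f) in whenW
                (λ near → assignW (sym (trans pick
                  (if-yes (d (τ · y) (at σ₀ Pv k) ≤? τ · v) (subst₂ _≤_ dist≡ (sm v refl 0) near)))))
                (λ ¬near → nopW (trans inv (sym (trans pick
                  (if-no (d (τ · y) (at σ₀ Pv k) ≤? τ · v) (¬near ∘ subst₂ _≤_ (sym dist≡) (sym (sm v refl 0)))))))))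
              (λ ¬1≤f → nopW (trans inv (sym (if-no (1 ℕₚ.≤? bt k) (¬1≤f ∘ subst (1 ℕ.≤_) (sym bit≡)))))))))))
          (λ τ′ sm inv → trans inv (cong (hits bt (τ · v) (τ · y)) (cnt-of bs)))))

        coverW : ∀ τ → Base τ → Bits τ →
          Wp coverage (λ τ′ → τ′ · cov ≡ covered bt (τ · v) (σ₀ · cnt)) τ
        coverW τ bs bits = seqW (assignW (forW {wf-for = refl}
          (λ k τ′ → τ′ · cov ≡ covered bt (τ · v) k) refl
          (λ k τ′ lt ik sm inv →
            let lt₀ = subst (k ℕ.<_) (cnt-of bs) lt
                bs′ = keep {coverage} refl bs (same-⨟ (cov ≔ # 0) coverLoop sm)
                τ₁  = upd y 0 (at τ′ Pv (τ′ · t)) τ′ in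
            seqW (fetchW (base-idx {τ′} bs′ ik lt₀) (seqW (conseq
              (hitRowW τ₁ bs′ (λ l l< → trans (sm F refl l) (bits l l<)))
              (λ τ″ sm″ eh →
                let bs″ = keep {hitRow} refl bs′ sm″
                    hit≡ = trans eh (cong₂ (λ r p → hits bt r p (σ₀ · cnt)) (sm v refl 0)
                             (trans (cong (at τ′ Pv) ik) (proj₁ bs′ k)))
                    cov≡ = trans (sm″ cov refl 0) inv
                    t≡   = trans (sm″ t refl 0) ik in
                whenW
                  (λ 1≤h → seqW (fetchW (base-idx {τ″} bs″ t≡ lt₀) (assignW
                    (trans (cong₂ ℕ._+_ cov≡ (trans (cong (at τ″ C) t≡) (proj₁ (proj₂ (proj₂ bs″)) k)))
                      (sym (if-yes (1 ℕₚ.≤? hits bt (τ · v) (at σ₀ Pv k) (σ₀ · cnt)) (subst (1 ℕ.≤_) hit≡ 1≤h)))))))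
                  (λ ¬1≤h → nopW (trans cov≡
                      (sym (if-no (1 ℕₚ.≤? hits bt (τ · v) (at σ₀ Pv k) (σ₀ · cnt)) (¬1≤h ∘ subst (1 ℕ.≤_) (sym hit≡)))))))))))
          (λ τ′ sm inv → trans inv (cong (covered bt (τ · v)) (cnt-of bs)))))

      gap : ℕ → ℕ → ℝ
      gap k l = d (at σ₀ Pv k) (at σ₀ Pv l)

      -- `fnd` tells whether `bS` and `bv` hold a candidate at all, as no real number can act as an
      -- infinite initial value.
      Best : (ℕ → ℕ → ℕ → Set) → State → Set
      Best Tried τ = (1 ℕ.≤ τ · fnd → Ok (τ · bS) (τ · bv)) ×
        (∀ k l S → Tried k l S → Ok S (gap k l) → 1 ℕ.≤ τ · fnd × τ · bv ≤ gap k l)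

      best-same : ∀ {Tried Tried′ : ℕ → ℕ → ℕ → Set} {τ τ′} → τ′ · fnd ≡ τ · fnd → τ′ · bS ≡ τ · bS → τ′ · bv ≡ τ · bv →
                  (∀ k l S → Tried′ k l S → Ok S (gap k l) → Tried k l S ⊎ (1 ℕ.≤ τ · fnd × τ · bv ≤ gap k l)) →
                  Best Tried τ → Best Tried′ τ′
      best-same {τ = τ} {τ′} ef eS ev sub (ok , all) =
        (λ 1≤f → subst₂ Ok (sym eS) (sym ev) (ok (subst (1 ℕ.≤_) ef 1≤f))) ,
        λ k l S tr o → transport [ (λ tr′ → all k l S tr′ o) , (λ r → r) ] (sub k l S tr o)
        where
        transport : ∀ {A : Set} {r} → (A → 1 ℕ.≤ τ · fnd × τ · bv ≤ r) → A → 1 ℕ.≤ τ′ · fnd × τ′ · bv ≤ r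
        transport f e = let p , q = f e in subst (1 ℕ.≤_) (sym ef) p , subst (_≤ _) (sym ev) q

      Add : (ℕ → ℕ → ℕ → Set) → ℕ → ℕ → ℕ → ℕ → ℕ → ℕ → Set
      Add Tried k l r k′ l′ r′ = Tried k′ l′ r′ ⊎ (k′ ≡ k × l′ ≡ l × r′ ≡ r)

      chooseW : ∀ {Tried : ℕ → ℕ → ℕ → Set} k l τ → Base τ →
        τ · ws ≡ weight-below (bitOf (τ · S)) (σ₀ · cnt) → τ · cov ≡ covered (bitOf (τ · S)) (τ · v) (σ₀ · cnt) →
        τ · v ≡ gap k l → Best Tried τ → Wp choose (Best (Add Tried k l (τ · S))) τ
      chooseW {Tried} k l τ bs ews ecov ev best@(_ , all) with τ · v | ev
      ... | _ | refl = whenW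
        (λ light → whenW
          (λ enough →
            let ok : Ok (τ · S) (gap k l)
                ok = subst (_≤ 1#) ews light , subst₂ (λ p q → p ℕ.∸ z ℕ.≤ q) (proj₂ (proj₂ (proj₂ (proj₂ (proj₂ bs))))) ecov enough in
            whenW
              (λ 1≤f → whenW
                (λ le → nopW (best-same {Tried} {Add Tried k l (τ · S)} {τ} {τ} refl refl refl
                  (λ { _ _ _ (inj₁ tr) _ → inj₁ tr
                     ; _ _ _ (inj₂ (refl , refl , refl)) _ → inj₂ (1≤f , subst (τ · bv ≤_) ev le) }) best))
                (λ nle → improve ok λ k′ l′ r′ tr o →
                  ≤-trans (≰⇒≥ (nle ∘ subst (τ · bv ≤_) (sym ev))) (proj₂ (all k′ l′ r′ tr o))))
              (λ ¬1≤f → improve ok λ k′ l′ r′ tr o → contradiction (proj₁ (all k′ l′ r′ tr o)) ¬1≤f))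
          (λ ¬enough → nopW (fails λ o →
            ¬enough (subst₂ (λ p q → p ℕ.∸ z ℕ.≤ q) (sym (proj₂ (proj₂ (proj₂ (proj₂ (proj₂ bs)))))) (sym ecov) (proj₂ o)))))
        (λ ¬light → nopW (fails λ o → ¬light (subst (_≤ 1#) (sym ews) (proj₁ o))))
        where
        improve : Ok (τ · S) (gap k l) → (∀ k′ l′ r′ → Tried k′ l′ r′ → Ok r′ (gap k′ l′) → gap k l ≤ gap k′ l′) →
                  Wp update (Best (Add Tried k l (τ · S))) τ
        improve ok least = seqW (assignW (seqW (assignW (assignW
          ((λ _ → subst (Ok (τ · S)) (sym ev) ok) ,
           λ { k′ l′ r′ (inj₁ tr) o → ℕₚ.≤-refl , subst (_≤ gap k′ l′) (sym ev) (least k′ l′ r′ tr o)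
             ; k′ l′ r′ (inj₂ (refl , refl , refl)) o → ℕₚ.≤-refl , ≤-reflexive ev })))))
        fails : ¬ Ok (τ · S) (gap k l) → Best (Add Tried k l (τ · S)) τ
        fails ¬ok = best-same {Tried} {Add Tried k l (τ · S)} {τ} {τ} refl refl refl
          (λ { _ _ _ (inj₁ tr) _ → inj₁ tr
             ; _ _ _ (inj₂ (refl , refl , refl)) o → contradiction o ¬ok }) best

      trialW : ∀ {Tried : ℕ → ℕ → ℕ → Set} {k l r} τ → Base τ → τ · a ≡ k → τ · b ≡ l → τ · S ≡ r →
        k ℕ.< σ₀ · cnt → l ℕ.< σ₀ · cnt → Best Tried τ → Wp trial (Best (Add Tried k l r)) τ
      trialW {Tried} {k} {l} {r} τ bs refl refl refl k< l< best =
        seqW (conseq (decodeW S τ (subst₂ ℕ._≤_ (sym cnt≡) (sym (proj₁ (proj₂ (proj₂ (proj₂ (proj₂ bs)))))) cnt≤sz))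
        λ τ₁ sm₁ bits → let bs₁ = keep {decode S} {τ} {τ₁} refl bs sm₁
                            bits₁ = λ l l< → bits l (subst (l ℕ.<_) (sym cnt≡) l<) in
        seqW (conseq (weighW (bitOf r) τ₁ bs₁ bits₁)
        λ τ₂ sm₂ eW → let bs₂ = keep {weigh} {τ₁} {τ₂} refl bs₁ sm₂
                          a≡ = trans (sm₂ a refl 0) (sm₁ a refl 0)
                          b≡ = trans (sm₂ b refl 0) (sm₁ b refl 0) in
        seqW (fetchW (base-idx {τ₂} bs₂ a≡ k<) (seqW (fetchW (base-idx {τ₂} bs₂ b≡ l<) (seqW (assignW
        (seqW (conseq (coverW (bitOf r) _ bs₂ (λ l l< → trans (sm₂ F refl l) (bits₁ l l<)))
        λ τ₃ sm₃ eC →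
          let S≡ = trans (sm₃ S refl 0) (trans (sm₂ S refl 0) (sm₁ S refl 0)) in
          conseq (chooseW {Tried} k l τ₃ (keep {coverage} {_} {τ₃} refl bs₂ sm₃)
              (trans (sm₃ ws refl 0) (trans eW (cong (λ s → weight-below (bitOf s) (σ₀ · cnt)) (sym S≡))))
              (trans eC (cong₂ (λ s r → covered (bitOf s) r (σ₀ · cnt)) (sym S≡) (sym (sm₃ v refl 0))))
              (trans (sm₃ v refl 0) (cong₂ d (trans (cong (at τ₂ Pv) a≡) (proj₁ bs₂ k)) (trans (cong (at τ₂ Pv) b≡) (proj₁ bs₂ l))))
              (best-same {Tried} {Tried} {τ} {τ₃}
                (trans (sm₃ fnd refl 0) (trans (sm₂ fnd refl 0) (sm₁ fnd refl 0)))
                (trans (sm₃ bS refl 0) (trans (sm₂ bS refl 0) (sm₁ bS refl 0)))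
                (trans (sm₃ bv refl 0) (trans (sm₂ bv refl 0) (sm₁ bv refl 0)))
                (λ _ _ _ tr _ → inj₁ tr) best))
            (λ τ₄ _ → subst (λ s → Best (Add Tried k l s) τ₄) S≡))))))))))
        where
        cnt≡ : τ · cnt ≡ σ₀ · cnt
        cnt≡ = cnt-of bs

      best-mono : ∀ {Tried Tried′ : ℕ → ℕ → ℕ → Set} τ → (∀ k l r → Tried′ k l r → Tried k l r) →
                  Best Tried τ → Best Tried′ τ
      best-mono τ sub (ok , all) = ok , λ k l r tr → all k l r (sub k l r tr)

      Count : ℕ
      Count = 2 ℕ.^ (σ₀ · cnt)

      All : ℕ → ℕ → ℕ → Set
      All k l r = k ℕ.< σ₀ · cnt × l ℕ.< σ₀ · cnt × r ℕ.< Count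

      -- `Rows`, `Cols` and `Sets` describe the triples already tried by the three nested loops, in
      -- lexicographic order.
      Rows : ℕ → ℕ → ℕ → ℕ → Set
      Rows k₀ k l r = k ℕ.< k₀ × l ℕ.< σ₀ · cnt × r ℕ.< Count

      Cols : ℕ → ℕ → ℕ → ℕ → ℕ → Set
      Cols k₀ l₀ k l r = Rows k₀ k l r ⊎ (k ≡ k₀ × l ℕ.< l₀ × r ℕ.< Count)

      Sets : ℕ → ℕ → ℕ → ℕ → ℕ → ℕ → Set
      Sets k₀ l₀ r₀ k l r = Cols k₀ l₀ k l r ⊎ (k ≡ k₀ × l ≡ l₀ × r ℕ.< r₀)

      setsW : ∀ k l τ → Base τ → τ · pw ≡ Count → τ · a ≡ k → τ · b ≡ l → k ℕ.< σ₀ · cnt → l ℕ.< σ₀ · cnt →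
              Best (Cols k l) τ → Wp (for S pw trial) (Best (Cols k (suc l))) τ
      setsW k l τ bs epw refl refl k< l< best = forW {wf-for = refl} (λ r → Best (Sets k l r))
        (best-mono {Cols k l} {Sets k l 0} τ (λ { _ _ _ (inj₁ c) → c ; _ _ _ (inj₂ (_ , _ , ())) }) best)
        (λ r τ′ lt ir sm inv → conseq
          (trialW {Sets k l r} τ′ (keep {for S pw trial} {τ} {τ′} refl bs sm) (sm a refl 0) (sm b refl 0) ir k< l< inv)
          (λ τ″ _ → best-mono {Add (Sets k l r) k l r} {Sets k l (suc r)} τ″
            (λ { _ _ _ (inj₁ c) → inj₁ (inj₁ c)
               ; _ _ _ (inj₂ (e , e′ , lt)) → [ (λ e″ → inj₂ (e , e′ , e″)) , (λ lt → inj₁ (inj₂ (e , e′ , lt))) ] (<-suc⁻ lt) })))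
        (λ τ′ sm → best-mono {Sets k l (τ · pw)} {Cols k (suc l)} τ′
          (λ { _ _ _ (inj₁ c) → inj₁ (inj₁ c)
             ; _ _ _ (inj₂ (e , lt , lt′)) → [ (λ e′ → inj₂ (e , e′ , subst (_ ℕ.<_) (sym epw) lt′))
                                             , (λ lt → inj₁ (inj₂ (e , lt , lt′))) ] (<-suc⁻ lt) }))

      colsW : ∀ k τ → Base τ → τ · pw ≡ Count → τ · a ≡ k → k ℕ.< σ₀ · cnt →
              Best (Rows k) τ → Wp (for b cnt (for S pw trial)) (Best (Rows (suc k))) τ
      colsW k τ bs epw refl k< best = forW {wf-for = refl} (λ l → Best (Cols k l))
        (best-mono {Rows k} {Cols k 0} τ (λ { _ _ _ (inj₁ c) → c ; _ _ _ (inj₂ (_ , () , _)) }) best)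
        (λ l τ′ lt il sm inv → setsW k l τ′ (keep {for b cnt (for S pw trial)} {τ} {τ′} refl bs sm)
          (trans (sm pw refl 0) epw) (sm a refl 0) il k< (subst (l ℕ.<_) cnt≡ lt) inv)
        (λ τ′ sm → best-mono {Cols k (τ · cnt)} {Rows (suc k)} τ′
          (λ { _ _ _ (lt , l< , r<) → [ (λ e → inj₂ (e , subst (_ ℕ.<_) (sym cnt≡) l< , r<)) , (λ lt → inj₁ (lt , l< , r<)) ] (<-suc⁻ lt) }))
        where
        cnt≡ : τ · cnt ≡ σ₀ · cnt
        cnt≡ = cnt-of bs

      searchW : Wp search (Best All) σ₀
      searchW = seqW (assignW (seqW (forW {wf-for = refl} (λ k τ → τ · pw ≡ 2 ℕ.^ k) refl
        (λ k τ lt ik sm epw → assignW (trans (cong₂ ℕ._+_ epw epw) (cong (2 ℕ.^ k ℕ.+_) (sym (ℕₚ.+-identityʳ _)))))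
        (λ τ sm epw →
          let bs = keep {for t cnt (pw ≔ ! pw ⊕ ! pw)} {run (pw ≔ # 1) σ₀} {τ} refl
                     ((λ _ → refl) , (λ _ → refl) , (λ _ → refl) , refl , refl , refl) sm in
          seqW (assignW (forW {wf-for = refl} (λ k → Best (Rows k))
          ((λ ()) , λ { _ _ _ (() , _) })
          (λ k τ′ lt ik sm′ inv → colsW k τ′ (keep {for a cnt (for b cnt (for S pw trial))} {upd fnd 0 0 τ} {τ′} refl bs sm′)
             (trans (sm′ pw refl 0) epw) ik (subst (k ℕ.<_) (sm cnt refl 0) lt) inv)
          (λ τ′ sm′ → best-mono {Rows (τ · cnt)} {All} τ′
            (λ { _ _ _ (lt , r) → subst (_ ℕ.<_) (sym (sm cnt refl 0)) lt , r }))))))))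

-- Leaving only the solution in memory, and computing the multiplier.

module Finishing (R : Reals) where
  open Reals R
  open RKC R
  open Streaming R
  open Selection R public

  pick wipeB wipe cleanup : HCmd
  pick = for t cnt (fetch f F (! t) ⨟ when (# 1 ≼ ! f) (fetch y B (! t)) nop)
  wipeB =
    when (! t ⊕ # 1 ≼ ! cnt)
      (fetch f F (! t) ⨟ when (# 1 ≼ ! f) nop (save B (! t) (! y)))
      (save B (! t) (! y))
  -- All `sz` rows are swept, because stale points also lie in the rows beyond the pivots in use.
  wipe = for t sz (
    save x (! t) (! y) ⨟ save y′ (! t) (! y) ⨟ save Pv (! t) (! y) ⨟ wipeB ⨟ save y (! t) (! y))
  -- Every point left in memory is output, so the cells that hold other points
  -- are overwritten with a point of the solution.
  cleanup = decode bS ⨟ pick ⨟ wipe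

  power multiplier : HCmd
  power = pw ≔ # 1 ⨟ for j old (pw ≔ ! pw ⊗ ! gg)
  multiplier =
    -- After `nn` turns either the power has reached n, or `gg` has grown at every turn and equals n
    -- + 2, so that its power reaches n all the same.
    gg ≔ # 2 ⨟ for i nn (power ⨟ when (! pw ⊕ # 1 ≼ ! nn) (gg ≔ ! gg ⊕ # 1) nop)

  module FinishingSpec (I : Instance) where
    open Instance I
    open SelectionSpec I public

    module _ (σ : State) (bt : ℕ → ℕ) where

      Chosen : V → Set
      Chosen p = ∃[ k ] k ℕ.< σ · cnt × 1 ℕ.≤ bt k × p ≡ at σ B k

      pickW : ∀ τ → (∀ k → k ℕ.< σ · cnt → at τ F k ≡ bt k) → (∀ k → at τ B k ≡ at σ B k) →
        τ · cnt ≡ σ · cnt → τ · cnt ℕ.≤ τ · sz →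
        (∃[ k ] k ℕ.< σ · cnt × 1 ℕ.≤ bt k) → Wp pick (λ τ′ → Chosen (τ′ · y)) τ
      pickW τ bits eB ec cnt≤sz (k₀ , k₀< , on) = forW {wf-for = refl} Inv
        (inj₂ λ _ ())
        (λ k τ′ lt ik sm inv →
          let k<sz = subst₂ ℕ._<_ (sym ik) (sym (sm sz refl 0)) (ℕₚ.<-≤-trans lt cnt≤sz)
              k<   = subst (k ℕ.<_) ec lt
              bit≡ = trans (cong (at τ′ F) ik) (trans (sm F refl k) (bits k k<)) in
          seqW (fetchW k<sz (whenW
            (λ 1≤f → fetchW k<sz (inj₁ (k , k< , subst (1 ℕ.≤_) bit≡ 1≤f ,
                       trans (cong (at τ′ B) ik) (trans (sm B refl k) (eB k)))))
            (λ ¬1≤f → nopW ([ inj₁ , (λ none → inj₂ λ l lt →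
                [ (λ { refl on → ¬1≤f (subst (1 ℕ.≤_) (sym bit≡) on) }) , none l ] (<-suc⁻ lt)) ] inv)))))
        (λ τ′ sm → [ (λ c → c) , (λ none → contradiction on (none k₀ (subst (k₀ ℕ.<_) (sym ec) k₀<))) ])
        where
        Inv : ℕ → State → Set
        Inv k τ′ = Chosen (τ′ · y) ⊎ (∀ l → l ℕ.< k → ¬ 1 ℕ.≤ bt l)

      Wiped : ℕ → State → Set
      Wiped k τ = (∀ (z : Var point) l → l ℕ.< k → Chosen (at τ z l)) ×
                  (∀ l → l ℕ.< σ · cnt → 1 ℕ.≤ bt l → at τ B l ≡ at σ B l)

      -- The match on `P` lets the update of a variable of sort `nat` reduce away.
      wiped-t : ∀ {k} l τ → Wiped k τ → Wiped k (upd t 0 l τ)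
      wiped-t l τ (ch , kept) = (λ { (P z) → ch (P z) }) , kept

      chosen-upd : ∀ (z : Var point) k p τ → Chosen p → (∀ l → l ℕ.< k → Chosen (at τ z l)) →
                   ∀ l → l ℕ.< suc k → Chosen (at (upd z k p τ) z l)
      chosen-upd z k p τ ch old l lt with <-suc⁻ lt
      ... | inj₁ refl = subst Chosen (sym (upd-same z l p τ)) ch
      ... | inj₂ lt′  = subst Chosen (sym (upd-index z k p τ (ℕₚ.<⇒≢ lt′ ∘ sym))) (old l lt′)

      wipeBW : ∀ k τ → τ · t ≡ k → (∀ l → l ℕ.< σ · cnt → at τ F l ≡ bt l) → τ · cnt ≡ σ · cnt →
        k ℕ.< τ · sz → Chosen (τ · y) →
        (∀ l → l ℕ.< k → Chosen (at τ B l)) →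
        (∀ l → l ℕ.< σ · cnt → 1 ℕ.≤ bt l → at τ B l ≡ at σ B l) →
        Wp wipeB (λ τ′ → (∀ l → l ℕ.< suc k → Chosen (at τ′ B l)) ×
          (∀ l → l ℕ.< σ · cnt → 1 ℕ.≤ bt l → at τ′ B l ≡ at σ B l)) τ
      wipeBW k τ refl bits ec k<sz ch below kept = whenW
        (λ le → let k< = subst₂ ℕ._≤_ (ℕₚ.+-comm (τ · t) 1) ec le in
          seqW (fetchW k<sz (whenW
            (λ 1≤f → let on = subst (1 ℕ.≤_) (bits k k<) 1≤f in
              nopW ((λ l lt → [ (λ { refl → l , k< , on , kept l k< on }) , below l ] (<-suc⁻ lt)) , kept))
            (λ ¬1≤f → saveW k<sz (overwrite τ (λ l l< on → λ { refl → ¬1≤f (subst (1 ℕ.≤_) (sym (bits l l<)) on) }) ch below kept)))))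
        (λ nle → saveW k<sz (overwrite τ (λ l l< on → λ { refl → nle (subst₂ ℕ._≤_ (ℕₚ.+-comm 1 l) (sym ec) l<) }) ch below kept))
        where
        overwrite : ∀ τ′ → (∀ l → l ℕ.< σ · cnt → 1 ℕ.≤ bt l → k ≢ l) → Chosen (τ · y) →
          (∀ l → l ℕ.< k → Chosen (at τ′ B l)) →
          (∀ l → l ℕ.< σ · cnt → 1 ℕ.≤ bt l → at τ′ B l ≡ at σ B l) →
          (∀ l → l ℕ.< suc k → Chosen (at (upd B k (τ · y) τ′) B l)) ×
          (∀ l → l ℕ.< σ · cnt → 1 ℕ.≤ bt l → at (upd B k (τ · y) τ′) B l ≡ at σ B l)
        overwrite τ′ ne ch below kept = chosen-upd B k (τ · y) τ′ ch below ,
          λ l l< on → trans (upd-index B k (τ · y) τ′ (ne l l< on)) (kept l l< on)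

      wipeW : ∀ τ → (∀ k → k ℕ.< σ · cnt → at τ F k ≡ bt k) → (∀ k → at τ B k ≡ at σ B k) →
        τ · cnt ≡ σ · cnt → Chosen (τ · y) → Wp wipe (Wiped (τ · sz)) τ
      wipeW τ bits eB ec ch = forW {wf-for = refl} (λ k τ′ → Chosen (τ′ · y) × Wiped k τ′)
        (ch , (λ _ _ ()) , λ l _ _ → eB l)
        (λ k τ′ lt ik sm (ch′ , below , kept) →
          let k<sz = subst₂ ℕ._<_ (sym ik) (sym (sm sz refl 0)) lt in
          seqW (saveW k<sz (seqW (saveW k<sz (seqW (saveW k<sz
          (let τ₁ = upd Pv (τ′ · t) (τ′ · y) (upd y′ (τ′ · t) (τ′ · y) (upd x (τ′ · t) (τ′ · y) τ′)) in
          seqW (conseq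
            (wipeBW k τ₁ ik (λ l l< → trans (sm F refl l) (bits l l<)) (trans (sm cnt refl 0) ec) (subst (k ℕ.<_) (sym (sm sz refl 0)) lt) ch′ (below B) kept)
            λ τ″ sm″ (bB , kept″) →
              saveW (subst₂ ℕ._<_ (sym (sm″ t refl 0)) (sym (sm″ sz refl 0)) k<sz)
                (let ch″ , w = finish k τ′ τ″ ik (sm″ t refl 0) (sm″ y refl) (sm″ x refl) (sm″ y′ refl) (sm″ Pv refl) ch′ below bB kept″
                 in ch″ , wiped-t _ _ w)))))))))
        (λ τ′ sm (_ , wiped) → wiped)
        where
        finish : ∀ k τ′ τ″ → τ′ · t ≡ k → τ″ · t ≡ τ′ · t → (∀ l → at τ″ y l ≡ at τ′ y l) →
          (∀ l → at τ″ x l ≡ at (upd x (τ′ · t) (τ′ · y) τ′) x l) →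
          (∀ l → at τ″ y′ l ≡ at (upd y′ (τ′ · t) (τ′ · y) τ′) y′ l) →
          (∀ l → at τ″ Pv l ≡ at (upd Pv (τ′ · t) (τ′ · y) τ′) Pv l) →
          Chosen (τ′ · y) → (∀ (z : Var point) l → l ℕ.< k → Chosen (at τ′ z l)) →
          (∀ l → l ℕ.< suc k → Chosen (at τ″ B l)) →
          (∀ l → l ℕ.< σ · cnt → 1 ℕ.≤ bt l → at τ″ B l ≡ at σ B l) →
          Chosen (at (upd y (τ″ · t) (τ″ · y) τ″) y 0) × Wiped (suc k) (upd y (τ″ · t) (τ″ · y) τ″)
        finish k τ′ τ″ refl e ey ex ey′ eP ch below bB kept rewrite e =
          all-y 0 (s≤s z≤n) , (λ
            { (P Fin.zero) l lt → subst Chosen (sym (ex l)) (chosen-upd x k (τ′ · y) τ′ ch (below x) l lt)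
            ; (P (Fin.suc Fin.zero)) → all-y
            ; (P (Fin.suc (Fin.suc Fin.zero))) l lt → subst Chosen (sym (ey′ l)) (chosen-upd y′ k (τ′ · y) τ′ ch (below y′) l lt)
            ; (P (Fin.suc (Fin.suc (Fin.suc Fin.zero)))) l lt → subst Chosen (sym (eP l)) (chosen-upd Pv k (τ′ · y) τ′ ch (below Pv) l lt)
            ; (P (Fin.suc (Fin.suc (Fin.suc (Fin.suc Fin.zero))))) → bB }) ,
          kept
          where
          all-y : ∀ l → l ℕ.< suc k → Chosen (at (upd y k (τ″ · y) τ″) y l)
          all-y = chosen-upd y k (τ″ · y) τ″ (subst Chosen (sym (ey 0)) ch) (λ l lt → subst Chosen (sym (ey l)) (below y l lt))

    cleanupW : ∀ σ → σ · cnt ℕ.≤ σ · sz → (∃[ k ] k ℕ.< σ · cnt × 1 ℕ.≤ bitOf (σ · bS) k) →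
      Wp cleanup (Wiped σ (bitOf (σ · bS)) (σ · sz)) σ
    cleanupW σ le some = seqW (conseq (decodeW bS σ le) λ τ sm bits → seqW (conseq
      (pickW σ (bitOf (σ · bS)) τ bits (sm B refl) (sm cnt refl 0)
        (subst₂ ℕ._≤_ (sym (sm cnt refl 0)) (sym (sm sz refl 0)) le) some)
      λ τ′ sm′ ch → conseq
        (wipeW σ (bitOf (σ · bS)) τ′ (λ k k< → trans (sm′ F refl k) (bits k k<)) (λ k → trans (sm′ B refl k) (sm B refl k))
           (trans (sm′ cnt refl 0) (sm cnt refl 0)) ch)
        λ τ″ _ → subst (λ k → Wiped σ (bitOf (σ · bS)) k τ″) (trans (sm′ sz refl 0) (sm sz refl 0))))

    powerW : ∀ σ → Wp power (λ τ → τ · pw ≡ (σ · gg) ℕ.^ (σ · old)) σ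
    powerW σ = seqW (assignW (forW {wf-for = refl} (λ k τ → τ · pw ≡ (σ · gg) ℕ.^ k) refl
      (λ k τ lt ik sm e → assignW (trans (cong₂ ℕ._*_ e (sm gg refl 0)) (ℕₚ.*-comm _ (σ · gg))))
      (λ τ sm e → e)))

    -- The last clause records that g is least unless it is 2. As g is at most 2 g′, it will bound g
    -- by twice the r-th root of n.
    IsMultiplier : ℕ → ℕ → Set
    IsMultiplier r g = 2 ℕ.≤ g × n ℕ.≤ g ℕ.^ r × (g ≡ 2 ⊎ (∃[ g′ ] g ≡ suc g′ × 1 ℕ.≤ g′ × g′ ℕ.^ r ℕ.< n))

    multiplierW : ∀ σ → 1 ℕ.≤ σ · old → σ · nn ≡ n → Wp multiplier (λ τ → IsMultiplier (σ · old) (τ · gg)) σ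
    multiplierW σ 1≤r nn≡n = seqW (assignW (forW {wf-for = refl} Inv
      (ℕₚ.≤-refl , inj₁ refl , inj₂ refl)
      (λ k τ lt ik sm inv → seqW (conseq (powerW τ) λ τ′ sm′ ep →
        let pw≡ = trans ep (cong ((τ · gg) ℕ.^_) (sm old refl 0)) in whenW
          (λ le → assignW (grow k τ τ′ (sm′ gg refl 0) inv
             (subst₂ ℕ._<_ pw≡ (trans (sm′ nn refl 0) (trans (sm nn refl 0) nn≡n)) (subst (ℕ._≤ τ′ · nn) (ℕₚ.+-comm _ 1) le))))
          (λ nle → nopW (stay k τ τ′ (sm′ gg refl 0) inv
             (subst₂ ℕ._≤_ (trans (sm′ nn refl 0) (trans (sm nn refl 0) nn≡n)) pw≡
               (ℕ.s≤s⁻¹ (ℕₚ.≰⇒> (nle ∘ subst (ℕ._≤ τ′ · nn) (ℕₚ.+-comm 1 _)))))))))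
      (λ τ sm (2≤g , low , high) → 2≤g , [ (λ p → p) , enough τ ] high , low)))
      where
      Inv : ℕ → State → Set
      Inv k τ = 2 ℕ.≤ τ · gg ×
        (τ · gg ≡ 2 ⊎ (∃[ g′ ] τ · gg ≡ suc g′ × 1 ℕ.≤ g′ × g′ ℕ.^ (σ · old) ℕ.< n)) ×
        (n ℕ.≤ (τ · gg) ℕ.^ (σ · old) ⊎ τ · gg ≡ 2 ℕ.+ k)
      grow : ∀ k τ τ′ → τ′ · gg ≡ τ · gg → Inv k τ → (τ · gg) ℕ.^ (σ · old) ℕ.< n → Inv (suc k) (upd gg 0 (τ′ · gg ℕ.+ 1) τ′)
      grow k τ τ′ e (2≤g , low , high) lt with τ′ · gg
      grow k τ τ′ refl (2≤g , low , high) lt | _ =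
        ℕₚ.≤-trans 2≤g (ℕₚ.m≤m+n _ 1) , inj₂ (τ · gg , ℕₚ.+-comm _ 1 , ℕₚ.<⇒≤ 2≤g , lt) ,
        inj₂ ([ (λ ge → contradiction ge (ℕₚ.<⇒≱ lt)) , (λ e → trans (ℕₚ.+-comm _ 1) (cong suc e)) ] high)
      stay : ∀ k τ τ′ → τ′ · gg ≡ τ · gg → Inv k τ → n ℕ.≤ (τ · gg) ℕ.^ (σ · old) → Inv (suc k) τ′
      stay k τ τ′ e (2≤g , low , high) ge rewrite e = 2≤g , low , inj₁ ge
      enough : ∀ τ → τ · gg ≡ 2 ℕ.+ σ · nn → n ℕ.≤ (τ · gg) ℕ.^ (σ · old)
      enough τ e rewrite e | nn≡n = go (σ · old) 1≤r
        where
        go : ∀ r → 1 ℕ.≤ r → n ℕ.≤ (2 ℕ.+ n) ℕ.^ r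
        go (suc r) _ = ℕₚ.≤-trans (ℕₚ.m≤n+m n 2)
          (ℕₚ.m≤m*n (2 ℕ.+ n) ((2 ℕ.+ n) ℕ.^ r) {{ℕ.>-nonZero (ℕₚ.m^n>0 (2 ℕ.+ n) r)}})

-- The whole program, and the execution of the parts written for the machine itself.

module Algorithm (R : Reals) where
  open Reals R
  open RKC R
  open Streaming R
  open Finishing R public

  column : ∀ {m s k} → Expr m nat → Expr m s → (Fin k → Var s) → List (Fin k) → Cmd m
  column idx e f = foldr (λ i → store (litℕ (class (f i)) +ℕ (idx *ℕ litℕ W)) e ⨾_) skip

  -- Opaque, lest its 43 stores be unfolded in every goal that mentions a row.
  opaque
   row : ∀ {m} → Expr m nat → Expr m point → Cmd m
   row idx p = column idx (litℕ 0) N (allFin 32) ⨾ (column idx (litℝ 0#) Q (allFin 6) ⨾ column idx p P (allFin 5))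

  scanBody : HCmd → Cmd inScan
  scanBody c = store (litℕ (addr x 0)) (current refl) ⨾ compile c

  -- Points exist only inside a scan: row 0 is set up by the first point read.
  firstBody : Cmd inScan
  firstBody =
    -- Memory starts out as zeros of sort `nat`, so `nn` can be read, as 0, before row 0 has been
    -- set up.
    cond (compT (! nn ≼ # 0)) (row (litℕ 0) (current refl) ⨾ put sz (# 1)) skip ⨾
    compile (nn ≔ ! nn ⊕ # 1)

  -- Points can only be copied, so the point cells of a new row are filled with whatever point `x`
  -- holds.
  grow : Cmd outside
  grow = while (compT (! sz ≼ ! m)) (row (compE (! sz)) (compE (! x)) ⨾ put sz (! sz ⊕ # 1))

  clear : HCmd
  clear = cnt ≔ # 0 ⨟ ρ ≔ real# 0#

  -- Kept abstract in its five commands: execution and correctness of an iteration are then proved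
  -- without unfolding the concrete programs.
  iterationOf : (c₁ b₁ c₂ b₂ c₃ : HCmd) → Cmd outside
  iterationOf c₁ b₁ c₂ b₂ c₃ =
    grow ⨾ (compile c₁ ⨾ (pass (scanBody b₁) ⨾ (compile c₂ ⨾ (pass (scanBody b₂) ⨾ compile c₃))))

  mainOf : HCmd → Cmd outside → HCmd → Program
  mainOf c₀ iteration c₁ =
    pass firstBody ⨾ (compile c₀ ⨾ (while (compT (! acc ≼ # 0)) iteration ⨾ compile c₁))

  iteration : Cmd outside
  iteration = iterationOf clear body₁ reset body₂ (search ⨟ decide)

  setup : HCmd → HCmd
  setup G = m ≔ # 1 ⨟ acc ≔ # 0 ⨟ G

  main : HCmd → Program
  main G = mainOf (setup G) iteration cleanup

  module AlgorithmSpec (I : Instance) where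
    open Instance I
    open FinishingSpec I public

    blank : V → ∀ {s} → Var s → Val s
    blank p (N _) = 0
    blank p (Q _) = 0#
    blank p (P _) = p

    addRow : State → State
    addRow σ = state λ z t → if t ≡ᵇ σ · sz then blank (σ · x) z else at σ z t

    extend : State → State
    extend σ = upd sz 0 (suc (σ · sz)) (addRow σ)

    growRun : State → State
    growRun σ = iterate extend (suc (σ · m) ℕ.∸ σ · sz) σ

    iterRunOf : (c₁ b₁ c₂ b₂ c₃ : HCmd) → State → State
    iterRunOf c₁ b₁ c₂ b₂ c₃ σ =
      run c₃ (scanRun b₂ (allFin n) (run c₂ (scanRun b₁ (allFin n) (run c₁ (growRun σ)))))

    iterRun : State → State
    iterRun = iterRunOf clear body₁ reset body₂ (search ⨟ decide)

    firstState : V → ℕ → State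
    firstState p k = iterate (run (nn ≔ ! nn ⊕ # 1)) k (upd sz 0 1 (state λ z _ → blank p z))

    extend-var : ∀ σ {s} (z : Var s) → same sz z ≡ false → 1 ℕ.≤ σ · sz → extend σ · z ≡ σ · z
    extend-var σ z ne 1≤sz = trans (upd-var sz 0 _ (addRow σ) z 0 ne)
      (cong (if_then blank (σ · x) z else σ · z) (≢⇒≡ᵇ {0} {σ · sz} λ e → contradiction (subst (1 ℕ.≤_) (sym e) 1≤sz) λ ()))

    module Execution (M : ℕ) where
      open Semantics I M
      open Sound M

      Holding : Memory → ℕ → ∀ {s} → Var s → Val s → Set
      Holding μ t {s} z v = read μ (addr z t) ≡ just (s , conv s v)

      OffRow : ℕ → Memory → Memory → Set
      OffRow t μ μ′ = ∀ {s} (z : Var s) t′ → t ≢ t′ → read μ′ (addr z t′) ≡ read μ (addr z t′)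

      addr≢ : ∀ {s s′} (z : Var s) (z′ : Var s′) {t t′} → addr z t ≡ addr z′ t′ → t ≡ t′
      addr≢ z z′ {t} {t′} e = ℕₚ.*-cancelʳ-≡ t t′ W (ℕₚ.+-cancelˡ-≡ (class z) _ _
        (trans e (cong (ℕ._+ t′ ℕ.* W) (sym (class-inj z z′ {t} {t′} e)))))

      module _ {mode : Mode} {ρ : Item mode} {t : ℕ} (fits : suc t ℕ.* W ℕ.≤ M) {idx : Expr mode nat}
               {s : Sort} {e : Expr mode s} {v : Val s} where

        -- Index and value are evaluated anew at each store, so they must be stable under changes to
        -- row `t`, the only row written meanwhile.
        column-sound : ∀ {k} (f : Fin k → Var s) L μ →
          (∀ μ′ → OffRow t μ μ′ → eval ρ μ′ idx ≡ just t × eval ρ μ′ e ≡ just (conv s v)) →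
          ∃[ μ′ ] Exec ρ (column idx e f L) μ 0 μ′ × OffRow t μ μ′ ×
            (∀ {s′} (z : Var s′) v′ → (∀ i → i ∈ L → class (f i) ≢ class z) → Holding μ t z v′ → Holding μ′ t z v′) ×
            (∀ i → i ∈ L ⊎ Holding μ t (f i) v → Holding μ′ t (f i) v)
        column-sound f [] μ stable = μ , skip , (λ _ _ _ → refl) , (λ _ _ _ h → h) , λ { i (inj₂ h) → h }
        column-sound f (i ∷ L) μ stable =
          let μ₁ = μ [ fromℕ< lt ]≔ (s , conv s v)
              off₁ : OffRow t μ μ₁
              off₁ z t′ ne = read-update-≢ μ lt _ (ne ∘ addr≢ (f i) z {t} {t′})
              μ′ , ex , off , keep , all = column-sound f L μ₁
                (λ μ′ off → stable μ′ λ z t′ ne → trans (off z t′ ne) (off₁ z t′ ne))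
              ei , ee = stable μ (λ _ _ _ → refl)
          in μ′ , seq (store (addr≡ ei) lt ee) ex ,
             (λ z t′ ne → trans (off z t′ ne) (off₁ z t′ ne)) ,
             (λ z v′ ne h → keep z v′ (λ j j∈ → ne j (there j∈))
               (trans (read-update-≢ μ lt _ (ne i (here refl) ∘ class-inj (f i) z {t} {t})) h)) ,
             λ { j (inj₁ (here refl)) → all j (inj₂ (read-update μ lt _))
               ; j (inj₁ (there j∈)) → all j (inj₁ j∈)
               ; j (inj₂ h) → all j (inj₂ (again j h)) }
          where
          lt : addr (f i) t ℕ.< M
          lt = addr<M (f i) {t} {suc t} ℕₚ.≤-refl fits
          addr≡ : eval ρ μ idx ≡ just t → eval ρ μ (litℕ (class (f i)) +ℕ (idx *ℕ litℕ W)) ≡ just (addr (f i) t)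
          addr≡ eq rewrite eq = refl
          again : ∀ j → Holding μ t (f j) v → Holding (μ [ fromℕ< lt ]≔ (s , conv s v)) t (f j) v
          again j h with addr (f i) t ℕₚ.≟ addr (f j) t
          ... | no ne = trans (read-update-≢ μ lt _ ne) h
          ... | yes eq = trans (cong (read _) (sym eq)) (read-update μ lt _)

      opaque
       unfolding row
       row-sound : ∀ {mode} {ρ : Item mode} {t} → suc t ℕ.* W ℕ.≤ M → ∀ idx e p μ →
         (∀ μ′ → OffRow t μ μ′ → eval ρ μ′ idx ≡ just t × eval ρ μ′ e ≡ just p) →
         ∃[ μ′ ] Exec ρ (row idx e) μ 0 μ′ × OffRow t μ μ′ × (∀ {s} (z : Var s) → Holding μ′ t z (blank p z))
       row-sound {ρ = ρ} {t} fits idx e p μ stable =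
         let μ₁ , ex₁ , off₁ , _ , all₁ = column-sound {ρ = ρ} fits {idx} {nat} {litℕ 0} {0} N (allFin 32) μ
               (λ μ′ off → proj₁ (stable μ′ off) , refl)
             μ₂ , ex₂ , off₂ , keep₂ , all₂ = column-sound {ρ = ρ} fits {idx} {num} {litℝ 0#} {0#} Q (allFin 6) μ₁
               (λ μ′ off → proj₁ (stable μ′ λ z t′ ne → trans (off z t′ ne) (off₁ z t′ ne)) , refl)
             μ₃ , ex₃ , off₃ , keep₃ , all₃ = column-sound {ρ = ρ} fits {idx} {point} {e} {p} P (allFin 5) μ₂
               (λ μ′ off → stable μ′ λ z t′ ne → trans (off z t′ ne) (trans (off₂ z t′ ne) (off₁ z t′ ne)))
         in μ₃ , seq ex₁ (seq ex₂ ex₃) , (λ z t′ ne → trans (off₃ z t′ ne) (trans (off₂ z t′ ne) (off₁ z t′ ne))) ,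
            λ { (N i) → keep₃ (N i) 0 (λ j _ eq → distinct (P j) (N i) refl eq)
                          (keep₂ (N i) 0 (λ j _ eq → distinct (Q j) (N i) refl eq) (all₁ i (inj₁ (∈-allFin i))))
              ; (Q i) → keep₃ (Q i) 0# (λ j _ eq → distinct (P j) (Q i) refl eq) (all₂ i (inj₁ (∈-allFin i)))
              ; (P i) → all₃ i (inj₁ (∈-allFin i)) }
         where
         distinct : ∀ {s s′} (z : Var s) (z′ : Var s′) → same z z′ ≡ false → class z ≢ class z′
         distinct z z′ ne eq with trans (sym ne) (same-class z z′ eq)
         ... | ()

      extend-sound : ∀ {μ σ} → Rep μ σ → 0 ℕ.< σ · sz → suc (σ · sz) ℕ.* W ℕ.≤ M →
        Runs tt (row (compE (! sz)) (compE (! x)) ⨾ put sz (! sz ⊕ # 1)) μ 0 (extend σ)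
      extend-sound {μ} {σ} rep pos fits =
        resize (row-sound {ρ = tt} fits (compE (! sz)) (compE (! x)) (σ · x) μ (λ μ′ off → value off sz , value off x))
        where
        nonzero : σ · sz ≢ 0
        nonzero e = contradiction (subst (0 ℕ.<_) e pos) λ ()
        value : ∀ {μ′} → OffRow (σ · sz) μ μ′ → ∀ {s} (z : Var s) → eval tt μ′ (compE (! z)) ≡ just (conv s (σ · z))
        value {μ′} off {s} z rewrite trans (off z 0 nonzero) (rep z 0 pos) = as-conv s _
        below : ∀ {μ′} → OffRow (σ · sz) μ μ′ → (∀ {s} (z : Var s) → Holding μ′ (σ · sz) z (blank (σ · x) z)) →
                RepBelow (suc (σ · sz)) μ′ (addRow σ)
        below {μ′} off blanks z t lt with <-suc⁻ lt
        ... | inj₁ refl rewrite ≡ᵇ-refl (σ · sz) = blanks z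
        ... | inj₂ lt′ rewrite ≢⇒≡ᵇ {t} {σ · sz} (ℕₚ.<⇒≢ lt′) = trans (off z t (ℕₚ.<⇒≢ lt′ ∘ sym)) (rep z t lt′)
        lt : addr sz 0 ℕ.< M
        lt = addr<M sz {0} {suc (σ · sz)} (s≤s z≤n) fits
        size≡ : ∀ {μ′} → eval tt μ′ (compE (! sz)) ≡ just (σ · sz) → eval tt μ′ (compE (! sz ⊕ # 1)) ≡ just (suc (σ · sz))
        size≡ eq rewrite eq = cong just (ℕₚ.+-comm (σ · sz) 1)
        resize : ∃[ μ′ ] Exec tt (row (compE (! sz)) (compE (! x))) μ 0 μ′ × OffRow (σ · sz) μ μ′ ×
                   (∀ {s} (z : Var s) → Holding μ′ (σ · sz) z (blank (σ · x) z)) →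
                 Runs tt (row (compE (! sz)) (compE (! x)) ⨾ put sz (! sz ⊕ # 1)) μ 0 (extend σ)
        resize (μ₁ , ex₁ , off , blanks) =
          _ , seq ex₁ (store refl lt (size≡ {μ₁} (value off sz))) ,
          RepBelow-upd {suc (σ · sz)} {μ₁} {addRow σ} sz 0 (suc (σ · sz)) lt (below off blanks)

      grow-sound : ∀ k {μ σ} → σ · sz ℕ.+ k ≡ suc (σ · m) → Rep μ σ → 0 ℕ.< σ · sz → suc (σ · m) ℕ.* W ℕ.≤ M →
        Runs tt grow μ 0 (iterate extend k σ) × iterate extend k σ · sz ≡ suc (σ · m)
      grow-sound zero {μ} {σ} eq rep pos fits =
        (_ , stop (trans (test-sound {ρ = tt} rep pos (! sz ≼ ! m)) (cong just (dec-false (σ · sz ℕₚ.≤? σ · m)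
                 (ℕₚ.<⇒≱ (ℕₚ.≤-reflexive (sym sz≡)))))) , rep) , sz≡
        where
        sz≡ : σ · sz ≡ suc (σ · m)
        sz≡ = trans (sym (ℕₚ.+-identityʳ _)) eq
      grow-sound (suc k) {μ} {σ} eq rep pos fits =
        let sz≤m = ℕ.s≤s⁻¹ (subst (suc (σ · sz) ℕ.≤_) (trans (sym (ℕₚ.+-suc (σ · sz) k)) eq) (s≤s (ℕₚ.m≤m+n (σ · sz) k)))
            μ₁ , ex₁ , rep₁ = extend-sound {σ = σ} rep pos (ℕₚ.≤-trans (ℕₚ.*-monoˡ-≤ W (s≤s sz≤m)) fits)
            m≡ = extend-var σ m refl pos
            (μ₂ , ex₂ , rep₂) , sz≡ = grow-sound k {μ₁} {extend σ}
              (trans (sym (ℕₚ.+-suc (σ · sz) k)) (trans eq (cong suc (sym m≡)))) rep₁ (s≤s z≤n)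
              (subst (λ e → suc e ℕ.* W ℕ.≤ M) (sym m≡) fits)
        in (μ₂ , step (trans (test-sound {ρ = tt} rep pos (! sz ≼ ! m)) (cong just (dec-true (σ · sz ℕₚ.≤? σ · m) sz≤m)))
                   (seq ex₁ ex₂) , rep₂) , trans sz≡ (cong suc m≡)

      scan-sound : ∀ c L {μ σ} → wf c ≡ true → Rep μ σ → 0 ℕ.< σ · sz → Fits σ →
        ∃[ μ′ ] Scan (scanBody c) L μ μ′ × Rep μ′ (scanRun c L σ) × scanRun c L σ · sz ≡ σ · sz
      scan-sound c [] ok rep pos fits = _ , [] , rep , refl
      scan-sound c (p ∷ L) {μ} {σ} ok rep pos fits =
        let lt = addr<M x pos fits
            rep₁ = Rep-upd {σ = σ} x 0 p lt refl rep
            μ₂ , ex₂ , rep₂ = sound {ρ = p} c {σ = upd x 0 p σ} ok rep₁ pos fits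
            sz≡ = wf⇒sz {ρ = p} c (upd x 0 p σ) ok
            μ₃ , sc , rep₃ , sz≡₃ = scan-sound c L {μ₂} {run c (upd x 0 p σ)} ok rep₂
              (subst (0 ℕ.<_) (sym sz≡) pos) (subst (λ e → e ℕ.* W ℕ.≤ M) (sym sz≡) fits)
        in μ₃ , seq (store refl lt refl) ex₂ ∷ sc , rep₃ , trans sz≡₃ sz≡

      initial-read : ∀ {a} → a ℕ.< M → read initial a ≡ just (nat , 0)
      initial-read lt = trans (read-< initial lt) (cong just (lookup-replicate (fromℕ< lt) (nat , 0)))

      first-rest : ∀ L {μ σ} → 1 ℕ.≤ σ · nn → Rep μ σ → σ · sz ≡ 1 → 1 ℕ.* W ℕ.≤ M →
        ∃[ μ′ ] Scan firstBody L μ μ′ × Rep μ′ (iterate (run (nn ≔ ! nn ⊕ # 1)) (length L) σ)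
      first-rest [] 1≤nn rep sz≡ fits = _ , [] , rep
      first-rest (p ∷ L) {μ} {σ} 1≤nn rep sz≡ fits =
        let pos = subst (0 ℕ.<_) (sym sz≡) (s≤s z≤n)
            μ₁ , ex₁ , rep₁ = sound {ρ = p} (nn ≔ ! nn ⊕ # 1) {σ = σ} refl rep pos (subst (λ e → e ℕ.* W ℕ.≤ M) (sym sz≡) fits)
            μ₂ , sc , rep₂ = first-rest L {μ₁} {run (nn ≔ ! nn ⊕ # 1) σ} (ℕₚ.≤-trans 1≤nn (ℕₚ.m≤m+n _ 1)) rep₁ sz≡ fits
        in μ₂ , seq (cond (trans (test-sound {ρ = p} rep pos (! nn ≼ # 0))
                      (cong just (dec-false (σ · nn ℕₚ.≤? 0) (ℕₚ.<⇒≱ 1≤nn)))) skip) ex₁ ∷ sc , rep₂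

      first-sound : ∀ p L → 1 ℕ.* W ℕ.≤ M →
        ∃[ μ′ ] Scan firstBody (p ∷ L) initial μ′ × Rep μ′ (firstState p (suc (length L)))
      first-sound p L fits =
        let μ₁ , ex₁ , _ , blanks = row-sound {ρ = p} {t = 0} fits (litℕ 0) (current refl) p initial (λ _ _ → refl , refl)
            lt = addr<M sz {0} {1} (s≤s z≤n) fits
            below₁ : RepBelow 1 μ₁ (state λ z _ → blank p z)
            below₁ = λ { z zero _ → blanks z ; z (suc _) (s≤s ()) }
            rep₂ = RepBelow-upd {1} {μ₁} {state λ z _ → blank p z} sz 0 1 lt below₁
            σ₁ = upd sz 0 1 (state λ z _ → blank p z)
            μ₃ , ex₃ , rep₃ = sound {ρ = p} (nn ≔ ! nn ⊕ # 1) {σ = σ₁} refl rep₂ (s≤s z≤n) fits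
            μ₄ , sc , rep₄ = first-rest L {μ₃} {run (nn ≔ ! nn ⊕ # 1) σ₁} ℕₚ.≤-refl rep₃ refl fits
        in μ₄ , seq (cond (test≡ (initial-read (addr<M nn {0} {1} (s≤s z≤n) fits))) (seq ex₁ (store refl lt refl))) ex₃ ∷ sc , rep₄
        where
        test≡ : read initial (addr nn 0) ≡ just (nat , 0) → test {m = inScan} p initial (compT (! nn ≼ # 0)) ≡ just true
        test≡ eq rewrite eq = refl

-- Execution of the loop over guesses, with its number of passes.

module AlgorithmRuns (R : Reals) where
  open Reals R
  open RKC R
  open Streaming R
  open Algorithm R public

  module RunsSpec (I : Instance) where
    open Instance I
    open AlgorithmSpec I public

    -- Memory has to accommodate each guess before its iteration starts, hence a bound on `M` at
    -- every step.
    data Iterates (f : State → State) (M : ℕ) : ℕ → State → State → Set where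
      done : ∀ {σ} → 1 ℕ.≤ σ · acc → Iterates f M 0 σ σ
      more : ∀ {k σ τ} → σ · acc ≡ 0 → σ · sz ℕ.≤ suc (σ · m) → suc (σ · m) ℕ.* W ℕ.≤ M →
             Iterates f M k (f σ) τ → Iterates f M (suc k) σ τ

    module LoopExecution (M : ℕ) where
      open Semantics I M
      open Sound M
      open Execution M

      record Config (s : ℕ) (μ : Memory) (σ : State) : Set where
        constructor config
        field
          rep  : Rep μ σ
          size : σ · sz ≡ s

      CRuns : ∀ {mode} → Item mode → Cmd mode → Memory → ℕ → ℕ → State → Set
      CRuns ρ c μ p s τ = ∃[ μ′ ] Exec ρ c μ p μ′ × Config s μ′ τ

      module _ {s : ℕ} (pos : 0 ℕ.< s) (fits : s ℕ.* W ℕ.≤ M) where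

        run-config : ∀ {mode} {ρ : Item mode} c {μ σ} → wf c ≡ true → Config s μ σ → CRuns ρ (compile c) μ 0 s (run c σ)
        run-config {ρ = ρ} c {μ} {σ} ok (config rep refl) with sound {ρ = ρ} c ok rep pos fits
        ... | μ₁ , ex₁ , rep₁ = μ₁ , ex₁ , config rep₁ (wf⇒sz {ρ = ρ} c σ ok)

        pass-config : ∀ c {μ σ} → wf c ≡ true → Config s μ σ → CRuns tt (pass (scanBody c)) μ 1 s (scanRun c (allFin n) σ)
        pass-config c {μ} {σ} ok (config rep refl) with scan-sound c (allFin n) ok rep pos fits
        ... | μ₁ , sc₁ , rep₁ , size₁ = μ₁ , pass sc₁ , config rep₁ size₁

        phases : ∀ c₁ b₁ c₂ b₂ c₃ {μ σ} → wf c₁ ≡ true → wf b₁ ≡ true → wf c₂ ≡ true → wf b₂ ≡ true → wf c₃ ≡ true → Config s μ σ →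
          CRuns tt (compile c₁ ⨾ (pass (scanBody b₁) ⨾ (compile c₂ ⨾ (pass (scanBody b₂) ⨾ compile c₃)))) μ 2 s
            (run c₃ (scanRun b₂ (allFin n) (run c₂ (scanRun b₁ (allFin n) (run c₁ σ)))))
        phases c₁ b₁ c₂ b₂ c₃ ok₁ ok₂ ok₃ ok₄ ok₅ cf
          with run-config c₁ ok₁ cf
        ... | _ , ex₁ , cf₁ with pass-config b₁ ok₂ cf₁
        ... | _ , ex₂ , cf₂ with run-config c₂ ok₃ cf₂
        ... | _ , ex₃ , cf₃ with pass-config b₂ ok₄ cf₃
        ... | _ , ex₄ , cf₄ with run-config c₃ ok₅ cf₄
        ... | _ , ex₅ , cf₅ = _ , seq ex₁ (seq ex₂ (seq ex₃ (seq ex₄ ex₅))) , cf₅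

      IterationSound : Cmd outside → (State → State) → Set
      IterationSound iteration f = ∀ {μ σ} → Rep μ σ → 0 ℕ.< σ · sz → σ · sz ℕ.≤ suc (σ · m) → suc (σ · m) ℕ.* W ℕ.≤ M →
        CRuns tt iteration μ 2 (suc (σ · m)) (f σ)

      iteration-sound : ∀ c₁ b₁ c₂ b₂ c₃ → wf c₁ ≡ true → wf b₁ ≡ true → wf c₂ ≡ true → wf b₂ ≡ true → wf c₃ ≡ true →
        IterationSound (iterationOf c₁ b₁ c₂ b₂ c₃) (iterRunOf c₁ b₁ c₂ b₂ c₃)
      iteration-sound c₁ b₁ c₂ b₂ c₃ ok₁ ok₂ ok₃ ok₄ ok₅ {μ} {σ} rep pos le fits
        with grow-sound (suc (σ · m) ℕ.∸ σ · sz) {σ = σ} (ℕₚ.m+[n∸m]≡n le) rep pos fits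
      ... | (_ , ex₁ , rep₁) , size₁
        with phases (s≤s z≤n) fits c₁ b₁ c₂ b₂ c₃ ok₁ ok₂ ok₃ ok₄ ok₅ (config rep₁ size₁)
      ... | _ , ex₂ , cf₂ = _ , seq ex₁ ex₂ , cf₂

      loop-config : ∀ {iteration f} → IterationSound iteration f → ∀ {k s μ σ τ} → Iterates f M k σ τ →
        Config s μ σ → 0 ℕ.< s → s ℕ.* W ℕ.≤ M →
        ∃[ s′ ] CRuns tt (while (compT (! acc ≼ # 0)) iteration) μ (k ℕ.* 2) s′ τ × 0 ℕ.< s′ × s′ ℕ.* W ℕ.≤ M
      loop-config is {σ = σ} (done 1≤acc) cf@(config rep refl) pos fits =
        _ , (_ , stop (trans (test-sound {ρ = tt} rep pos (! acc ≼ # 0)) (cong just (dec-false (σ · acc ℕₚ.≤? 0) (ℕₚ.<⇒≱ 1≤acc)))) , cf) , pos , fits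
      loop-config is {σ = σ} (more acc≡0 le mfits its) (config rep refl) pos fits
        with is {σ = σ} rep pos le mfits
      ... | _ , ex₁ , cf₁ with loop-config is its cf₁ (s≤s z≤n) mfits
      ... | _ , (_ , ex₂ , cf₂) , rest = _ ,
        (_ , step (trans (test-sound {ρ = tt} rep pos (! acc ≼ # 0)) (cong just (dec-true (σ · acc ℕₚ.≤? 0) (ℕₚ.≤-reflexive acc≡0))))
               (seq ex₁ ex₂) , cf₂) , rest

      first-config : ∀ p L → 1 ℕ.* W ℕ.≤ M →
        ∃[ μ ] Scan firstBody (p ∷ L) initial μ × Config 1 μ (firstState p (suc (length L)))
      first-config p L fits with first-sound p L fits
      ... | μ , sc , rep = μ , sc , config rep
        (iterate-frame (run (nn ≔ ! nn ⊕ # 1)) sz 0 (λ _ → refl) (suc (length L)) (upd sz 0 1 (state λ z _ → blank p z)))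

      -- One pass counts the points and sets up row 0, and each of the `k` iterations makes two; the
      -- remaining code makes none.
      main-sound : ∀ c₀ iteration c₁ f → IterationSound iteration f → wf c₀ ≡ true → wf c₁ ≡ true →
        ∀ {p L k τ} → allFin n ≡ p ∷ L → 1 ℕ.* W ℕ.≤ M →
        Iterates f M k (run c₀ (firstState p (suc (length L)))) τ →
        ∃[ s ] CRuns tt (mainOf c₀ iteration c₁) initial (suc (k ℕ.* 2 ℕ.+ 0)) s (run c₁ τ) × s ≡ τ · sz
      main-sound c₀ iteration c₁ f is ok₀ ok₁ {p} {L} {k} {τ} eq fits its
        with first-config p L fits
      ... | μ₁ , sc₁ , cf₁ with run-config (s≤s z≤n) fits c₀ ok₀ cf₁
      ... | _ , ex₂ , cf₂ with loop-config is its cf₂ (s≤s z≤n) fits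
      ... | s , (_ , ex₃ , cf₃@(config _ size₃)) , pos₃ , fits₃ with run-config pos₃ fits₃ c₁ ok₁ cf₃
      ... | _ , ex₄ , cf₄ =
        s , (_ , seq (pass (subst (λ l → Scan firstBody l initial μ₁) (sym eq) sc₁)) (seq ex₂ (seq ex₃ ex₄)) , cf₄) , sym size₃

-- Counting, finite optimisation and sums.

tally-mono : ∀ {A : Set} {f g : A → Bool} → (∀ p → f p ≡ true → g p ≡ true) → ∀ L → tally f L ℕ.≤ tally g L
tally-mono imp []      = z≤n
tally-mono {f = f} {g} imp (p ∷ L) with f p | imp p
... | false | _ = ℕₚ.m≤n⇒m≤o+n _ (tally-mono imp L)
... | true  | h rewrite h refl = s≤s (tally-mono imp L)

tally-tabulate : ∀ {A : Set} {k} (f : A → Bool) (g : Fin k → A) → tally f (List.tabulate g) ≡ ∣ tabulate (f ∘ g) ∣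
tally-tabulate {k = zero}  f g = refl
tally-tabulate {k = suc k} f g with f (g zero)
... | true  = cong suc (tally-tabulate f (g ∘ suc))
... | false = tally-tabulate f (g ∘ suc)

tally-lookup : ∀ {k} (X : Subset k) → tally (lookup X) (allFin k) ≡ ∣ X ∣
tally-lookup X = trans (tally-tabulate (lookup X) id) (cong ∣_∣ (tabulate∘lookup X))

∈-tabulate⁺ : ∀ {k} (f : Fin k → Bool) {i} → f i ≡ true → i ∈ₛ tabulate f
∈-tabulate⁺ f {i} eq = lookup⇒[]= i _ (trans (lookup∘tabulate f i) eq)

∈-tabulate⁻ : ∀ {k} (f : Fin k → Bool) {i} → i ∈ₛ tabulate f → f i ≡ true
∈-tabulate⁻ f {i} i∈ = trans (sym (lookup∘tabulate f i)) ([]=⇒lookup i∈)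

subsets : ∀ k → List (Subset k)
subsets zero    = [] ∷ []
subsets (suc k) = List.map (inside ∷_) (subsets k) ++ List.map (outside ∷_) (subsets k)

∈-subsets : ∀ {k} (X : Subset k) → X ∈ subsets k
∈-subsets []            = here refl
∈-subsets (true ∷ X)  = ∈-++⁺ˡ (∈-map⁺ (inside ∷_) (∈-subsets X))
∈-subsets {suc k} (false ∷ X) = ∈-++⁺ʳ (List.map (inside ∷_) (subsets k)) (∈-map⁺ (outside ∷_) (∈-subsets X))

module _ {A B : Set} {_≼_ : Rel B 0ℓ} (refl-≼ : ∀ {x} → x ≼ x) (trans-≼ : Transitive _≼_) (total : Total _≼_)
         {Q : A → Set} (Q? : Decidable Q) (f : A → B) where

  -- Stated for an arbitrary total preorder, so that the flipped order yields maxima.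
  best : ∀ L → (∀ a → a ∈ L → ¬ Q a) ⊎ (∃[ a ] Q a × (∀ b → b ∈ L → Q b → f a ≼ f b))
  best [] = inj₁ λ _ ()
  best (a ∷ L) with Q? a | best L
  ... | no ¬q | inj₁ none = inj₁ λ { b (here refl) → ¬q ; b (there b∈) → none b b∈ }
  ... | no ¬q | inj₂ (c , qc , least) = inj₂ (c , qc , λ { b (here refl) qb → contradiction qb ¬q ; b (there b∈) → least b b∈ })
  ... | yes q | inj₁ none = inj₂ (a , q , λ { b (here refl) _ → refl-≼ ; b (there b∈) qb → contradiction qb (none b b∈) })
  ... | yes q | inj₂ (c , qc , least) with total (f a) (f c)
  ... | inj₁ le = inj₂ (a , q , λ { b (here refl) _ → refl-≼ ; b (there b∈) qb → trans-≼ le (least b b∈ qb) })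
  ... | inj₂ ge = inj₂ (c , qc , λ { b (here refl) _ → ge ; b (there b∈) → least b b∈ })

  best-of : ∀ L {a} → a ∈ L → Q a → ∃[ a ] Q a × (∀ b → b ∈ L → Q b → f a ≼ f b)
  best-of L a∈ q = [ (λ none → contradiction q (none _ a∈)) , id ] (best L)

module Sums (R : Reals) where
  open Reals R
  open RealLemmas R

  sum-mono : ∀ {k} {f g : Fin k → ℝ} → (∀ i → f i ≤ g i) → sum f ≤ sum g
  sum-mono {zero}  le = ≤-refl
  sum-mono {suc k} le = +-mono-≤ (le zero) (sum-mono (le ∘ suc))

  swap-last : ∀ x y z → x + y + z ≡ x + z + y
  swap-last x y z = trans (+-assoc x y z) (trans (cong (x +_) (+-comm y z)) (sym (+-assoc x z y)))

  -- A pointwise comparison in which coordinate `c` alone pays for `u` and `v`. With one of them 0,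
  -- it charges a single extra weight to that coordinate.
  sum-bump : ∀ {k} {f g : Fin k → ℝ} {u v} c → (∀ i → i ≢ c → f i ≤ g i) → f c + u ≤ g c + v →
             sum f + u ≤ sum g + v
  sum-bump {suc k} {f} {g} {u} {v} zero le lec = subst₂ _≤_ (swap-last (f zero) u _) (swap-last (g zero) v _)
    (+-mono-≤ lec (sum-mono λ i → le (suc i) λ ()))
  sum-bump {suc k} {f} {g} {u} {v} (suc c) le lec = subst₂ _≤_ (sym (+-assoc (f zero) _ u)) (sym (+-assoc (g zero) _ v))
    (+-mono-≤ (le zero λ ()) (sum-bump c (λ i ne → le (suc i) (ne ∘ Finₚ.suc-injective)) lec))

-- Costs without minima, and covers by balls.

module Costs (R : Reals) (I : RKC.Instance R) where
  open Reals R
  open RKC R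
  open RealLemmas R
  open Instance I

  -- A form of "cost at most u" that presupposes no minimum or maximum. The analysis of the
  -- algorithm uses only this; `reaches⇒cost` and `cost⇒reaches` translate.
  Reaches : Subset n → ℝ → Set
  Reaches S u = ∃[ X ] n ℕ.∸ z ℕ.≤ ∣ X ∣ × (∀ i → i ∈ₛ X → ∃[ c ] c ∈ₛ S × d i c ≤ u)

  distance : ∀ S → Nonempty S → ∀ i → ∃ (DistanceTo I i S)
  distance S (c , c∈) i =
    let e , e∈ , least = best-of {_≼_ = _≤_} ≤-refl ≤-trans ≤-total (_∈? S) (d i) (allFin n) (∈-allFin c) c∈
    in d i e , (e , e∈ , refl) , λ { _ (c′ , c′∈ , refl) → least c′ (∈-allFin c′) c′∈ }

  distance-unique : ∀ {S i u v} → DistanceTo I i S u → DistanceTo I i S v → u ≡ v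
  distance-unique (pu , lu) (pv , lv) = ≤-antisym (lu _ pv) (lv _ pu)

  maxDistance : ∀ S → Nonempty S → ∀ X → Nonempty X → ∃ (MaxDistance I X S)
  maxDistance S ne X (i , i∈) =
    let e , e∈ , most = best-of {_≼_ = flip _≤_} ≤-refl (flip ≤-trans) (flip ≤-total)
                          (_∈? X) (proj₁ ∘ distance S ne) (allFin n) (∈-allFin i) i∈
    in proj₁ (distance S ne e) , (e , e∈ , proj₂ (distance S ne e)) ,
       λ { u (j , j∈ , du) → subst (_≤ proj₁ (distance S ne e)) (distance-unique (proj₂ (distance S ne j)) du) (most j (∈-allFin j) j∈) }

  large-nonempty : ∀ (X : Subset n) → n ℕ.∸ z ℕ.≤ ∣ X ∣ → Nonempty X
  large-nonempty X le with nonempty? X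
  ... | yes ne = ne
  ... | no empty = contradiction (ℕₚ.<-≤-trans (ℕₚ.m<n⇒0<n∸m z<n) (subst (n ℕ.∸ z ℕ.≤_) ∣X∣≡0 le)) λ ()
    where
    ∣X∣≡0 : ∣ X ∣ ≡ 0
    ∣X∣≡0 = trans (cong ∣_∣ (Empty-unique empty)) (∣⊥∣≡0 n)

  reaches⇒cost : ∀ S u → Reaches S u → ∃[ v ] Cost I S v × v ≤ u
  reaches⇒cost S u (X , large , near) = g Y , ((Y , Y-large , max-g Y Y-large) , least′) , ≤-trans (least X (∈-subsets X) large) g≤u
    where
    S-nonempty : Nonempty S
    S-nonempty = let i , i∈ = large-nonempty X large ; c , c∈ , _ = near i i∈ in c , c∈
    g : Subset n → ℝ
    g X with nonempty? X
    ... | yes ne = proj₁ (maxDistance S S-nonempty X ne)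
    -- A mere default: a set of at least n - z points is nonempty, because z < n.
    ... | no _   = 0#
    max-g : ∀ X → n ℕ.∸ z ℕ.≤ ∣ X ∣ → MaxDistance I X S (g X)
    max-g X le with nonempty? X
    ... | yes ne = proj₂ (maxDistance S S-nonempty X ne)
    ... | no empty = contradiction (large-nonempty X le) empty
    optimum : ∃[ Y ] n ℕ.∸ z ℕ.≤ ∣ Y ∣ × (∀ X → X ∈ subsets n → n ℕ.∸ z ℕ.≤ ∣ X ∣ → g Y ≤ g X)
    optimum = best-of {_≼_ = _≤_} ≤-refl ≤-trans ≤-total (λ X → n ℕ.∸ z ℕₚ.≤? ∣ X ∣) g (subsets n) (∈-subsets X) large
    Y : Subset n
    Y = proj₁ optimum
    Y-large : n ℕ.∸ z ℕ.≤ ∣ Y ∣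
    Y-large = proj₁ (proj₂ optimum)
    least : ∀ X → X ∈ subsets n → n ℕ.∸ z ℕ.≤ ∣ X ∣ → g Y ≤ g X
    least = proj₂ (proj₂ optimum)
    least′ : ∀ v → (∃[ X ] n ℕ.∸ z ℕ.≤ ∣ X ∣ × MaxDistance I X S v) → g Y ≤ v
    least′ v (X , le , _ , most) = ≤-trans (least X (∈-subsets X) le) (most (g X) (proj₁ (max-g X le)))
    g≤u : g X ≤ u
    g≤u with max-g X large
    ... | (i , i∈ , (_ , below)) , _ = let c , c∈ , le = near i i∈ in ≤-trans (below _ (c , c∈ , refl)) le

  cost⇒reaches : ∀ S v → Cost I S v → Reaches S v
  cost⇒reaches S v ((X , large , (i₀ , _ , (c₀ , c₀∈ , _) , _) , most) , _) = X , large , λ i i∈ →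
    let u , du@((c , c∈ , u≡) , _) = distance S (c₀ , c₀∈) i
    in c , c∈ , subst (_≤ v) u≡ (most u (i , i∈ , du))

  module Metric = IsGeneralMetric isMetric

  Covers : List (Fin n) → ℝ → Set
  Covers L e = ∀ i → ∃[ c ] c ∈ L × d i c ≤ e

  elements : Subset n → List (Fin n)
  elements X = filter (_∈? X) (allFin n)

  length-filter-tally : ∀ {A : Set} {Q : A → Set} (Q? : Decidable Q) L → length (filter Q? L) ≡ tally (does ∘ Q?) L
  length-filter-tally Q? [] = refl
  length-filter-tally Q? (p ∷ L) with does (Q? p)
  ... | true  = cong suc (length-filter-tally Q? L)
  ... | false = length-filter-tally Q? L

  length-elements : ∀ X → length (elements X) ≡ ∣ X ∣
  length-elements X = trans (length-filter-tally (_∈? X) (allFin n))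
    (trans (ℕₚ.≤-antisym (tally-mono (λ p e → to p e) (allFin n)) (tally-mono (λ p e → from p e) (allFin n))) (tally-lookup X))
    where
    to : ∀ p → does (p ∈? X) ≡ true → lookup X p ≡ true
    to p e with p ∈? X
    ... | yes p∈ = []=⇒lookup p∈
    from : ∀ p → lookup X p ≡ true → does (p ∈? X) ≡ true
    from p e with p ∈? X
    ... | yes _ = refl
    ... | no p∉ = contradiction (lookup⇒[]= p X e) p∉

  ∈-elements : ∀ {X i} → i ∈ₛ X → i ∈ elements X
  ∈-elements {X} {i} i∈ = ∈-filter⁺ (_∈? X) (∈-allFin i) i∈

  reaches⇒covers : ∀ S u → 0# ≤ u → Reaches S u → ∃[ L ] length L ℕ.≤ ∣ S ∣ ℕ.+ z × Covers L u
  reaches⇒covers S u 0≤u (X , large , near) = elements S ++ elements (∁ X) , len , covers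
    where
    len : length (elements S ++ elements (∁ X)) ℕ.≤ ∣ S ∣ ℕ.+ z
    len = begin
      length (elements S ++ elements (∁ X))            ≡⟨ length-++ (elements S) ⟩
      length (elements S) ℕ.+ length (elements (∁ X))  ≡⟨ cong₂ ℕ._+_ (length-elements S) (trans (length-elements (∁ X)) (∣∁p∣≡n∸∣p∣ X)) ⟩
      ∣ S ∣ ℕ.+ (n ℕ.∸ ∣ X ∣)                          ≤⟨ ℕₚ.+-monoʳ-≤ ∣ S ∣ (ℕₚ.∸-monoʳ-≤ n large) ⟩
      ∣ S ∣ ℕ.+ (n ℕ.∸ (n ℕ.∸ z))                      ≡⟨ cong (∣ S ∣ ℕ.+_) (ℕₚ.m∸[m∸n]≡n (ℕₚ.<⇒≤ z<n)) ⟩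
      ∣ S ∣ ℕ.+ z                                      ∎
      where open ℕₚ.≤-Reasoning
    covers : Covers (elements S ++ elements (∁ X)) u
    covers i with i ∈? X
    ... | yes i∈ = let c , c∈ , le = near i i∈ in c , ∈-++⁺ˡ (∈-elements c∈) , le
    ... | no i∉ = i , ∈-++⁺ʳ (elements S) (∈-elements (x∉p⇒x∈∁p i∉)) , subst (_≤ u) (sym (Metric.≈⇒0 refl)) 0≤u

  halve-covers : ∀ D → Doubling I D → ∀ {L e} → 0# ≤ e → Covers L (e + e) →
    ∃[ L′ ] real (length L′) ≤ real (length L) * exp₂ D × Covers L′ e
  halve-covers D dbl {L} {e} 0≤e cov = concatMap balls L , len L , covers
    where
    balls : Fin n → List (Fin n)
    balls c = elements (proj₁ (dbl c (e + e) (+-nonNegative 0≤e 0≤e)))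
    len : ∀ L → real (length (concatMap balls L)) ≤ real (length L) * exp₂ D
    len [] = ≤-reflexive (sym (zeroˡ _))
    len (c ∷ L) = subst₂ _≤_
      (trans (sym (real-+ (length (balls c)) (length (concatMap balls L)))) (cong real (sym (length-++ (balls c)))))
      (trans (cong (_+ real (length L) * exp₂ D) (sym (*-identityˡ _))) (sym (distribʳ (exp₂ D) 1# (real (length L)))))
      (+-mono-≤ (subst (λ k → real k ≤ exp₂ D) (sym (length-elements _)) (proj₁ (proj₂ (dbl c (e + e) (+-nonNegative 0≤e 0≤e))))) (len L))
    covers : Covers (concatMap balls L) e
    covers i =
      let c , c∈ , le = cov i
          b , b∈ , le′ = proj₂ (proj₂ (dbl c (e + e) (+-nonNegative 0≤e 0≤e))) i (subst (_≤ e + e) (Metric.sym i c) le)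
      in b , ∈-concatMap⁺ balls (Any.map (λ { refl → ∈-elements b∈ }) c∈) ,
         subst₂ _≤_ (Metric.sym b i) (double-half e) le′

  -- Among k + 1 points, two have their centres at the same position of the list. This is why m
  -- balls of radius e keep the doubling algorithm from overflowing at spread above 2e.
  covers⇒close : ∀ {L e k} (g : ℕ → Fin n) → Covers L e → length L ℕ.≤ k →
    ∃[ l ] ∃[ l′ ] l ℕ.< l′ × l′ ℕ.< suc k × d (g l) (g l′) ≤ e + e
  covers⇒close {L} {e} {k} g cov le with pigeonhole (s≤s le) index
    where
    index : Fin (suc k) → Fin (length L)
    index i = Any.index (proj₁ (proj₂ (cov (g (Fin.toℕ i)))))
  ... | i , j , i<j , eq = Fin.toℕ i , Fin.toℕ j , i<j , toℕ<n j ,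
        ≤-trans (Metric.triangle (g (Fin.toℕ i)) c (g (Fin.toℕ j)))
          (+-mono-≤ le₁ (subst (_≤ e) (trans (cong (d (g (Fin.toℕ j))) (sym same)) (Metric.sym _ c)) le₂))
    where
    c c′ : Fin n
    c = proj₁ (cov (g (Fin.toℕ i)))
    c′ = proj₁ (cov (g (Fin.toℕ j)))
    le₁ : d (g (Fin.toℕ i)) c ≤ e
    le₁ = proj₂ (proj₂ (cov (g (Fin.toℕ i))))
    le₂ : d (g (Fin.toℕ j)) c′ ≤ e
    le₂ = proj₂ (proj₂ (cov (g (Fin.toℕ j))))
    index-∈ : ∀ {x : Fin n} {L} (p : x ∈ L) → x ≡ List.lookup L (Any.index p)
    index-∈ (here refl) = refl
    index-∈ (there p)   = index-∈ p
    same : c ≡ c′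
    same = trans (index-∈ (proj₁ (proj₂ (cov (g (Fin.toℕ i)))))) (trans (cong (List.lookup L) eq) (sym (index-∈ (proj₁ (proj₂ (cov (g (Fin.toℕ j))))))))

-- Translation between selections of clusters and sets of centres.

tally-cong : ∀ {A : Set} {f g : A → Bool} → (∀ p → f p ≡ g p) → ∀ L → tally f L ≡ tally g L
tally-cong eq []      = refl
tally-cong eq (p ∷ L) rewrite eq p = cong (_ ℕ.+_) (tally-cong eq L)

unit : Bool → ℕ
unit b = if b then 1 else 0

tally-+ : ∀ {A : Set} {f g h : A → Bool} → (∀ p → unit (f p) ≡ unit (g p) ℕ.+ unit (h p)) →
          ∀ L → tally f L ≡ tally g L ℕ.+ tally h L
tally-+ eq [] = refl
tally-+ {f = f} {g} {h} eq (p ∷ L) = begin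
  unit (f p) ℕ.+ tally f L                                          ≡⟨ cong₂ ℕ._+_ (eq p) (tally-+ eq L) ⟩
  unit (g p) ℕ.+ unit (h p) ℕ.+ (tally g L ℕ.+ tally h L)           ≡⟨ ℕₚ.+-assoc (unit (g p)) _ _ ⟩
  unit (g p) ℕ.+ (unit (h p) ℕ.+ (tally g L ℕ.+ tally h L))         ≡⟨ cong (unit (g p) ℕ.+_) (swap (unit (h p)) (tally g L) _) ⟩
  unit (g p) ℕ.+ (tally g L ℕ.+ (unit (h p) ℕ.+ tally h L))         ≡⟨ ℕₚ.+-assoc (unit (g p)) _ _ ⟨
  unit (g p) ℕ.+ tally g L ℕ.+ (unit (h p) ℕ.+ tally h L)           ∎
  where
  open ≡-Reasoning
  swap : ∀ a b c → a ℕ.+ (b ℕ.+ c) ≡ b ℕ.+ (a ℕ.+ c)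
  swap a b c = trans (sym (ℕₚ.+-assoc a b c)) (trans (cong (ℕ._+ c) (ℕₚ.+-comm a b)) (ℕₚ.+-assoc b a c))

does⇒ : ∀ {A : Set} (a? : Dec A) → does a? ≡ true → A
does⇒ (yes a) _ = a

module Coresets (R : Reals) (I : RKC.Instance R) where
  open Reals R
  open RKC R
  open RealLemmas R
  open Sums R
  open Instance I
  open Finishing R
  open FinishingSpec I hiding (module Metric)
  open Costs R I

  ind : ∀ {A : Set} → Dec A → ℝ → ℝ
  ind a? r = if does a? then r else 0#

  0≤ind : ∀ {A : Set} (a? : Dec A) {r} → 0# ≤ r → 0# ≤ ind a? r
  0≤ind (yes _) le = le
  0≤ind (no _)  le = ≤-refl

  ind-mono : ∀ {A B : Set} (a? : Dec A) (b? : Dec B) {r} → 0# ≤ r → (A → B) → ind a? r ≤ ind b? r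
  ind-mono (yes a) (yes b) le f = ≤-refl
  ind-mono (yes a) (no ¬b) le f = contradiction (f a) ¬b
  ind-mono (no _)  b?      le f = 0≤ind b? le

  ind-yes : ∀ {A : Set} (a? : Dec A) {r} → A → ind a? r ≡ r
  ind-yes a? = if-yes a?

  ind-no : ∀ {A : Set} (a? : Dec A) {r} → ¬ A → ind a? r ≡ 0#
  ind-no a? = if-no a?

  sum-zero : ∀ k → sum {k} (λ _ → 0#) ≡ 0#
  sum-zero zero    = refl
  sum-zero (suc k) = trans (+-identityˡ _) (sum-zero k)

  module _ (σ : State) (cnt≤sz : σ · cnt ℕ.≤ σ · sz) (clusters : Clusters σ) (nn≡n : σ · nn ≡ n) where
    open Clusters clusters
    open Search σ cnt≤sz

    pivot : V → V
    pivot p = at σ Pv (home σ p)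

    to-pivot : ∀ p → d p (pivot p) ≤ σ · RR
    to-pivot p = proj₂ (at-home p)

    hits⇒ : ∀ bt r p k → 1 ℕ.≤ hits bt r p k → ∃[ l ] l ℕ.< k × 1 ℕ.≤ bt l × d p (at σ Pv l) ≤ r
    hits⇒ bt r p (suc k) = go (1 ℕₚ.≤? bt k) (d p (at σ Pv k) ≤? r)
      where
      weaken : (∃[ l ] l ℕ.< k × 1 ℕ.≤ bt l × d p (at σ Pv l) ≤ r) → ∃[ l ] l ℕ.< suc k × 1 ℕ.≤ bt l × d p (at σ Pv l) ≤ r
      weaken (l , lt , rest) = l , ℕₚ.m<n⇒m<1+n lt , rest
      go : (d₁ : Dec (1 ℕ.≤ bt k)) (d₂ : Dec (d p (at σ Pv k) ≤ r)) →
           1 ℕ.≤ (if does d₁ then (if does d₂ then 1 else hits bt r p k) else hits bt r p k) →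
           ∃[ l ] l ℕ.< suc k × 1 ℕ.≤ bt l × d p (at σ Pv l) ≤ r
      go (yes on) (yes near) _ = k , ℕₚ.≤-refl , on , near
      go (yes on) (no _)     h = weaken (hits⇒ bt r p k h)
      go (no _)   _          h = weaken (hits⇒ bt r p k h)

    ⇒hits : ∀ bt r p k {l} → l ℕ.< k → 1 ℕ.≤ bt l → d p (at σ Pv l) ≤ r → 1 ℕ.≤ hits bt r p k
    ⇒hits bt r p (suc k) {l} lt on near = go (1 ℕₚ.≤? bt k) (d p (at σ Pv k) ≤? r) (<-suc⁻ lt)
      where
      go : (d₁ : Dec (1 ℕ.≤ bt k)) (d₂ : Dec (d p (at σ Pv k) ≤ r)) → l ≡ k ⊎ l ℕ.< k →
           1 ℕ.≤ (if does d₁ then (if does d₂ then 1 else hits bt r p k) else hits bt r p k)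
      go (yes _)  (yes _)    _           = ℕₚ.≤-refl
      go (yes _)  (no ¬near) (inj₁ refl) = contradiction near ¬near
      go (yes _)  (no _)     (inj₂ lt′)  = ⇒hits bt r p k lt′ on near
      go (no ¬on) _          (inj₁ refl) = contradiction on ¬on
      go (no _)   _          (inj₂ lt′)  = ⇒hits bt r p k lt′ on near

    hit? : ∀ bt r p → Dec (1 ℕ.≤ hits bt r (pivot p) (σ · cnt))
    hit? bt r p = 1 ℕₚ.≤? hits bt r (pivot p) (σ · cnt)

    -- Every point is counted at its home and nowhere else, so summing the sizes of clusters amounts
    -- to counting points. The induction adds the clusters one at a time.
    covered-below : ∀ bt r k → k ℕ.≤ σ · cnt →
      covered bt r k ≡ tally (λ p → does (home σ p ℕₚ.<? k) ∧ does (hit? bt r p)) (allFin n)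
    covered-below bt r zero    le = sym (tally-false (allFin n))
      where
      tally-false : ∀ L → tally (λ (_ : V) → false) L ≡ 0
      tally-false []      = refl
      tally-false (_ ∷ L) = tally-false L
    covered-below bt r (suc k) le = go (1 ℕₚ.≤? hits bt r (at σ Pv k) (σ · cnt))
      where
      G : ℕ → V → Bool
      G k p = does (home σ p ℕₚ.<? k) ∧ does (hit? bt r p)
      ih : covered bt r k ≡ tally (G k) (allFin n)
      ih = covered-below bt r k (ℕₚ.<⇒≤ le)
      older : ∀ p → home σ p ≢ k → G (suc k) p ≡ G k p
      older p ne = cong (_∧ does (hit? bt r p)) (bool (home σ p ℕₚ.<? k))
        where
        bool : Dec (home σ p ℕ.< k) → does (home σ p ℕₚ.<? suc k) ≡ does (home σ p ℕₚ.<? k)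
        bool (yes lt) = trans (dec-true (home σ p ℕₚ.<? suc k) (ℕₚ.m<n⇒m<1+n lt)) (sym (dec-true (home σ p ℕₚ.<? k) lt))
        bool (no ¬lt) = trans (dec-false (home σ p ℕₚ.<? suc k) λ lt → [ ne , ¬lt ] (<-suc⁻ lt)) (sym (dec-false (home σ p ℕₚ.<? k) ¬lt))
      at-k : ∀ p → home σ p ≡ k → G (suc k) p ≡ does (hit? bt r p) × G k p ≡ false
      at-k p refl = cong (_∧ does (hit? bt r p)) (dec-true (home σ p ℕₚ.<? suc (home σ p)) ℕₚ.≤-refl)
                  , cong (_∧ does (hit? bt r p)) (dec-false (home σ p ℕₚ.<? home σ p) (ℕₚ.<-irrefl refl))
      go : (de : Dec (1 ℕ.≤ hits bt r (at σ Pv k) (σ · cnt))) →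
           (if does de then covered bt r k ℕ.+ at σ C k else covered bt r k) ≡ tally (G (suc k)) (allFin n)
      go (yes h) = trans (cong₂ ℕ._+_ ih (count k le)) (sym (tally-+ pointwise (allFin n)))
        where
        pointwise : ∀ p → unit (G (suc k) p) ≡ unit (G k p) ℕ.+ unit (does (home σ p ℕₚ.≟ k))
        pointwise p = split (home σ p ℕₚ.≟ k)
          where
          split : Dec (home σ p ≡ k) → unit (G (suc k) p) ≡ unit (G k p) ℕ.+ unit (does (home σ p ℕₚ.≟ k))
          split (yes e) = trans (cong unit (trans (proj₁ (at-k p e))
              (dec-true (hit? bt r p) (subst (λ l → 1 ℕ.≤ hits bt r (at σ Pv l) (σ · cnt)) (sym e) h))))
            (sym (cong₂ ℕ._+_ (cong unit (proj₂ (at-k p e))) (cong unit (dec-true (home σ p ℕₚ.≟ k) e))))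
          split (no ne) = trans (cong unit (older p ne))
            (trans (sym (ℕₚ.+-identityʳ _)) (cong (unit (G k p) ℕ.+_) (cong unit (sym (dec-false (home σ p ℕₚ.≟ k) ne)))))
      go (no ¬h) = trans ih (tally-cong (λ p → sym (split p (home σ p ℕₚ.≟ k))) (allFin n))
        where
        split : ∀ p → Dec (home σ p ≡ k) → G (suc k) p ≡ G k p
        split p (yes e) = trans (proj₁ (at-k p e)) (trans
          (dec-false (hit? bt r p) (¬h ∘ subst (λ l → 1 ℕ.≤ hits bt r (at σ Pv l) (σ · cnt)) e))
          (sym (proj₂ (at-k p e))))
        split p (no ne) = older p ne

    covered≡ : ∀ bt r → covered bt r (σ · cnt) ≡ tally (does ∘ hit? bt r) (allFin n)
    covered≡ bt r = trans (covered-below bt r (σ · cnt) ℕₚ.≤-refl)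
      (tally-cong (λ p → cong (_∧ does (hit? bt r p)) (dec-true (home σ p ℕₚ.<? σ · cnt) (proj₁ (at-home p)))) (allFin n))

    Selected : (ℕ → ℕ) → V → Set
    Selected bt i = ∃[ k ] k ℕ.< σ · cnt × 1 ℕ.≤ bt k × i ≡ at σ B k

    module _ (bt : ℕ → ℕ) where

      selected? : ∀ k i → Dec (∃[ l ] l ℕ.< k × 1 ℕ.≤ bt l × i ≡ at σ B l)
      selected? k i = ℕₚ.anyUpTo? (λ l → (1 ℕₚ.≤? bt l) ×-dec (i Finₚ.≟ at σ B l)) k

      -- An inequality only, because a point that represents several selected clusters is weighed
      -- once in the set but repeatedly by the program; the program errs on the safe side.
      selected-weight : ∀ k → sum (λ i → ind (selected? k i) (w i)) ≤ weight-below bt k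
      selected-weight zero = subst (sum (λ i → ind (selected? 0 i) (w i)) ≤_) (sum-zero n)
        (sum-mono λ i → ≤-reflexive (ind-no (selected? 0 i) {w i} λ ()))
      selected-weight (suc k) = go (1 ℕₚ.≤? bt k)
        where
        φ : ℕ → V → ℝ
        φ k i = ind (selected? k i) (w i)
        go : (de : Dec (1 ℕ.≤ bt k)) → sum (φ (suc k)) ≤ (if does de then weight-below bt k + w (at σ B k) else weight-below bt k)
        go (yes on) = ≤-trans (subst (_≤ sum (φ k) + w (at σ B k)) (+-identityʳ _)
          (sum-bump (at σ B k)
            (λ i ne → ind-mono (selected? (suc k) i) (selected? k i) (0≤w i) λ (l , lt , on , e) →
              [ (λ { refl → contradiction e ne }) , (λ lt → l , lt , on , e) ] (<-suc⁻ lt))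
            (subst₂ _≤_ (trans (sym (ind-yes (selected? (suc k) (at σ B k)) (k , ℕₚ.≤-refl , on , refl))) (sym (+-identityʳ _)))
              (+-comm (w (at σ B k)) (φ k (at σ B k)))
              (x≤x+y (0≤ind (selected? k (at σ B k)) (0≤w _))))))
          (+-monoˡ-≤ (w (at σ B k)) (selected-weight k))
        go (no off) = ≤-trans (sum-mono λ i → ind-mono (selected? (suc k) i) (selected? k i) (0≤w i) λ (l , lt , on , e) →
              [ (λ { refl → contradiction on off }) , (λ lt → l , lt , on , e) ] (<-suc⁻ lt))
          (selected-weight k)

    module _ {S : ℕ} {r : ℝ} (ok : Ok S r) (O : Subset n)
             (O⇒ : ∀ i → i ∈ₛ O → Selected (bitOf S) i) (⇒O : ∀ i → Selected (bitOf S) i → i ∈ₛ O) where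

      ok⇒feasible : Feasible I O
      ok⇒feasible = ≤-trans (sum-mono below) (≤-trans (selected-weight (bitOf S) (σ · cnt)) (proj₁ ok))
        where
        below : ∀ i → (if lookup O i then w i else 0#) ≤ ind (selected? (bitOf S) (σ · cnt) i) (w i)
        below i with lookup O i in eq
        ... | true  = ≤-reflexive (sym (ind-yes (selected? (bitOf S) (σ · cnt) i) (O⇒ i (lookup⇒[]= i O eq))))
        ... | false = 0≤ind (selected? (bitOf S) (σ · cnt) i) (0≤w i)

      -- The path leads from a point to its pivot, on to the pivot of a selected cluster, and from
      -- there to its representative, at costs of at most `RR`, r and `RR`.
      ok⇒reaches : Reaches O (r + (σ · RR + σ · RR))
      ok⇒reaches = X , large , near
        where
        X : Subset n
        X = tabulate (does ∘ hit? (bitOf S) r)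
        large : n ℕ.∸ z ℕ.≤ ∣ X ∣
        large = subst₂ (λ k l → k ℕ.∸ z ℕ.≤ l) nn≡n
          (trans (covered≡ (bitOf S) r) (tally-tabulate (does ∘ hit? (bitOf S) r) id)) (proj₂ ok)
        near : ∀ i → i ∈ₛ X → ∃[ c ] c ∈ₛ O × d i c ≤ r + (σ · RR + σ · RR)
        near i i∈ =
          let k , lt , on , le = hits⇒ (bitOf S) r (pivot i) (σ · cnt) (does⇒ (hit? (bitOf S) r i) (∈-tabulate⁻ (does ∘ hit? (bitOf S) r) i∈))
          in at σ B k , ⇒O _ (k , lt , on , refl) ,
             ≤-trans (Metric.triangle i (pivot i) (at σ B k)) (subst (d i (pivot i) + d (pivot i) (at σ B k) ≤_) regroup
               (+-mono-≤ (to-pivot i) (≤-trans (Metric.triangle (pivot i) (at σ Pv k) (at σ B k))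
                 (+-mono-≤ le (subst (_≤ σ · RR) d-sym (rep k lt))))))
          where
          regroup : σ · RR + (r + σ · RR) ≡ r + (σ · RR + σ · RR)
          regroup = trans (sym (+-assoc _ r _)) (trans (cong (_+ σ · RR) (+-comm (σ · RR) r)) (+-assoc r _ _))

    module _ (O : Subset n) (feasible : Feasible I O) {o : ℝ} (reaches : Reaches O o) where

      -- The selection that imitates `O` consists of the clusters that are home to one of its
      -- centres.
      used? : ∀ k → Dec (∃[ i ] i ∈ₛ O × home σ i ≡ k)
      used? k = any? (λ i → (i ∈? O) ×-dec (home σ i ℕₚ.≟ k))

      code : ∃[ S ] S ℕ.< 2 ℕ.^ (σ · cnt) × (∀ l → l ℕ.< σ · cnt → bitOf S l ≡ (if does (used? l) then 1 else 0))
      code = encode (σ · cnt) (does ∘ used?)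

      S₀ : ℕ
      S₀ = proj₁ code

      on⇒used : ∀ l → l ℕ.< σ · cnt → 1 ℕ.≤ bitOf S₀ l → ∃[ i ] i ∈ₛ O × home σ i ≡ l
      on⇒used l lt on with used? l | proj₂ (proj₂ code) l lt
      ... | yes u | _ = u
      ... | no _  | e = contradiction (subst (1 ℕ.≤_) e on) λ ()

      home-on : ∀ i → i ∈ₛ O → 1 ℕ.≤ bitOf S₀ (home σ i)
      home-on i i∈ = ℕₚ.≤-reflexive (sym (trans (proj₂ (proj₂ code) (home σ i) (proj₁ (at-home i))) (if-yes (used? (home σ i)) (i , i∈ , refl))))

      -- Each selected cluster is charged to a centre of `O` at home in it, which weighs at least as
      -- much as the cheapest representative. Homes being unique, no centre is charged twice.
      light : ∀ k → k ℕ.≤ σ · cnt →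
        weight-below (bitOf S₀) k ≤ sum (λ i → ind ((i ∈? O) ×-dec (home σ i ℕₚ.<? k)) (w i))
      light zero le = subst (_≤ sum (λ i → ind ((i ∈? O) ×-dec (home σ i ℕₚ.<? 0)) (w i))) (sum-zero n)
        (sum-mono λ i → 0≤ind ((i ∈? O) ×-dec (home σ i ℕₚ.<? 0)) (0≤w i))
      light (suc k) lt = go (1 ℕₚ.≤? bitOf S₀ k)
        where
        e? : ∀ k i → Dec (i ∈ₛ O × home σ i ℕ.< k)
        e? k i = (i ∈? O) ×-dec (home σ i ℕₚ.<? k)
        φ : ℕ → V → ℝ
        φ k i = ind (e? k i) (w i)
        up : ∀ i → φ k i ≤ φ (suc k) i
        up i = ind-mono (e? k i) (e? (suc k) i) (0≤w i) λ (i∈ , lt) → i∈ , ℕₚ.m<n⇒m<1+n lt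
        go : (de : Dec (1 ℕ.≤ bitOf S₀ k)) →
             (if does de then weight-below (bitOf S₀) k + w (at σ B k) else weight-below (bitOf S₀) k) ≤ sum (φ (suc k))
        go (no _) = ≤-trans (light k (ℕₚ.<⇒≤ lt)) (sum-mono up)
        go (yes on) with on⇒used k lt on
        ... | i , i∈ , refl = ≤-trans (+-monoˡ-≤ (w (at σ B k)) (light k (ℕₚ.<⇒≤ lt)))
          (subst (sum (φ k) + w (at σ B k) ≤_) (+-identityʳ _) (sum-bump i (λ j _ → up j)
            (subst₂ _≤_ (trans (sym (+-identityˡ _)) (cong (_+ w (at σ B k)) (sym (ind-no (e? k i) λ (_ , lt) → ℕₚ.<-irrefl refl lt))))
              (trans (sym (ind-yes (e? (suc k) i) (i∈ , ℕₚ.≤-refl))) (sym (+-identityʳ _)))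
              (cheap k lt i (to-pivot i)))))

      light-enough : weight-below (bitOf S₀) (σ · cnt) ≤ 1#
      light-enough = ≤-trans (light (σ · cnt) ℕₚ.≤-refl) (≤-trans (sum-mono below) feasible)
        where
        below : ∀ i → ind ((i ∈? O) ×-dec (home σ i ℕₚ.<? σ · cnt)) (w i) ≤ (if lookup O i then w i else 0#)
        below i with i ∈? O
        ... | yes i∈ rewrite []=⇒lookup i∈ | dec-true (home σ i ℕₚ.<? σ · cnt) (proj₁ (at-home i)) = ≤-refl
        ... | no _ with lookup O i
        ... | true  = 0≤w i
        ... | false = ≤-refl

      o′ : ℝ
      o′ = o + (σ · RR + σ · RR)

      covers-all : ∀ i c → d i c ≤ o → d (pivot i) (pivot c) ≤ o′
      covers-all i c le = ≤-trans (Metric.triangle (pivot i) i (pivot c)) (subst (d (pivot i) i + d i (pivot c) ≤_) regroup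
        (+-mono-≤ (subst (_≤ σ · RR) d-sym (to-pivot i)) (≤-trans (Metric.triangle i c (pivot c)) (+-mono-≤ le (to-pivot c)))))
        where
        regroup : σ · RR + (o + σ · RR) ≡ o + (σ · RR + σ · RR)
        regroup = trans (sym (+-assoc _ o _)) (trans (cong (_+ σ · RR) (+-comm (σ · RR) o)) (+-assoc o _ _))

      optimum-tried : ∃[ k ] ∃[ l ] ∃[ S ] All k l S × Ok S (gap k l) × gap k l ≤ o′
      optimum-tried =
        let X , large , near = reaches
            i , i∈ = large-nonempty X large
            c , _ , le = near i i∈
            -- `o′` itself need not be a distance between pivots. The largest such distance not
            -- above `o′` reaches the same pivots and is among the radii tried.
            (k , l) , (k< , l< , le′) , most = best-of {_≼_ = flip _≤_} ≤-refl (flip ≤-trans) (flip ≤-total)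
              (λ (k , l) → (k ℕₚ.<? σ · cnt) ×-dec ((l ℕₚ.<? σ · cnt) ×-dec (gap k l ≤? o′))) (uncurry gap)
              pairs (∈-pairs (proj₁ (at-home i)) (proj₁ (at-home c))) (proj₁ (at-home i) , proj₁ (at-home c) , covers-all i c le)
            enough = ℕₚ.≤-trans large (subst₂ ℕ._≤_ (tally-lookup X) (sym (covered≡ (bitOf S₀) (gap k l)))
              (tally-mono (λ p e → let c , c∈ , le = near p (lookup⇒[]= p X e) in
                dec-true (hit? (bitOf S₀) (gap k l) p)
                  (⇒hits (bitOf S₀) (gap k l) (pivot p) (σ · cnt) (proj₁ (at-home c)) (home-on c c∈)
                    (most (home σ p , home σ c) (∈-pairs (proj₁ (at-home p)) (proj₁ (at-home c)))
                      (proj₁ (at-home p) , proj₁ (at-home c) , covers-all p c le))))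
                (allFin n)))
        in k , l , S₀ , (k< , l< , proj₁ (proj₂ code)) ,
           (light-enough , subst (λ e → e ℕ.∸ z ℕ.≤ covered (bitOf S₀) (gap k l) (σ · cnt)) (sym nn≡n) enough) , le′
        where
        pairs : List (ℕ × ℕ)
        pairs = cartesianProduct (upTo (σ · cnt)) (upTo (σ · cnt))
        ∈-pairs : ∀ {k l} → k ℕ.< σ · cnt → l ℕ.< σ · cnt → (k , l) ∈ pairs
        ∈-pairs p q = ∈-cartesianProduct⁺ (∈-upTo⁺ p) (∈-upTo⁺ q)

-- The outcome of a single guess.

module Doubles (R : Reals) where
  open Reals R
  open RealLemmas R

  -- The multiple 2 ^ k e as a repeated sum, so that comparisons of radii need only monotonicity and
  -- cancellation of addition.
  doubles : ℕ → ℝ → ℝ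
  doubles zero    e = e
  doubles (suc k) e = doubles k e + doubles k e

  0≤doubles : ∀ k {e} → 0# ≤ e → 0# ≤ doubles k e
  0≤doubles zero    le = le
  0≤doubles (suc k) le = +-nonNegative (0≤doubles k le) (0≤doubles k le)

  0≤half : ∀ {x} → 0# ≤ x → 0# ≤ x / real 2
  0≤half le = *-nonNegative le (0≤⁻¹ (<-≤⇒< 0<1 (1≤real {2} (s≤s z≤n))))

  halved : ∀ k {x} → 0# ≤ x → ∃[ e ] 0# ≤ e × doubles k e ≡ x
  halved zero    {x} le = x , le , refl
  halved (suc k) {x} le =
    let e , 0≤e , eq = halved k (0≤half le) in e , 0≤e , trans (cong₂ _+_ eq eq) (half+half x)

module Outcomes (R : Reals) (I : RKC.Instance R) where
  open Reals R
  open RKC R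
  open RealLemmas R
  open Doubles R
  open Instance I
  open AlgorithmRuns R
  open RunsSpec I hiding (module Metric)
  open Costs R I
  open Coresets R I

  -- Here e is o/64, expressed without division. This is the information gained from a rejected
  -- guess k.
  NoCover : ℕ → ℝ → Set
  NoCover k o = ∀ L e → 0# ≤ e → doubles 6 e ≡ o → Covers L e → k ℕ.< length L

  record Ready (σ : State) : Set where
    field
      rejected : σ · acc ≡ 0
      1≤m      : 1 ℕ.≤ σ · m
      1≤sz     : 1 ℕ.≤ σ · sz
      sz≤m     : σ · sz ℕ.≤ suc (σ · m)
      nn≡n     : σ · nn ≡ n

  -- Quantifies over every `O` with the chosen members, because the output of the final memory will
  -- be known only through its membership.
  Accepted : ℝ → State → Set
  Accepted o τ = σ-cnt ℕ.≤ τ · sz × (∃[ k ] k ℕ.< σ-cnt × 1 ℕ.≤ bitOf (τ · bS) k) ×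
    (∀ O → (∀ i → i ∈ₛ O → Chosen τ (bitOf (τ · bS)) i) → (∀ i → Chosen τ (bitOf (τ · bS)) i → i ∈ₛ O) →
      Feasible I O × Reaches O (o + o + o))
    where
    σ-cnt : ℕ
    σ-cnt = τ · cnt

  Outcome : ℝ → State → State → Set
  Outcome o σ τ =
    (1 ℕ.≤ τ · acc × τ · m ≡ σ · m × Accepted o τ) ⊎ (τ · acc ≡ 0 × τ · m ≡ σ · m ℕ.* σ · gg × NoCover (σ · m) o)

  iterate-extend : ∀ k σ → 1 ℕ.≤ σ · sz → iterate extend k σ · sz ≡ k ℕ.+ σ · sz ×
    (∀ {s} (z : Var s) → same sz z ≡ false → iterate extend k σ · z ≡ σ · z)
  iterate-extend zero    σ pos = refl , λ _ _ → refl
  iterate-extend (suc k) σ pos =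
    let e , rest = iterate-extend k (extend σ) (s≤s z≤n) in
    trans e (ℕₚ.+-suc k (σ · sz)) , λ z ne → trans (rest z ne) (extend-var σ z ne pos)

  module _ (O : Subset n) (feasible : Feasible I O) (o : ℝ) (0≤o : 0# ≤ o) (reaches : Reaches O o)
           (optimal : ∀ O′ u → Feasible I O′ → Reaches O′ u → o ≤ u) where

    record Netted (σ τ : State) : Set where
      constructor netted
      field
        pivots    : Pivots [] (τ · m) τ
        unchanged : Same (x ≔ ! x ⨟ body₁) σ τ

    record Emptied (σ τ : State) : Set where
      constructor emptied
      field
        unchanged : Same reset σ τ
        radius    : τ · RR ≡ σ · ρ + σ · ρ
        fresh     : ∀ k → k ℕ.< σ · cnt → at τ C k ≡ 0 × at τ B k ≡ at σ Pv k

    record Assigned (σ τ : State) : Set where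
      constructor assigned
      field
        clusters  : Clusters τ
        unchanged : Same (x ≔ ! x ⨟ body₂) σ τ

    firstPass : ∀ σ → σ · cnt ≡ 0 → σ · ρ ≡ 0# → 1 ℕ.≤ σ · m → σ · sz ≡ suc (σ · m) →
      Netted σ (scanRun body₁ (allFin n) σ)
    firstPass σ cnt≡0 ρ≡0 1≤m sz≡ = pack (scanW body₁ σ (λ L τ → Pivots L (τ · m) τ) (allFin n)
      (record { cnt≤ = subst (ℕ._≤ σ · m) (sym cnt≡0) z≤n
              ; sep = λ {k} {l} _ lt → contradiction (subst (l ℕ.<_) cnt≡0 lt) λ ()
              ; 0≤ρ = ≤-reflexive (sym ρ≡0) ; low = inj₁ ρ≡0 ; cover = λ p → inj₁ (∈-allFin p) })
      (λ p L τ sm inv → conseq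
        (body₁W τ inv (subst (1 ℕ.≤_) (sym (sm m refl 0)) 1≤m)
          (trans (sm sz refl 0) (trans sz≡ (cong suc (sym (sm m refl 0))))))
        (λ τ′ sm′ piv → subst (λ k → Pivots L k τ′) (sym (sm′ m refl 0)) piv)))
      where
      pack : ∀ {τ} → Pivots [] (τ · m) τ × Same (x ≔ ! x ⨟ body₁) σ τ → Netted σ τ
      pack (piv , sm) = netted piv sm

    emptying : ∀ σ → σ · cnt ℕ.≤ σ · sz → Emptied σ (run reset σ)
    emptying σ cnt≤sz = pack (frame reset σ) (run-wp (resetW σ cnt≤sz))
      where
      pack : ∀ {τ} → Same reset σ τ →
        τ · RR ≡ σ · ρ + σ · ρ × (∀ k → k ℕ.< σ · cnt → at τ C k ≡ 0 × at τ B k ≡ at σ Pv k) → Emptied σ τ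
      pack sm (e , f) = emptied sm e f

    module _ (σ σ₁ : State) (sm₁ : Same reset σ σ₁) (eR : σ₁ · RR ≡ σ · ρ + σ · ρ)
             (fresh : ∀ k → k ℕ.< σ · cnt → at σ₁ C k ≡ 0 × at σ₁ B k ≡ at σ Pv k)
             (cov : ∀ p → Cov σ (σ · ρ + σ · ρ) p) where

      reset-cover : ∀ p → Cov σ₁ (σ₁ · RR) p
      reset-cover p = let k , lt , le = cov p in
        k , subst (k ℕ.<_) (sym (sm₁ cnt refl 0)) lt , subst₂ (λ q r → d p q ≤ r) (sym (sm₁ Pv refl k)) (sym eR) le

      partial-start : Partial σ₁ (allFin n) σ₁
      partial-start = record
        { count = λ k lt → cong (ℕ._+ tally (λ p → does (home σ₁ p ℕₚ.≟ k)) (allFin n)) (proj₁ (fresh k (lt′ lt)))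
        ; rep   = λ k lt → subst (_≤ σ₁ · RR)
                    (sym (Metric.≈⇒0 (trans (proj₂ (fresh k (lt′ lt))) (sym (sm₁ Pv refl k))))) (0≤R (at σ₁ Pv k))
        ; cheap = λ k lt p → inj₁ (∈-allFin p)
        }
        where
        lt′ : ∀ {k} → k ℕ.< σ₁ · cnt → k ℕ.< σ · cnt
        lt′ = subst (_ ℕ.<_) (sm₁ cnt refl 0)
        0≤R : V → 0# ≤ σ₁ · RR
        0≤R p = let _ , _ , le = reset-cover p in ≤-trans Metric.nonNegative le

    partial⇒clusters : ∀ σ τ → Same (x ≔ ! x ⨟ body₂) σ τ → (∀ p → Cov σ (σ · RR) p) → Partial σ [] τ → Clusters τ
    partial⇒clusters σ τ sm cov par = record
      { at-home = λ p → let lt , le = home-near σ p (cov p) in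
          subst₂ ℕ._<_ (sym (home≡ p)) (sym (sm cnt refl 0)) lt ,
          subst₂ (λ q r → d p q ≤ r) (trans (sym (sm Pv refl _)) (cong (at τ Pv) (sym (home≡ p)))) (sym (sm RR refl 0)) le
      ; count   = λ k lt → trans (sym (ℕₚ.+-identityʳ _)) (trans (Partial.count par k (lt′ lt))
          (tally-cong (λ p → cong (λ h → does (h ℕₚ.≟ k)) (sym (home≡ p))) (allFin n)))
      ; rep     = λ k lt → subst₂ (λ q r → d (at τ B k) q ≤ r) (sym (sm Pv refl k)) (sym (sm RR refl 0)) (Partial.rep par k (lt′ lt))
      ; cheap   = λ k lt p le → [ (λ ()) , (λ ok → ok (subst₂ (λ q r → d p q ≤ r) (sm Pv refl k) (sm RR refl 0) le)) ]
                    (Partial.cheap par k (lt′ lt) p)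
      }
      where
      home≡ : ∀ p → home τ p ≡ home σ p
      home≡ p = home-cong σ τ p (sm Pv refl) (sm RR refl 0) (sm cnt refl 0)
      lt′ : ∀ {k} → k ℕ.< τ · cnt → k ℕ.< σ · cnt
      lt′ = subst (_ ℕ.<_) (sm cnt refl 0)

    secondPass : ∀ σ σ₁ → σ · cnt ℕ.≤ σ · sz → (∀ p → Cov σ (σ · ρ + σ · ρ) p) → Emptied σ σ₁ →
      Assigned σ₁ (scanRun body₂ (allFin n) σ₁)
    secondPass σ σ₁ cnt≤sz cov (emptied sm₁ eR fresh) = pack (scanW body₂ σ₁ (Partial σ₁) (allFin n)
        (partial-start σ σ₁ sm₁ eR fresh cov)
        (λ p L τ sm inv → body₂W σ₁ p L τ (subst₂ ℕ._≤_ (sym (sm₁ cnt refl 0)) (sym (sm₁ sz refl 0)) cnt≤sz)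
          (reset-cover σ σ₁ sm₁ eR fresh cov) sm inv))
      where
      pack : ∀ {τ} → Partial σ₁ [] τ × Same (x ≔ ! x ⨟ body₂) σ₁ τ → Assigned σ₁ τ
      pack (par , sm) = assigned (partial⇒clusters σ₁ _ sm (reset-cover σ σ₁ sm₁ eR fresh cov) par) sm

    module _ (σ : State) (cnt≤sz : σ · cnt ℕ.≤ σ · sz) (clusters : Clusters σ) (nn≡n : σ · nn ≡ n) (acc≡0 : σ · acc ≡ 0)
             (small : ∀ L e → 0# ≤ e → Covers L e → length L ℕ.≤ σ · m → σ · RR ≤ doubles 3 e) where
      open Search σ cnt≤sz

      searched : ∀ τ → Same search σ τ → Best All τ → Wp decide (λ τ′ → Outcome o σ τ′ × τ′ · sz ≡ σ · sz × τ′ · nn ≡ σ · nn × τ′ · gg ≡ σ · gg) τ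
      searched τ sm (best-ok , best-least) = whenW
        (λ large → assignW (inj₁ (ℕₚ.≤-refl , sm m refl 0 ,
           subst₂ ℕ._≤_ (sym (sm cnt refl 0)) (sym (sm sz refl 0)) cnt≤sz ,
           someSelected , solution (subst (λ r → (r + r) + (r + r) ≤ τ · bv) (sm RR refl 0) large)) ,
           sm sz refl 0 , sm nn refl 0 , sm gg refl 0))
        (λ ¬large → assignW (inj₂ (trans (sm acc refl 0) acc≡0 , cong₂ ℕ._*_ (sm m refl 0) (sm gg refl 0) ,
           λ L e 0≤e eq cov → ℕₚ.≰⇒> λ le → ¬large (subst (λ r → (r + r) + (r + r) ≤ τ · bv) (sym (sm RR refl 0)) (accept L e 0≤e eq cov le))) ,
           sm sz refl 0 , sm nn refl 0 , sm gg refl 0))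
        where
        r2 : ℝ
        r2 = σ · RR + σ · RR
        tried : ∃[ k ] ∃[ l ] ∃[ S ] All k l S × Ok S (gap k l) × gap k l ≤ o + r2
        tried = optimum-tried σ cnt≤sz clusters nn≡n O feasible reaches
        bestOk : Ok (τ · bS) (τ · bv)
        bestOk = let k , l , S , a , ok , _ = tried in best-ok (proj₁ (best-least k l S a ok))
        bv≤ : τ · bv ≤ o + r2
        bv≤ = let k , l , S , a , ok , le = tried in ≤-trans (proj₂ (best-least k l S a ok)) le
        selected : Subset n
        selected = tabulate (λ i → does (selected? σ cnt≤sz clusters nn≡n (bitOf (τ · bS)) (σ · cnt) i))
        ⇒selected : ∀ i → i ∈ₛ selected → Selected σ cnt≤sz clusters nn≡n (bitOf (τ · bS)) i
        ⇒selected i i∈ = does⇒ (selected? σ cnt≤sz clusters nn≡n (bitOf (τ · bS)) (σ · cnt) i) (∈-tabulate⁻ _ i∈)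
        selected⇒ : ∀ i → Selected σ cnt≤sz clusters nn≡n (bitOf (τ · bS)) i → i ∈ₛ selected
        selected⇒ i s = ∈-tabulate⁺ _ (dec-true (selected? σ cnt≤sz clusters nn≡n (bitOf (τ · bS)) (σ · cnt) i) s)
        feas : Feasible I selected
        feas = ok⇒feasible σ cnt≤sz clusters nn≡n bestOk selected ⇒selected selected⇒
        reach : Reaches selected (τ · bv + r2)
        reach = ok⇒reaches σ cnt≤sz clusters nn≡n bestOk selected ⇒selected selected⇒
        someSelected : ∃[ k ] k ℕ.< τ · cnt × 1 ℕ.≤ bitOf (τ · bS) k
        someSelected =
          let X , large , near = reach
              i , i∈ = large-nonempty X large
              c , c∈ , _ = near i i∈
              k , lt , on , _ = ⇒selected c c∈
          in k , subst (k ℕ.<_) (sym (sm cnt refl 0)) lt , on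
        solution : r2 + r2 ≤ τ · bv → ∀ O′ → (∀ i → i ∈ₛ O′ → Chosen τ (bitOf (τ · bS)) i) →
          (∀ i → Chosen τ (bitOf (τ · bS)) i → i ∈ₛ O′) → Feasible I O′ × Reaches O′ (o + o + o)
        solution large O′ O′⇒ ⇒O′ =
          ok⇒feasible σ cnt≤sz clusters nn≡n bestOk O′ to from ,
          (let X , big , near = ok⇒reaches σ cnt≤sz clusters nn≡n bestOk O′ to from in
           X , big , λ i i∈ → let c , c∈ , le = near i i∈ in c , c∈ , ≤-trans le cost≤)
          where
          to : ∀ i → i ∈ₛ O′ → Selected σ cnt≤sz clusters nn≡n (bitOf (τ · bS)) i
          to i i∈ = let k , lt , on , e = O′⇒ i i∈ in k , subst (k ℕ.<_) (sm cnt refl 0) lt , on , trans e (sm B refl k)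
          from : ∀ i → Selected σ cnt≤sz clusters nn≡n (bitOf (τ · bS)) i → i ∈ₛ O′
          from i (k , lt , on , e) = ⇒O′ i (k , subst (k ℕ.<_) (sym (sm cnt refl 0)) lt , on , trans e (sym (sm B refl k)))
          r2≤o : r2 ≤ o
          r2≤o = +-cancelʳ-≤ r2 (≤-trans large bv≤)
          cost≤ : τ · bv + r2 ≤ o + o + o
          cost≤ = +-mono-≤ (≤-trans bv≤ (+-monoʳ-≤ o r2≤o)) r2≤o
        -- With `RR` ≤ 8e, optimality gives 64e = o ≤ bv + 2 `RR` ≤ bv + 32e. Hence 32e ≤ bv, and 4
        -- `RR` is at most 32e.
        accept : ∀ L e → 0# ≤ e → doubles 6 e ≡ o → Covers L e → length L ℕ.≤ σ · m → r2 + r2 ≤ τ · bv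
        accept L e 0≤e eq cov le = ≤-trans (+-mono-≤ r2≤ r2≤) (+-cancelʳ-≤ (doubles 5 e) (≤-trans (≤-reflexive eq)
            (≤-trans (optimal selected (τ · bv + r2) feas reach)
              (+-monoʳ-≤ (τ · bv) (≤-trans r2≤ (x≤x+y (0≤doubles 4 0≤e)))))))
          where
          r2≤ : r2 ≤ doubles 4 e
          r2≤ = +-mono-≤ (small L e 0≤e cov le) (small L e 0≤e cov le)

    record Decided (σ τ : State) : Set where
      constructor decided
      field
        outcome : Outcome o σ τ
        sz≡     : τ · sz ≡ σ · sz
        nn≡     : τ · nn ≡ σ · nn
        gg≡     : τ · gg ≡ σ · gg

    Small : State → Set
    Small σ = ∀ L e → 0# ≤ e → Covers L e → length L ℕ.≤ σ · m → σ · RR ≤ doubles 3 e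

    deciding : ∀ σ → σ · cnt ℕ.≤ σ · sz → Clusters σ → σ · nn ≡ n → σ · acc ≡ 0 → Small σ →
      Decided σ (run (search ⨟ decide) σ)
    deciding σ cnt≤sz clusters nn≡n acc≡0 small = pack (run-wp (seqW {c = search} {c′ = decide}
        (conseq {c = search} (Search.searchW σ cnt≤sz) (λ τ sm best → searched σ cnt≤sz clusters nn≡n acc≡0 small τ sm best))))
      where
      pack : ∀ {τ} → Outcome o σ τ × τ · sz ≡ σ · sz × τ · nn ≡ σ · nn × τ · gg ≡ σ · gg → Decided σ τ
      pack (a , b , c , e) = decided a b c e

    record Cleared (σ τ : State) : Set where
      constructor cleared
      field
        cnt≡0 : τ · cnt ≡ 0
        ρ≡0   : τ · ρ ≡ 0#
        nn≡   : τ · nn ≡ σ · nn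
        gg≡   : τ · gg ≡ σ · gg
        m≡    : τ · m ≡ σ · m
        acc≡  : τ · acc ≡ σ · acc
        sz≡   : τ · sz ≡ suc (σ · m)

    clearing : ∀ σ → Ready σ → Cleared σ (run clear (growRun σ))
    clearing σ ready with iterate-extend (suc (σ · m) ℕ.∸ σ · sz) σ (Ready.1≤sz ready)
    ... | e , rest = cleared refl refl (rest nn refl) (rest gg refl) (rest m refl) (rest acc refl)
      (trans e (ℕₚ.m∸n+n≡m (Ready.sz≤m ready)))

    record Result (σ τ : State) : Set where
      constructor result
      field
        outcome : Outcome o σ τ
        sz≡     : τ · sz ≡ suc (σ · m)
        nn≡n    : τ · nn ≡ n
        gg≡     : τ · gg ≡ σ · gg

    -- The five phases enter through their specifications alone; the programs remain variables, so
    -- none of them is unfolded here.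
    compose : ∀ {c₁ b₁ c₂ b₂ c₃} →
      (∀ σ → Ready σ → Cleared σ (run c₁ (growRun σ))) →
      (∀ σ → σ · cnt ≡ 0 → σ · ρ ≡ 0# → 1 ℕ.≤ σ · m → σ · sz ≡ suc (σ · m) → Netted σ (scanRun b₁ (allFin n) σ)) →
      (∀ σ → σ · cnt ℕ.≤ σ · sz → Emptied σ (run c₂ σ)) →
      (∀ σ σ₁ → σ · cnt ℕ.≤ σ · sz → (∀ p → Cov σ (σ · ρ + σ · ρ) p) → Emptied σ σ₁ → Assigned σ₁ (scanRun b₂ (allFin n) σ₁)) →
      (∀ σ → σ · cnt ℕ.≤ σ · sz → Clusters σ → σ · nn ≡ n → σ · acc ≡ 0 → Small σ → Decided σ (run c₃ σ)) →
      ∀ σ → Ready σ → Result σ (iterRunOf c₁ b₁ c₂ b₂ c₃ σ)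
    compose {c₁} {b₁} {c₂} {b₂} {c₃} clears nets empties assigns decides σ ready =
      result
        ([ (λ (a , b , c) → inj₁ (a , trans b m₅ , c))
         , (λ (a , b , c) → inj₂ (a , trans b (cong₂ ℕ._*_ m₅ gg₅) , subst (λ k → NoCover k o) m₅ c)) ] (Decided.outcome D₆))
        (trans (Decided.sz≡ D₆) sz₅) (trans (Decided.nn≡ D₆) nn₅) (trans (Decided.gg≡ D₆) gg₅)
      where
      open Ready ready
      σ₂ σ₃ σ₄ σ₅ : State
      σ₂ = run c₁ (growRun σ)
      σ₃ = scanRun b₁ (allFin n) σ₂
      σ₄ = run c₂ σ₃
      σ₅ = scanRun b₂ (allFin n) σ₄
      D₂ : Cleared σ σ₂
      D₂ = clears σ ready
      module D₂ = Cleared D₂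
      D₃ : Netted σ₂ σ₃
      D₃ = nets σ₂ D₂.cnt≡0 D₂.ρ≡0 (subst (1 ℕ.≤_) (sym D₂.m≡) 1≤m) (trans D₂.sz≡ (cong suc (sym D₂.m≡)))
      sm₃ : Same (x ≔ ! x ⨟ body₁) σ₂ σ₃
      sm₃ = Netted.unchanged D₃
      open Pivots (Netted.pivots D₃)
      m₃ : σ₃ · m ≡ σ · m
      m₃ = trans (sm₃ m refl 0) D₂.m≡
      sz₃ : σ₃ · sz ≡ suc (σ · m)
      sz₃ = trans (sm₃ sz refl 0) D₂.sz≡
      cnt≤sz₃ : σ₃ · cnt ℕ.≤ σ₃ · sz
      cnt≤sz₃ = subst (σ₃ · cnt ℕ.≤_) (trans (cong suc m₃) (sym sz₃)) (ℕₚ.m≤n⇒m≤1+n cnt≤)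
      D₄ : Emptied σ₃ σ₄
      D₄ = empties σ₃ cnt≤sz₃
      covered-all : ∀ p → Cov σ₃ (σ₃ · ρ + σ₃ · ρ) p
      covered-all p with cover p
      ... | inj₂ cv = cv
      D₅ : Assigned σ₄ σ₅
      D₅ = assigns σ₃ σ₄ cnt≤sz₃ covered-all D₄
      sm₅ : ∀ {s} (v : Var s) → touches (x ≔ ! x ⨟ body₂) v ≡ false → touches reset v ≡ false → σ₅ · v ≡ σ₃ · v
      sm₅ v v∉ v∉′ = trans (Assigned.unchanged D₅ v v∉ 0) (Emptied.unchanged D₄ v v∉′ 0)
      cnt≤sz₅ : σ₅ · cnt ℕ.≤ σ₅ · sz
      cnt≤sz₅ = subst₂ ℕ._≤_ (sym (sm₅ cnt refl refl)) (sym (sm₅ sz refl refl)) cnt≤sz₃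
      sz₅ : σ₅ · sz ≡ suc (σ · m)
      sz₅ = trans (sm₅ sz refl refl) sz₃
      nn₅ : σ₅ · nn ≡ n
      nn₅ = trans (sm₅ nn refl refl) (trans (sm₃ nn refl 0) (trans D₂.nn≡ nn≡n))
      acc₅ : σ₅ · acc ≡ 0
      acc₅ = trans (sm₅ acc refl refl) (trans (sm₃ acc refl 0) (trans D₂.acc≡ rejected))
      m₅ : σ₅ · m ≡ σ · m
      m₅ = trans (sm₅ m refl refl) m₃
      gg₅ : σ₅ · gg ≡ σ · gg
      gg₅ = trans (sm₅ gg refl refl) (trans (sm₃ gg refl 0) D₂.gg≡)
      RR₅ : σ₅ · RR ≡ σ₃ · ρ + σ₃ · ρ
      RR₅ = trans (Assigned.unchanged D₅ RR refl 0) (Emptied.radius D₄)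
      small : Small σ₅
      small L e 0≤e cov le = subst (_≤ doubles 3 e) (sym RR₅) (+-mono-≤ ρ≤ ρ≤)
        where
        ρ≤ : σ₃ · ρ ≤ doubles 2 e
        -- Either ρ is still 0, or it is 2 `dl` for m + 1 points at least `dl` apart. Two of these
        -- lie within 2e of each other, so that ρ is at most 4e.
        ρ≤ with low
        ... | inj₁ eq = subst (_≤ doubles 2 e) (sym eq) (0≤doubles 2 0≤e)
        ... | inj₂ (dl , eq , g , far) with covers⇒close g cov (subst (length L ℕ.≤_) (trans m₅ (sym m₃)) le)
        ... | l , l′ , l<l′ , l′< , near = subst (_≤ doubles 2 e) (sym eq) (+-mono-≤ dl≤ dl≤)
          where
          dl≤ : dl ≤ e + e
          dl≤ = ≤-trans (far l l′ l<l′ l′<) near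
      D₆ : Decided σ₅ (run c₃ σ₅)
      D₆ = decides σ₅ cnt≤sz₅ (Assigned.clusters D₅) nn₅ acc₅ small

    iter-outcome : ∀ σ → Ready σ → Result σ (iterRun σ)
    iter-outcome = compose {clear} {body₁} {reset} {body₂} {search ⨟ decide} clearing firstPass emptying secondPass deciding

-- The sequence of guesses, and the output of the final memory.

module Rounds (R : Reals) (I : RKC.Instance R) where
  open Reals R
  open RKC R
  open Streaming R
  open RealLemmas R
  open Doubles R
  open Instance I
  open AlgorithmRuns R
  open RunsSpec I hiding (module Metric)
  open Costs R I
  open Outcomes R I

  halve-covers* : ∀ D → Doubling I D → ∀ k {L e} → 0# ≤ e → Covers L (doubles k e) →
    ∃[ L′ ] real (length L′) ≤ real (length L) * exp₂ (real k * D) × Covers L′ e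
  halve-covers* D dbl zero {L} 0≤e cov = L , ≤-reflexive (sym
    (trans (cong (real (length L) *_) (trans (cong exp₂ (zeroˡ D)) exp₂-0)) (*-identityʳ _))) , cov
  halve-covers* D dbl (suc k) {L} {e} 0≤e cov =
    let L₁ , le₁ , cov₁ = halve-covers D dbl (0≤doubles k 0≤e) cov
        L₂ , le₂ , cov₂ = halve-covers* D dbl k 0≤e cov₁
    in L₂ , ≤-trans le₂ (subst (real (length L₁) * exp₂ (real k * D) ≤_) regroup
         (*-monoˡ-≤ (proj₁ (exp₂>0 _)) le₁)) , cov₂
    where
    regroup : real (length L) * exp₂ D * exp₂ (real k * D) ≡ real (length L) * exp₂ (real (suc k) * D)
    regroup = trans (*-assoc _ _ _) (cong (real (length L) *_) (trans (sym (exp₂-+ D (real k * D)))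
      (cong exp₂ (sym (trans (distribʳ D 1# (real k)) (cong (_+ real k * D) (*-identityˡ D)))))))

  noCover⇒<n : ∀ {k o} → 0# ≤ o → NoCover k o → k ℕ.< n
  noCover⇒<n 0≤o none =
    let e , 0≤e , eq = halved 6 0≤o in
    subst (_ ℕ.<_) (length-tabulate id)
      (none (allFin n) e 0≤e eq (λ i → i , ∈-allFin i , subst (_≤ e) (sym (Metric.≈⇒0 refl)) 0≤e))

  -- Six halvings of the radius multiply the number of balls by 64 ^ D, and
  -- 64 ≤ 2 · 14 · 3 ≤ c / ε.
  noCover⇒≤ : ∀ {k o} S D → 0# ≤ o → Reaches S o → Doubling I D → NoCover k o →
    real k ≤ real (∣ S ∣ ℕ.+ z) * exp₂ (real 6 * D)
  noCover⇒≤ {k} {o} S D 0≤o reaches dbl none =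
    let e , 0≤e , eq = halved 6 0≤o
        L , len , cov = reaches⇒covers S o 0≤o reaches
        L′ , len′ , cov′ = halve-covers* D dbl 6 {L} 0≤e (subst (Covers L) (sym eq) cov)
    in ≤-trans (real-mono (ℕₚ.<⇒≤ (none L′ e 0≤e eq cov′)))
         (≤-trans len′ (*-monoˡ-≤ (proj₁ (exp₂>0 _)) (real-mono len)))

  module _ (O : Subset n) (feasible : Feasible I O) (o : ℝ) (0≤o : 0# ≤ o) (reaches : Reaches O o)
           (optimal : ∀ O′ u → Feasible I O′ → Reaches O′ u → o ≤ u)
           (f : State → State) (f-result : ∀ σ → Ready σ → Result O feasible o 0≤o reaches optimal σ (f σ)) where

    -- `its` speaks of the memory for the accepted guess, a size known only when the run is
    -- complete. `before` keeps the last rejected guess, from which all bounds follow.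
    record Run_from_ (j : ℕ) (σ : State) : Set where
      field
        final    : State
        m≡       : final · m ≡ σ · m ℕ.* σ · gg ℕ.^ j
        its      : Iterates f (suc (final · m) ℕ.* W) (suc j) σ final
        accepted : Accepted o final
        sz≡      : final · sz ≡ suc (final · m)
        before   : j ≡ 0 ⊎ (∃[ j′ ] j ≡ suc j′ × NoCover (σ · m ℕ.* σ · gg ℕ.^ j′) o)

    -- When the fuel is spent the guess is at least n, and `noCover⇒<n` excludes its rejection.
    rounds : ∀ fuel σ → Ready σ → 1 ℕ.≤ σ · gg → n ℕ.≤ σ · m ℕ.* σ · gg ℕ.^ fuel → ∃[ j ] Run j from σ
    rounds fuel σ ready 1≤g enough = go fuel enough (f σ) refl (f-result σ ready)
      where
      open Ready ready
      go : ∀ fuel → n ℕ.≤ σ · m ℕ.* σ · gg ℕ.^ fuel → ∀ τ → τ ≡ f σ → Result O feasible o 0≤o reaches optimal σ τ → ∃[ j ] Run j from σ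
      go _ _ τ τ≡ (result (inj₁ (1≤acc , m≡ , acc)) sz≡ nn≡ gg≡) = 0 , record
        { final    = τ
        ; m≡       = trans m≡ (sym (ℕₚ.*-identityʳ _))
        ; its      = more rejected sz≤m (ℕₚ.≤-reflexive (cong (λ k → suc k ℕ.* W) (sym m≡)))
                       (subst (λ υ → Iterates f _ 0 υ τ) τ≡ (done 1≤acc))
        ; accepted = acc
        ; sz≡      = trans sz≡ (cong suc (sym m≡))
        ; before   = inj₁ refl
        }
      go zero enough τ τ≡ (result (inj₂ (_ , _ , none)) _ _ _) =
        contradiction (subst (n ℕ.≤_) (ℕₚ.*-identityʳ _) enough) (ℕₚ.<⇒≱ (noCover⇒<n 0≤o none))
      go (suc fuel) enough τ τ≡ (result (inj₂ (acc≡0 , m≡ , none)) sz≡ nn≡ gg≡) = extend′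
        (rounds fuel τ
          (record { rejected = acc≡0
                  ; 1≤m  = subst (1 ℕ.≤_) (sym m≡) (ℕₚ.*-mono-≤ 1≤m 1≤g)
                  ; 1≤sz = subst (1 ℕ.≤_) (sym sz≡) (s≤s z≤n)
                  ; sz≤m = subst₂ ℕ._≤_ (sym sz≡) (cong suc (sym m≡)) (s≤s m≤mg)
                  ; nn≡n = nn≡ })
          (subst (1 ℕ.≤_) (sym gg≡) 1≤g)
          (subst (n ℕ.≤_) (shift fuel) enough))
        where
        m≤mg : σ · m ℕ.≤ σ · m ℕ.* σ · gg
        m≤mg = subst (ℕ._≤ σ · m ℕ.* σ · gg) (ℕₚ.*-identityʳ _) (ℕₚ.*-monoʳ-≤ (σ · m) 1≤g)
        shift : ∀ k → σ · m ℕ.* σ · gg ℕ.^ suc k ≡ τ · m ℕ.* τ · gg ℕ.^ k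
        shift k = trans (sym (ℕₚ.*-assoc (σ · m) (σ · gg) _)) (sym (cong₂ (λ a b → a ℕ.* b ℕ.^ k) m≡ gg≡))
        extend′ : (∃[ j ] Run j from τ) → ∃[ j ] Run j from σ
        extend′ (j , r) = suc j , record
          { final    = final
          ; m≡       = trans r-m≡ (sym (shift j))
          ; its      = more rejected sz≤m
                         (ℕₚ.*-monoˡ-≤ W (s≤s (ℕₚ.≤-trans m≤mg (ℕₚ.≤-trans (ℕₚ.≤-reflexive (sym m≡)) τm≤))))
                         (subst (λ υ → Iterates f _ (suc j) υ final) τ≡ its)
          ; accepted = accepted
          ; sz≡      = r-sz≡
          ; before   = inj₂ (j , refl , last before)
          }
          where
          open Run_from_ r renaming (m≡ to r-m≡; sz≡ to r-sz≡)
          τm≤ : τ · m ℕ.≤ final · m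
          τm≤ = subst₂ ℕ._≤_ (ℕₚ.*-identityʳ _) (sym r-m≡)
            (ℕₚ.*-monoʳ-≤ (τ · m) (ℕₚ.m^n>0 (τ · gg) {{ℕ.>-nonZero (subst (1 ℕ.≤_) (sym gg≡) 1≤g)}} j))
          last : j ≡ 0 ⊎ (∃[ j′ ] j ≡ suc j′ × NoCover (τ · m ℕ.* τ · gg ℕ.^ j′) o) → NoCover (σ · m ℕ.* σ · gg ℕ.^ j) o
          last (inj₁ refl) = subst (λ k → NoCover k o) (sym (ℕₚ.*-identityʳ _)) none
          last (inj₂ (j′ , refl , none′)) = subst (λ k → NoCover k o) (sym (shift j′)) none′

  class-surjective : ∀ {r} → r ℕ.< W → ∃[ s ] Σ (Var s) λ x → class x ≡ r
  class-surjective {r} r<W with r ℕₚ.<? 32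
  ... | yes r<32 = nat , N (fromℕ< r<32) , toℕ-fromℕ< r<32
  ... | no r≥32 with r ℕₚ.<? 38
  ... | yes r<38 = num , Q (fromℕ< lt) , trans (cong (32 ℕ.+_) (toℕ-fromℕ< lt)) (ℕₚ.m+[n∸m]≡n (ℕₚ.≮⇒≥ r≥32))
    where
    lt : r ℕ.∸ 32 ℕ.< 6
    lt = ℕₚ.∸-monoˡ-< r<38 (ℕₚ.≮⇒≥ r≥32)
  ... | no r≥38 = point , P (fromℕ< lt) , trans (cong (38 ℕ.+_) (toℕ-fromℕ< lt)) (ℕₚ.m+[n∸m]≡n (ℕₚ.≮⇒≥ r≥38))
    where
    lt : r ℕ.∸ 38 ℕ.< 5
    lt = ℕₚ.∸-monoˡ-< r<W (ℕₚ.≮⇒≥ r≥38)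

  module _ {M : ℕ} where
    open Semantics I M
    open Sound M

    -- `output` folds an anonymous pattern-matching function; it is represented here by any `g` that
    -- satisfies the same equations.
    module _ (g : Word → Subset n → Subset n) (g-point : ∀ i S → g (point , i) S ≡ ⁅ i ⁆ ∪ S)
             (g-nat : ∀ k S → g (nat , k) S ≡ S) (g-num : ∀ r S → g (num , r) S ≡ S) where

      ∈-fold⁻ : ∀ {k} (v : Vec Word k) {i} → i ∈ₛ foldr′ g ⊥ₛ v → ∃[ j ] lookup v j ≡ (point , i)
      ∈-fold⁻ [] i∈ = contradiction i∈ ∉⊥
      ∈-fold⁻ ((point , i′) ∷ v) {i} i∈ with x∈p∪q⁻ ⁅ i′ ⁆ _ (subst (i ∈ₛ_) (g-point i′ _) i∈)
      ... | inj₁ i∈⁅i′⁆ = Fin.zero , cong (point ,_) (sym (x∈⁅y⁆⇒x≡y i′ i∈⁅i′⁆))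
      ... | inj₂ i∈v = let j , eq = ∈-fold⁻ v i∈v in Fin.suc j , eq
      ∈-fold⁻ ((nat , k) ∷ v) i∈ = let j , eq = ∈-fold⁻ v (subst (_ ∈ₛ_) (g-nat k _) i∈) in Fin.suc j , eq
      ∈-fold⁻ ((num , r) ∷ v) i∈ = let j , eq = ∈-fold⁻ v (subst (_ ∈ₛ_) (g-num r _) i∈) in Fin.suc j , eq

      ∈-fold⁺ : ∀ {k} (v : Vec Word k) {i} j → lookup v j ≡ (point , i) → i ∈ₛ foldr′ g ⊥ₛ v
      ∈-fold⁺ ((point , i) ∷ v) Fin.zero refl = subst (i ∈ₛ_) (sym (g-point i _)) (x∈p∪q⁺ (inj₁ (x∈⁅x⁆ i)))
      ∈-fold⁺ ((point , i′) ∷ v) {i} (Fin.suc j) eq = subst (i ∈ₛ_) (sym (g-point i′ _)) (x∈p∪q⁺ (inj₂ (∈-fold⁺ v j eq)))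
      ∈-fold⁺ ((nat , k) ∷ v) (Fin.suc j) eq = subst (_ ∈ₛ_) (sym (g-nat k _)) (∈-fold⁺ v j eq)
      ∈-fold⁺ ((num , r) ∷ v) (Fin.suc j) eq = subst (_ ∈ₛ_) (sym (g-num r _)) (∈-fold⁺ v j eq)

    read-lookup : ∀ μ j → read μ (toℕ j) ≡ just (lookup μ j)
    read-lookup μ j = trans (read-< μ (toℕ<n j)) (cong (just ∘ lookup μ) (fromℕ<-toℕ j (toℕ<n j)))

    module _ {μ : Memory} {s : ℕ} {τ : State} (rep : RepBelow s μ τ) (full : M ≡ s ℕ.* W) where

      -- Since memory is exactly filled, every address is a cell of the table: its residue modulo
      -- `W` gives the column and its quotient the row.
      ∈-output⁻ : ∀ {i} → i ∈ₛ output μ → Σ (Var point) λ x → ∃[ t ] t ℕ.< s × at τ x t ≡ i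
      ∈-output⁻ {i} i∈ with ∈-fold⁻ _ (λ _ _ → refl) (λ _ _ → refl) (λ _ _ → refl) μ i∈
      ... | j , eq with class-surjective (m%n<n (toℕ j) W)
      ... | s′ , x , cls = cellOf x (trans (sym (rep x t₀ t₀<s))
              (trans (cong (read μ) (trans (cong (ℕ._+ t₀ ℕ.* W) cls) (sym (m≡m%n+[m/n]*n (toℕ j) W)))) (trans (read-lookup μ j) (cong just eq))))
        where
        t₀ : ℕ
        t₀ = toℕ j ℕ./ W
        t₀<s : t₀ ℕ.< s
        t₀<s = m<n*o⇒m/o<n (subst (toℕ j ℕ.<_) full (toℕ<n j))
        cellOf : ∀ {s′} (x : Var s′) → just (s′ , conv s′ (at τ x t₀)) ≡ just (point , i) → Σ (Var point) λ x → ∃[ t ] t ℕ.< s × at τ x t ≡ i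
        cellOf (P x) refl = P x , t₀ , t₀<s , refl

      ∈-output⁺ : ∀ (x : Var point) {t} → t ℕ.< s → at τ x t ∈ₛ output μ
      ∈-output⁺ x {t} lt = ∈-fold⁺ _ (λ _ _ → refl) (λ _ _ → refl) (λ _ _ → refl) μ (fromℕ< a<M)
        (just-injective (trans (sym (read-< μ a<M)) (rep x t lt)))
        where
        a<M : addr x t ℕ.< M
        a<M = addr<M x {t} {s} lt (ℕₚ.≤-reflexive (sym full))

n≤2^n : ∀ n → n ℕ.≤ 2 ℕ.^ n
n≤2^n zero = z≤n
n≤2^n (suc n) = subst (suc n ℕ.≤_) (cong (2 ℕ.^ n ℕ.+_) (sym (ℕₚ.+-identityʳ (2 ℕ.^ n))))
  (ℕₚ.+-mono-≤ (ℕₚ.m^n>0 2 n) (n≤2^n n))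

-- From the run of the program to an approximate solution.

module Solving (R : Reals) (I : RKC.Instance R) where
  open Reals R
  open RKC R
  open Streaming R
  open RealLemmas R
  open Instance I
  open AlgorithmRuns R
  open RunsSpec I hiding (module Metric)
  open Costs R I
  open Outcomes R I
  open Rounds R I

  -- The bound by n limits the rounds in part (ii). The bound by the number of balls limits the
  -- rounds in part (i) and the memory in both parts.
  Before : ℕ → ℕ → ℕ → Set
  Before k g j = j ≡ 0 ⊎ (∃[ j′ ] j ≡ suc j′ × g ℕ.^ j′ ℕ.< n ×
    (∀ D → Doubling I D → real (g ℕ.^ j′) ≤ real (k ℕ.+ z) * exp₂ (real 6 * D)))

  Solution : Program → ℝ → ℕ → ℕ → Set
  Solution prog α M p = let open Semantics I M in ∃[ μ ] Exec tt prog initial p μ × Approximate I α (output μ)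

  firstState-nn : ∀ k σ → iterate (run (nn ≔ ! nn ⊕ # 1)) k σ · nn ≡ k ℕ.+ σ · nn
  firstState-nn zero    σ = refl
  firstState-nn (suc k) σ = trans (firstState-nn k (run (nn ≔ ! nn ⊕ # 1) σ))
    (trans (cong (k ℕ.+_) (ℕₚ.+-comm (σ · nn) 1)) (ℕₚ.+-suc k (σ · nn)))

  module _ {M : ℕ} where
    open Semantics I M
    open Sound M

    wiped⇒approximates : ∀ {μ τ τ′ s α o} → Rep μ τ′ → τ′ · sz ≡ s → M ≡ s ℕ.* W → τ · sz ≡ s →
      Wiped τ (bitOf (τ · bS)) (τ · sz) τ′ → Accepted o τ → OptimalCost I o → o + o + o ≤ α * o →
      Approximate I α (output μ)
    wiped⇒approximates {μ} {τ} {τ′} rep refl full sz≡ (chosen , kept) (cnt≤sz , _ , solution) opt 3o≤ =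
      let feasible , reaches = solution (output μ) to from
          v , cost , v≤ = reaches⇒cost (output μ) _ reaches
      in feasible , v , _ , cost , opt , ≤-trans v≤ 3o≤
      where
      to : ∀ i → i ∈ₛ output μ → Chosen τ (bitOf (τ · bS)) i
      to i i∈ with ∈-output⁻ {M} {μ} {τ′ · sz} {τ′} rep full i∈
      ... | z , t , t< , refl = chosen z t (subst (t ℕ.<_) (sym sz≡) t<)
      from : ∀ i → Chosen τ (bitOf (τ · bS)) i → i ∈ₛ output μ
      from i (k , k< , on , refl) = subst (_∈ₛ output μ) (kept k k< on)
        (∈-output⁺ {M} {μ} {τ′ · sz} {τ′} rep full B (subst (k ℕ.<_) sz≡ (ℕₚ.<-≤-trans k< cnt≤sz)))

  Wipes : HCmd → Set
  Wipes c = ∀ σ → σ · cnt ℕ.≤ σ · sz → (∃[ k ] k ℕ.< σ · cnt × 1 ℕ.≤ bitOf (σ · bS) k) →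
    Wiped σ (bitOf (σ · bS)) (σ · sz) (run c σ)

  finish : ∀ c₀ iter c₁ f → (∀ M → LoopExecution.IterationSound M iter f) → wf c₀ ≡ true → wf c₁ ≡ true → Wipes c₁ →
    ∀ {p L} → allFin n ≡ p ∷ L → ∀ {j o final M} → OptimalCost I o → M ≡ suc (final · m) ℕ.* W →
    Iterates f M (suc j) (run c₀ (firstState p (suc (length L)))) final →
    Accepted o final → final · sz ≡ suc (final · m) →
    ∀ {α} → o + o + o ≤ α * o → Solution (mainOf c₀ iter c₁) α M (suc (suc j ℕ.* 2 ℕ.+ 0))
  finish c₀ iter c₁ f is ok₀ ok₁ wipes {p} {L} eq {j} {o} {final} {M} opt M≡ its accepted sz≡ {α} 3o≤ =
    conclude (run c₁ final) (wipes final (proj₁ accepted) (proj₁ (proj₂ accepted)))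
      (LoopExecution.main-sound M c₀ iter c₁ f (is M) ok₀ ok₁ {p} {L} {suc j} {final} eq
        (subst (1 ℕ.* W ℕ.≤_) (sym M≡) (ℕₚ.*-monoˡ-≤ W {1} {suc (final · m)} (s≤s z≤n))) its)
    where
    conclude : ∀ τ → Wiped final (bitOf (final · bS)) (final · sz) τ → ∀ {prog k} →
      ∃[ s ] LoopExecution.CRuns M tt prog (Semantics.initial I M) k s τ × s ≡ final · sz → Solution prog α M k
    conclude τ wiping (s , (μ , ex , LoopExecution.config rep size) , s≡) =
      μ , ex , wiped⇒approximates {M} {μ} {final} {τ} {s} rep size
        (trans M≡ (cong (ℕ._* W) (trans (sym sz≡) (sym s≡)))) (sym s≡) wiping accepted opt 3o≤

  is : ∀ M → LoopExecution.IterationSound M iteration iterRun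
  is M = LoopExecution.iteration-sound M clear body₁ reset body₂ (search ⨟ decide) refl refl refl refl refl

  cleanupW′ : Wipes cleanup
  cleanupW′ σ le some = run-wp (cleanupW σ le some)

  -- The two parts of the theorem differ just in the command `G` that sets the multiplier and in the
  -- property `Good` that it guarantees.
  module _ (G : HCmd) (Good : ℕ → Set) (Good⇒2≤ : ∀ {g} → Good g → 2 ℕ.≤ g)
           (wf-setup : wf (setup G) ≡ true) (m∉ : touches G m ≡ false) (acc∉ : touches G acc ≡ false)
           (nn∉ : touches G nn ≡ false) (sz∉ : touches G sz ≡ false)
           (good : ∀ σ → σ · nn ≡ n → Good (run G σ · gg)) where

    ready : ∀ σ → σ · nn ≡ n → σ · sz ≡ 1 → let σ₀ = run (setup G) σ in Ready σ₀ × Good (σ₀ · gg) × σ₀ · m ≡ 1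
    ready σ nn≡ sz≡ =
      record { rejected = frame G σ₁ acc acc∉ 0
             ; 1≤m  = ℕₚ.≤-reflexive (sym (frame G σ₁ m m∉ 0))
             ; 1≤sz = ℕₚ.≤-reflexive (sym (trans (frame G σ₁ sz sz∉ 0) sz≡))
             ; sz≤m = subst₂ ℕ._≤_ (sym (trans (frame G σ₁ sz sz∉ 0) sz≡)) (cong suc (sym (frame G σ₁ m m∉ 0))) (s≤s z≤n)
             ; nn≡n = trans (frame G σ₁ nn nn∉ 0) nn≡ } ,
      good σ₁ nn≡ , frame G σ₁ m m∉ 0
      where
      σ₁ : State
      σ₁ = upd acc 0 0 (upd m 0 1 σ)

    module _ (O : Subset n) (feasible : Feasible I O) (o : ℝ) (cost : Cost I O o) (opt : OptimalCost I o) where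

      reaches : Reaches O o
      reaches = cost⇒reaches O o cost

      0≤o : 0# ≤ o
      0≤o = let X , large , near = reaches
                i , i∈ = large-nonempty X large
                _ , _ , le = near i i∈ in ≤-trans Metric.nonNegative le

      optimal : ∀ O′ u → Feasible I O′ → Reaches O′ u → o ≤ u
      optimal O′ u feas r = let v , c , le = reaches⇒cost O′ u r in ≤-trans (proj₂ opt v (O′ , feas , c)) le

      Attempt : ℕ → Set
      Attempt k = ∃[ g ] ∃[ j ] Good g × Before k g j ×
        (∀ α → o + o + o ≤ α * o → ∃[ M ] M ≡ suc (g ℕ.^ j) ℕ.* W × Solution (main G) α M (suc (suc j ℕ.* 2 ℕ.+ 0)))

      RunFrom : ℕ → State → Set
      RunFrom j σ₀ = Run_from_ O feasible o 0≤o reaches optimal iterRun (iter-outcome O feasible o 0≤o reaches optimal) j σ₀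

      module _ {p L} (eq : allFin n ≡ p ∷ L) (σ₀ : State) (σ₀≡ : σ₀ ≡ run (setup G) (firstState p (suc (length L))))
               (gd : Good (σ₀ · gg)) (m≡1 : σ₀ · m ≡ 1) where

        run⇒attempt : ∀ {j} → RunFrom j σ₀ → Attempt ∣ O ∣
        run⇒attempt {j} r = σ₀ · gg , j , gd , bound before , solution
          where
          open Run_from_ r
          bound : j ≡ 0 ⊎ (∃[ j′ ] j ≡ suc j′ × NoCover (σ₀ · m ℕ.* σ₀ · gg ℕ.^ j′) o) → Before ∣ O ∣ (σ₀ · gg) j
          bound (inj₁ e) = inj₁ e
          bound (inj₂ (j′ , e , none)) = inj₂ (j′ , e , noCover⇒<n 0≤o none′ , λ D dbl → noCover⇒≤ O D 0≤o reaches dbl none′)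
            where
            none′ : NoCover (σ₀ · gg ℕ.^ j′) o
            none′ = subst (λ q → NoCover q o) (trans (cong (ℕ._* σ₀ · gg ℕ.^ j′) m≡1) (ℕₚ.*-identityˡ _)) none
          fm≡ : final · m ≡ σ₀ · gg ℕ.^ j
          fm≡ = trans m≡ (trans (cong (ℕ._* σ₀ · gg ℕ.^ j) m≡1) (ℕₚ.*-identityˡ _))
          solution : ∀ α → o + o + o ≤ α * o →
            ∃[ M ] M ≡ suc (σ₀ · gg ℕ.^ j) ℕ.* W × Solution (main G) α M (suc (suc j ℕ.* 2 ℕ.+ 0))
          solution α 3o≤ = with-memory _ refl its
            where
            with-memory : ∀ M → M ≡ suc (final · m) ℕ.* W → Iterates iterRun M (suc j) σ₀ final →
              ∃[ M ] M ≡ suc (σ₀ · gg ℕ.^ j) ℕ.* W × Solution (main G) α M (suc (suc j ℕ.* 2 ℕ.+ 0))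
            with-memory M M≡ its = M , trans M≡ (cong (λ k → suc k ℕ.* W) fm≡) ,
              finish (setup G) iteration cleanup iterRun is wf-setup refl cleanupW′ eq opt M≡
                (subst (λ σ → Iterates iterRun M (suc j) σ final) σ₀≡ its) accepted sz≡ 3o≤

        enough : n ℕ.≤ σ₀ · m ℕ.* σ₀ · gg ℕ.^ n
        enough = subst (n ℕ.≤_) (sym (trans (cong (ℕ._* σ₀ · gg ℕ.^ n) m≡1) (ℕₚ.*-identityˡ _)))
          (ℕₚ.≤-trans (n≤2^n n) (ℕₚ.^-monoˡ-≤ n (Good⇒2≤ gd)))

      attempt : Attempt ∣ O ∣
      attempt = go (allFin n) refl (length-tabulate {n = n} id)
        where
        go : ∀ L₀ → allFin n ≡ L₀ → length L₀ ≡ n → Attempt ∣ O ∣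
        go [] eq len = contradiction z<n (subst (λ e → ¬ z ℕ.< e) len λ ())
        go (p ∷ L) eq len = start (run (setup G) (firstState p (suc (length L)))) refl
            (ready (firstState p (suc (length L)))
              (trans (firstState-nn (suc (length L)) _) (trans (ℕₚ.+-identityʳ _) len))
              (iterate-frame (run (nn ≔ ! nn ⊕ # 1)) sz 0 (λ _ → refl) (suc (length L)) (upd sz 0 1 (state λ z _ → blank p z))))
          where
          start : ∀ σ₀ → σ₀ ≡ run (setup G) (firstState p (suc (length L))) → Ready σ₀ × Good (σ₀ · gg) × σ₀ · m ≡ 1 → Attempt ∣ O ∣
          start σ₀ σ₀≡ (rdy , gd , m≡1) = ran (rounds O feasible o 0≤o reaches optimal iterRun (iter-outcome O feasible o 0≤o reaches optimal)
                 n σ₀ rdy (ℕₚ.<⇒≤ (Good⇒2≤ gd)) (enough eq σ₀ σ₀≡ gd m≡1))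
            where
            ran : (∃[ j ] RunFrom j σ₀) → Attempt ∣ O ∣
            ran (j , r) = run⇒attempt eq σ₀ σ₀≡ gd m≡1 r

-- Arithmetic of the bounds on passes and memory.

module Bounds (R : Reals) where
  open Reals R
  open RealLemmas R

  1≤*⁺ : ∀ {x y} → 1# ≤ x → 1# ≤ y → 1# ≤ x * y
  1≤*⁺ {x} {y} p q = subst (_≤ x * y) (*-identityˡ 1#) (*-mono-≤ 0≤1 (≤-trans 0≤1 p) p q)

  x≤y*x : ∀ {x y} → 0# ≤ x → 1# ≤ y → x ≤ y * x
  x≤y*x {x} {y} 0≤x 1≤y = subst (_≤ y * x) (*-identityˡ x) (*-monoˡ-≤ 0≤x 1≤y)

  1≤1/ : ∀ {x} → 0# < x → x < 1# → 1# ≤ 1# / x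
  1≤1/ {x} pos (le , _) = subst (1# ≤_) (sym (*-identityˡ (x ⁻¹))) (1≤⁻¹ pos le)

  log₂-pow : ∀ g k → 1 ℕ.≤ g → log₂ (real (g ℕ.^ k)) ≡ real k * log₂ (real g)
  log₂-pow g zero    1≤g = trans (cong log₂ real-1) (trans log₂-1 (sym (zeroˡ _)))
  log₂-pow g (suc k) 1≤g = begin
    log₂ (real (g ℕ.* g ℕ.^ k))              ≡⟨ cong log₂ (real-* g (g ℕ.^ k)) ⟩
    log₂ (real g * real (g ℕ.^ k))           ≡⟨ log₂-* (pos 1≤g) (pos (ℕₚ.m^n>0 g {{ℕ.>-nonZero 1≤g}} k)) ⟩
    log₂ (real g) + log₂ (real (g ℕ.^ k))    ≡⟨ cong₂ _+_ (sym (*-identityˡ _)) (log₂-pow g k 1≤g) ⟩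
    1# * log₂ (real g) + real k * log₂ (real g) ≡⟨ distribʳ _ 1# (real k) ⟨
    real (suc k) * log₂ (real g)             ∎
    where
    open ≡-Reasoning
    pos : ∀ {l} → 1 ℕ.≤ l → 0# < real l
    pos le = <-≤⇒< 0<1 (1≤real le)

  log₂-2^ : ∀ k → log₂ (real (2 ℕ.^ k)) ≡ real k
  log₂-2^ k = trans (log₂-pow 2 k (s≤s z≤n)) (trans (cong (real k *_) log₂-2) (*-identityʳ _))

  -- Descends from an Archimedean bound to the least natural number above x. This is at most x + 1,
  -- hence at most 2x as x ≥ 1.
  ceiling : ∀ x → 1# ≤ x → ∃[ q ] 1 ℕ.≤ q × x ≤ real q × real q ≤ real 2 * x
  ceiling x 1≤x = go (proj₁ (archimedean x)) (proj₂ (archimedean x))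
    where
    go : ∀ q → x ≤ real q → ∃[ q ] 1 ℕ.≤ q × x ≤ real q × real q ≤ real 2 * x
    go zero    le = contradiction (≤-trans 1≤x le) 1≰0
    go (suc q) le with x ≤? real q
    ... | yes le′ = go q le′
    ... | no ¬le  = suc q , s≤s z≤n , le ,
      subst (real (suc q) ≤_) (trans (sym (double x)) (*-comm x (real 2))) (+-mono-≤ 1≤x (≰⇒≥ ¬le))

  module _ {ε δ} (0<ε : 0# < ε) (ε<1 : ε < 1#) (0<δ : 0# < δ) (δ<1 : δ < 1#) where

    c : ℝ
    c = (real 2 + δ) * real 14 * (real 3 + ε)

    space : ℕ → ℕ → ℝ → ℝ
    space k z D = 1# / δ * log⁺ (1# / δ) * real (k ℕ.+ z) * (c / ε) ^ D

    real-64≤c/ε : real 64 ≤ c / ε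
    real-64≤c/ε = ≤-trans (real-mono {64} {84} (ℕₚ.m≤m+n 64 20)) (≤-trans 84≤c
      (subst (_≤ c / ε) (*-identityʳ c) (*-monoʳ-≤ (≤-trans (0≤real 84) 84≤c) (1≤⁻¹ 0<ε (proj₁ ε<1)))))
      where
      84≤c : real 84 ≤ c
      84≤c = subst (_≤ c) (trans (cong (_* real 3) (sym (real-* 2 14))) (sym (real-* 28 3)))
        (*-mono-≤ (0≤real 3) (*-nonNegative (+-nonNegative (0≤real 2) (proj₁ 0<δ)) (0≤real 14))
          (*-monoˡ-≤ (0≤real 14) (x≤x+y (proj₁ 0<δ))) (x≤x+y (proj₁ 0<ε)))

    clusters≤space : ∀ k z {D} → 0# ≤ D → real (k ℕ.+ z) * exp₂ (real 6 * D) ≤ space k z D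
    clusters≤space k z {D} 0≤D = *-mono-≤ (proj₁ (exp₂>0 _)) (*-nonNegative (≤-trans 0≤1 1≤front) (0≤real (k ℕ.+ z)))
      (x≤y*x (0≤real (k ℕ.+ z)) 1≤front)
      (exp₂-mono (subst (_≤ D * log₂ (c / ε)) (*-comm D (real 6)) (*-monoʳ-≤ 0≤D
        (subst (_≤ log₂ (c / ε)) (log₂-2^ 6) (log₂-mono-≤ (<-≤⇒< 0<1 (1≤real {64} (s≤s z≤n))) real-64≤c/ε)))))
      where
      1≤front : 1# ≤ 1# / δ * log⁺ (1# / δ)
      1≤front = 1≤*⁺ (1≤1/ 0<δ δ<1) (1≤log⁺ _)

  -- There are x + 1 ≤ 2x rows of 43 words, and x ≤ 2y; 43 · 2 · 2 = 172 is the origin of the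
  -- constant K.
  memory : ∀ {x y} → 1 ℕ.≤ x → real x ≤ real 2 * y → real (suc x ℕ.* 43) ≤ real 172 * y
  memory {x} {y} 1≤x le = ≤-trans (real-mono (ℕₚ.*-monoˡ-≤ 43 (ℕₚ.+-monoˡ-≤ x 1≤x)))
    (subst₂ _≤_ (sym eq) (trans (sym (*-assoc (real 86) (real 2) y)) (cong (_* y) (sym (real-* 86 2))))
      (*-monoʳ-≤ (0≤real 86) le))
    where
    eq : real ((x ℕ.+ x) ℕ.* 43) ≡ real 86 * real x
    eq = trans (cong real (trans (cong (ℕ._* 43) (trans (cong (x ℕ.+_) (sym (ℕₚ.+-identityʳ x))) (ℕₚ.*-comm 2 x)))
           (trans (ℕₚ.*-assoc x 2 43) (ℕₚ.*-comm x 86)))) (real-* 86 x)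

  weaken-constant : ∀ {k l} → k ℕ.≤ l → ∀ {x} → 0# ≤ x → real k * x ≤ real l * x
  weaken-constant le 0≤x = *-monoˡ-≤ 0≤x (real-mono le)

  -- The 3 + 2j passes number at most 15x; the constant is raised to that of `memory` so that a
  -- single K serves both bounds.
  passes : ∀ j {x} → 1# ≤ x → real j ≤ real 6 * x → real (suc (suc j ℕ.* 2 ℕ.+ 0)) ≤ real 172 * x
  passes j {x} 1≤x le = ≤-trans (≤-reflexive (cong real (cong suc (ℕₚ.+-identityʳ (suc j ℕ.* 2)))))
    (≤-trans (≤-reflexive (trans (real-+ 3 (j ℕ.* 2)) (cong (real 3 +_) (real-* j 2))))
    (≤-trans (+-mono-≤ (subst (_≤ real 3 * x) (*-identityʳ _) (*-monoʳ-≤ (0≤real 3) 1≤x)) (*-monoˡ-≤ (0≤real 2) le))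
    (subst (_≤ real 172 * x) eq (weaken-constant {15} {172} (ℕₚ.m≤m+n 15 157) (≤-trans 0≤1 1≤x)))))
    where
    eq : real 15 * x ≡ real 3 * x + real 6 * x * real 2
    eq = trans (cong (_* x) (trans (real-+ 3 12) (cong (real 3 +_) (real-* 6 2))))
      (trans (distribʳ x (real 3) (real 6 * real 2)) (cong (real 3 * x +_)
        (trans (*-assoc _ _ _) (trans (cong (real 6 *_) (*-comm (real 2) x)) (sym (*-assoc _ _ _))))))

  three : ∀ {ε o} → 0# ≤ ε → 0# ≤ o → o + o + o ≤ (real 3 + ε) * o
  three {ε} {o} 0≤ε 0≤o = ≤-trans (≤-reflexive eq) (*-monoˡ-≤ 0≤o (x≤x+y 0≤ε))
    where
    eq : o + o + o ≡ real 3 * o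
    eq = trans (+-comm (o + o) o) (sym (trans (distribʳ o 1# (real 2))
      (cong₂ _+_ (*-identityˡ o) (trans (*-comm (real 2) o) (double o)))))

-- The two programs and their bounds.

module Assembly (R : Reals) where
  open Reals R
  open RKC R
  open Streaming R
  open RealLemmas R
  open Bounds R
  open AlgorithmRuns R

  module _ (I : Instance) {D : ℝ} (dbl : Doubling I D) where
    open Instance I
    open Costs R I

    -- Even a ball of radius 0 contains its centre, so covering it takes at least one ball, and 1 ≤
    -- 2 ^ D.
    0≤D : 0# ≤ D
    0≤D = let T , ∣T∣≤ , cov = dbl i₀ 0# ≤-refl
              c , c∈ , _ = cov i₀ (≤-reflexive (Metric.≈⇒0 refl))
          in subst₂ _≤_ log₂-1 (log₂-exp₂ D) (log₂-mono-≤ 0<1 (≤-trans (1≤real (ℕₚ.≤-trans (s≤s z≤n) (x∈p⇒∣p-x∣<∣p∣ c∈))) ∣T∣≤))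
      where
      i₀ : Fin n
      i₀ = fromℕ< z<n

  module _ (I : Instance) {k : ℕ} (min : MinOptimalCardinality I k) where
    open Instance I
    open Costs R I
    open Solving R I

    -- An optimal solution has a real cost, which the empty set has not.
    1≤k : 1 ℕ.≤ k
    1≤k = let (O , (_ , o , cost , _) , ∣O∣≡k) , _ = min
              X , large , near = cost⇒reaches O o cost
              i , i∈ = large-nonempty X large
              c , c∈ , _ = near i i∈
          in subst (1 ℕ.≤_) ∣O∣≡k (ℕₚ.≤-trans (s≤s z≤n) (x∈p⇒∣p-x∣<∣p∣ c∈))

    record Solved (Good : ℕ → Set) (P : Program) : Set where
      field
        multiplier′ : ℕ
        rounds′     : ℕ
        is-good     : Good multiplier′
        before      : Before k multiplier′ rounds′
        solves      : ∀ {ε T W₀} → 0# ≤ ε →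
                      real (suc (suc rounds′ ℕ.* 2 ℕ.+ 0)) ≤ T → real (suc (multiplier′ ℕ.^ rounds′) ℕ.* 43) ≤ W₀ →
                      Solves P I (real 3 + ε) T W₀

    solved : ∀ G (Good : ℕ → Set) → (∀ {g} → Good g → 2 ℕ.≤ g) →
      wf (setup G) ≡ true → touches G m ≡ false → touches G acc ≡ false → touches G nn ≡ false → touches G sz ≡ false →
      (∀ σ → RunsSpec._·_ I σ nn ≡ n → Good (RunsSpec._·_ I (RunsSpec.run I G σ) gg)) → Solved Good (main G)
    solved G Good 2≤ wf-ok m∉ acc∉ nn∉ sz∉ good = pack min
      where
      pack : MinOptimalCardinality I k → Solved Good (main G)
      pack ((O , (feasible , o , cost , opt) , refl) , _) =
        build (attempt G Good 2≤ wf-ok m∉ acc∉ nn∉ sz∉ good O feasible o cost opt)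
        where
        build : Attempt G Good 2≤ wf-ok m∉ acc∉ nn∉ sz∉ good O feasible o cost opt ∣ O ∣ → Solved Good (main G)
        build (g , j , gd , bf , sol) = record
          { multiplier′ = g ; rounds′ = j ; is-good = gd ; before = bf
          ; solves = λ {ε} 0≤ε T-ok W-ok →
              let M , M≡ , μ , ex , approx = sol (real 3 + ε) (three 0≤ε (0≤o G Good 2≤ wf-ok m∉ acc∉ nn∉ sz∉ good O feasible o cost opt))
              in M , _ , μ , ex , approx , T-ok , subst (λ M → real M ≤ _) (sym M≡) W-ok }

    module _ {D : ℝ} (dbl : Doubling I D) where

      clusters : ℝ
      clusters = real (k ℕ.+ z) * exp₂ (real 6 * D)

      1≤clusters : 1# ≤ clusters
      1≤clusters = 1≤*⁺ (1≤real (ℕₚ.≤-trans 1≤k (ℕₚ.m≤m+n k z))) (1≤exp₂ (*-nonNegative (0≤real 6) (0≤D I dbl)))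

      -- The accepted guess is g times the last rejected one. Here `u` is 1 in part (i) and n ^ η in
      -- part (ii).
      power≤ : ∀ {g j u} → Before k g j → real g ≤ real 2 * u → 1# ≤ u → real (g ℕ.^ j) ≤ real 2 * (u * clusters)
      power≤ {u = u} (inj₁ refl) g≤ 1≤u = ≤-trans (≤-reflexive real-1)
        (1≤*⁺ (1≤real {2} (s≤s z≤n)) (1≤*⁺ 1≤u 1≤clusters))
      power≤ {g} {u = u} (inj₂ (j , refl , _ , few)) g≤ 1≤u = ≤-trans (≤-reflexive (real-* g (g ℕ.^ j)))
        (≤-trans (*-mono-≤ (0≤real (g ℕ.^ j)) (*-nonNegative (0≤real 2) (≤-trans 0≤1 1≤u)) g≤ (few D dbl))
          (≤-reflexive (*-assoc (real 2) u clusters)))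

      -- The logarithm of the bound on the rejected guess 2 ^ (j - 1). The term 6 D is the logarithm
      -- of 64 ^ D, and the lone 1 is absorbed by `log⁺`.
      rounds≤ : ∀ {j} e → 0# < e → e < 1# → Before k 2 j → real j ≤ real 6 * (log⁺ (real (k ℕ.+ z)) + D * log⁺ (1# / e))
      rounds≤ {j} e 0<e e<1 bf = ≤-trans (j≤ bf) (≤-trans (+-mono-≤ (≤-trans (+-mono-≤ (1≤log⁺ _) (log₂≤log⁺ _)) 2a≤6a) (*-monoʳ-≤ (0≤real 6) D≤b′))
          (≤-reflexive (sym (distribˡ (real 6) a′ b′))))
        where
        a′ b′ : ℝ
        a′ = log⁺ (real (k ℕ.+ z))
        b′ = D * log⁺ (1# / e)
        0<k+z : 0# < real (k ℕ.+ z)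
        0<k+z = <-≤⇒< 0<1 (1≤real (ℕₚ.≤-trans 1≤k (ℕₚ.m≤m+n k z)))
        0≤log : 0# ≤ log₂ (real (k ℕ.+ z))
        0≤log = 0≤log₂ (1≤real (ℕₚ.≤-trans 1≤k (ℕₚ.m≤m+n k z)))
        D≤b′ : D ≤ b′
        D≤b′ = subst (_≤ b′) (*-identityʳ D) (*-monoʳ-≤ (0≤D I dbl) (1≤log⁺ _))
        2a≤6a : a′ + a′ ≤ real 6 * a′
        2a≤6a = subst (_≤ real 6 * a′) (trans (*-comm (real 2) a′) (double a′))
          (weaken-constant {2} {6} (ℕₚ.m≤m+n 2 4) (≤-trans 0≤1 (1≤log⁺ _)))
        0≤6D : 0# ≤ real 6 * D
        0≤6D = *-nonNegative (0≤real 6) (0≤D I dbl)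
        j≤ : Before k 2 j → real j ≤ 1# + log₂ (real (k ℕ.+ z)) + real 6 * D
        j≤ (inj₁ refl) = +-nonNegative (+-nonNegative 0≤1 0≤log) 0≤6D
        j≤ (inj₂ (j′ , refl , _ , few)) = subst (real (suc j′) ≤_) (sym (+-assoc 1# _ _)) (+-monoʳ-≤ 1#
          (subst₂ _≤_ (log₂-2^ j′) (trans (log₂-* 0<k+z (exp₂>0 _)) (cong (log₂ (real (k ℕ.+ z)) +_) (log₂-exp₂ _)))
            (log₂-mono-≤ (<-≤⇒< 0<1 (1≤real (ℕₚ.m^n>0 2 j′))) (few D dbl))))

  module _ (I : Instance) where
    open Instance I
    open Solving R I
    open RunsSpec I using (IsMultiplier)

    -- If g exceeds 2, then g′ = g - 1 satisfies g′ ^ q < n. Since 1 ≤ q η, taking logarithms gives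
    -- g′ ≤ n ^ η, and g ≤ 2 g′.
    root≤ : ∀ {q g η} → 0# < η → 1# ≤ real q * η → IsMultiplier q g → real g ≤ real 2 * real n ^ η
    root≤ {q} {g} {η} (0≤η , _) 1≤qη (_ , _ , low) = go low
      where
      1≤n : 1 ℕ.≤ n
      1≤n = ℕₚ.≤-trans (s≤s z≤n) z<n
      1≤n^η : 1# ≤ real n ^ η
      1≤n^η = 1≤exp₂ (*-nonNegative 0≤η (0≤log₂ (1≤real 1≤n)))
      go : g ≡ 2 ⊎ (∃[ g′ ] g ≡ suc g′ × 1 ℕ.≤ g′ × g′ ℕ.^ q ℕ.< n) → real g ≤ real 2 * real n ^ η
      go (inj₁ refl) = subst (_≤ real 2 * real n ^ η) (*-identityʳ (real 2)) (*-monoʳ-≤ (0≤real 2) 1≤n^η)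
      go (inj₂ (g′ , refl , 1≤g′ , lt)) = ≤-trans (+-monoˡ-≤ (real g′) (1≤real 1≤g′))
        (subst (real g′ + real g′ ≤_) (trans (sym (double _)) (*-comm _ (real 2))) (+-mono-≤ g′≤ g′≤))
        where
        logs : log₂ (real g′) ≤ η * log₂ (real n)
        logs = ≤-trans (subst (_≤ log₂ (real g′) * (real q * η)) (*-identityʳ _) (*-monoʳ-≤ (0≤log₂ (1≤real 1≤g′)) 1≤qη))
          (subst (_≤ η * log₂ (real n)) (trans (*-comm η _) (trans (cong (_* η) (trans (log₂-pow g′ q 1≤g′) (*-comm _ _))) (*-assoc _ _ _)))
            (*-monoʳ-≤ 0≤η (log₂-mono-≤ (<-≤⇒< 0<1 (1≤real (ℕₚ.m^n>0 g′ {{ℕ.>-nonZero 1≤g′}} q))) (real-mono (ℕₚ.<⇒≤ lt)))))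
        g′≤ : real g′ ≤ real n ^ η
        g′≤ = subst (_≤ real n ^ η) (exp₂-log₂ (<-≤⇒< 0<1 (1≤real 1≤g′))) (exp₂-mono logs)

    -- A rejected guess is below n, which is at most g ^ q; its exponent j - 1 is therefore below q.
    rounds≤q : ∀ {k q g j} → IsMultiplier q g → Before k g j → j ℕ.≤ q
    rounds≤q _ (inj₁ refl) = z≤n
    rounds≤q {q = q} {g} (2≤g , n≤ , _) (inj₂ (j , refl , lt , _)) =
      ℕₚ.≰⇒> λ q≤j → ℕₚ.<⇒≱ lt (ℕₚ.≤-trans n≤ (ℕₚ.^-monoʳ-≤ g {{ℕ.>-nonZero (ℕₚ.<⇒≤ 2≤g)}} q≤j))

  doubling : HCmd
  doubling = gg ≔ # 2

  -- With q = ⌈ 1 / η ⌉ the guesses exceed n after q multiplications by the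
  -- least g with g ^ q ≥ n, and g ≤ 2 n ^ η.
  rooting : ℕ → HCmd
  rooting q = old ≔ # q ⨟ multiplier

  part-i : ∀ {ε δ} (0<ε : 0# < ε) (ε<1 : ε < 1#) (0<δ : 0# < δ) (δ<1 : δ < 1#) I k D →
    let open Instance I in MinOptimalCardinality I k → Doubling I D →
    Solves (main doubling) I (real 3 + ε) (real 172 * (log⁺ (real (k ℕ.+ z)) + D * log⁺ (1# / ε)))
      (real 172 * space 0<ε ε<1 0<δ δ<1 k z D)
  part-i {ε} {δ} 0<ε ε<1 0<δ δ<1 I k D min dbl =
    conclude (solved I min doubling (_≡ 2) (λ { refl → ℕₚ.≤-refl }) refl refl refl refl refl (λ _ _ → refl))
    where
    open Instance I
    conclude : Solved I min (_≡ 2) (main doubling) →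
      Solves (main doubling) I (real 3 + ε) (real 172 * (log⁺ (real (k ℕ.+ z)) + D * log⁺ (1# / ε)))
        (real 172 * space 0<ε ε<1 0<δ δ<1 k z D)
    conclude s = solves (proj₁ 0<ε)
      (passes rounds′ 1≤X (rounds≤ I min dbl ε 0<ε ε<1 (subst (λ g → Solving.Before R I k g rounds′) is-good before)))
      (memory (ℕₚ.m^n>0 multiplier′ {{ℕ.>-nonZero (subst (1 ℕ.≤_) (sym is-good) (s≤s z≤n))}} rounds′)
        (≤-trans (power≤ I min dbl before (≤-reflexive (trans (cong real is-good) (sym (*-identityʳ (real 2))))) ≤-refl)
          (*-monoʳ-≤ (0≤real 2) (subst (_≤ space 0<ε ε<1 0<δ δ<1 k z D) (sym (*-identityˡ _)) (clusters≤space 0<ε ε<1 0<δ δ<1 k z (0≤D I dbl))))))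
      where
      open Solved s
      1≤X : 1# ≤ log⁺ (real (k ℕ.+ z)) + D * log⁺ (1# / ε)
      1≤X = ≤-trans (1≤log⁺ _) (x≤x+y (*-nonNegative (0≤D I dbl) (≤-trans 0≤1 (1≤log⁺ _))))

  part-ii : ∀ {ε δ} (0<ε : 0# < ε) (ε<1 : ε < 1#) (0<δ : 0# < δ) (δ<1 : δ < 1#) {η} → 0# < η → η < 1# →
    ∃[ P ] ∀ I k D → let open Instance I in MinOptimalCardinality I k → Doubling I D →
    Solves P I (real 3 + ε) (real 172 * (1# / η)) (real 172 * (real n ^ η * space 0<ε ε<1 0<δ δ<1 k z D))
  part-ii {ε} {δ} 0<ε ε<1 0<δ δ<1 {η} 0<η η<1 = choose′ (ceiling (1# / η) (1≤1/ 0<η η<1))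
    where
    choose′ : ∃[ q ] 1 ℕ.≤ q × 1# / η ≤ real q × real q ≤ real 2 * (1# / η) → _
    -- `q` depends on η alone, so it can be a literal of a program that serves all instances.
    choose′ (q , 1≤q , low , high) = main (rooting q) , λ I k D min dbl → conclude I k D min dbl
      (solved I min (rooting q) (RunsSpec.IsMultiplier I q) proj₁ refl refl refl refl refl
        (λ σ nn≡ → RunsSpec.run-wp (RunsSpec.multiplierW I (RunsSpec.upd I old 0 q σ) 1≤q nn≡)))
      where
      1≤qη : 1# ≤ real q * η
      1≤qη = subst (_≤ real q * η) (trans (cong (_* η) (*-identityˡ _)) (trans (*-comm _ η) (*-inverse 0<η)))
        (*-monoˡ-≤ (proj₁ 0<η) low)
      conclude : ∀ I k D → let open Instance I in (min : MinOptimalCardinality I k) → Doubling I D →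
        Solved I min (RunsSpec.IsMultiplier I q) (main (rooting q)) →
        Solves (main (rooting q)) I (real 3 + ε) (real 172 * (1# / η)) (real 172 * (real n ^ η * space 0<ε ε<1 0<δ δ<1 k z D))
      conclude I k D min dbl s = solves (proj₁ 0<ε)
        (passes rounds′ (1≤1/ 0<η η<1) (≤-trans (real-mono (rounds≤q I {k} {q} is-good before))
          (≤-trans high (weaken-constant {2} {6} (ℕₚ.m≤m+n 2 4) (≤-trans 0≤1 (1≤1/ 0<η η<1))))))
        (memory (ℕₚ.m^n>0 multiplier′ {{ℕ.>-nonZero (ℕₚ.<⇒≤ (proj₁ is-good))}} rounds′)
          (≤-trans (power≤ I min dbl before (root≤ I {q = q} 0<η 1≤qη is-good) 1≤n^η)
            (*-monoʳ-≤ (0≤real 2) (*-monoʳ-≤ (≤-trans 0≤1 1≤n^η) (clusters≤space 0<ε ε<1 0<δ δ<1 k z (0≤D I dbl))))))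
        where
        open Instance I
        open Solved s
        1≤n^η : 1# ≤ real n ^ η
        1≤n^η = 1≤exp₂ (*-nonNegative (proj₁ 0<η) (0≤log₂ (1≤real (ℕₚ.≤-trans (s≤s z≤n) z<n))))

theorem5p4 : (R : Reals) →
    let open Reals R
        open RKC R
        open Streaming R
    in
    -- K is the constant hidden by the O-notation.
    ∃[ K ] ∀ (ε δ : ℝ) → 0# < ε → ε < 1# → 0# < δ → δ < 1# →
    let c : ℝ
        c = (real 2 + δ) * real 14 * (real 3 + ε)

        space : ℕ → ℕ → ℝ → ℝ
        space k z D = 1# / δ * log⁺ (1# / δ) * real (k ℕ.+ z) * (c / ε) ^ D
    in
    (∃[ P ] ∀ (I : Instance) (k : ℕ) (D : ℝ) →
      let open Instance I in
      MinOptimalCardinality I k → DoublingDimension I D →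
      Solves P I (real 3 + ε)
        (K * (log⁺ (real (k ℕ.+ z)) + D * log⁺ (1# / ε)))
        (K * space k z D))
    ×
    (∀ (η : ℝ) → 0# < η → η < 1# →
     ∃[ P ] ∀ (I : Instance) (k : ℕ) (D : ℝ) →
      let open Instance I in
      MinOptimalCardinality I k → DoublingDimension I D →
      Solves P I (real 3 + ε)
        (K * (1# / η))
        (K * (real n ^ η * space k z D)))
theorem5p4 R = Reals.real R 172 , λ ε δ 0<ε ε<1 0<δ δ<1 →
  (AlgorithmRuns.main R (doubling R) , λ I k D min dim → part-i R 0<ε ε<1 0<δ δ<1 I k D min (proj₁ dim)) ,
  λ η 0<η η<1 → let P , solves = part-ii R 0<ε ε<1 0<δ δ<1 0<η η<1 in
    P , λ I k D min dim → solves I k D min (proj₁ dim)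
  where open Assembly
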